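{- Let $G$ be a finite connected graph (loops and multiple edges allowed) whose first Betti number equals $2g$, for some integer $g\ge 0$. Then the number of $1$-faced embeddings of $G$, divided by the total number of embeddings of $G$, equals the sum of the weights of all decorations of $G$.
   Context: Each edge of $G$ consists of two half-edges; a loop contributes two half-edges at its vertex. An embedding of $G$ is the choice, at every vertex, of a cyclic order of the half-edges incident to it. Equivalently, it is a cellular embedding into a closed oriented surface, considered up to orientation-preserving homeomorphism compatible with $G$. If the vertices have valencies $k_1,\dots,k_n$, there are $\prod_i (k_i-1)!$ embeddings. The faces of an embedding are defined as follows. Let $\iota$ be the involution on half-edges exchanging the two halves of each edge, and let $\rho$ send each half-edge to its successor in the cyclic order at its vertex. The faces are the cycles of the permutation $\rho\circ\iota$. An embedding is $1$-faced if there is exactly one face; equivalently, the surface has genus $g$. A decoration of $G$ consists of the following data: - a choice of some vertices $v$ of $G$; - for each chosen vertex $v$, a choice of a set of $k_v$ half-edges incident to $v$, where $k_v$ is a positive even integer. These choices must satisfy $\sum_v k_v=2g$. They must also satisfy: if the chosen half-edges are erased from $G$ (viewed as a topological space, removing each chosen half-edge except its endpoint at the vertex), the remaining space is contractible. The weight of a decoration is $\frac{1}{2^{2g}}\prod_v\frac{1}{k_v+1}$. -}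

module Defs where

open import Data.Nat as ℕ using (ℕ; zero; suc; _≤_; _∸_)
open import Data.Nat.Divisibility using (_∣_)
open import Data.Integer using (+_)
open import Data.Fin using (Fin; _↑ˡ_; _↑ʳ_; splitAt; _≟_)
open import Data.Fin.Subset using (Subset)
open import Data.Sum using (_⊎_; inj₁; inj₂; [_,_]′)
open import Data.Product using (_×_; _,_; proj₁; proj₂; ∃)
open import Data.Bool using (Bool; true; false; not; _∧_; if_then_else_)
open import Data.Vec using (Vec; lookup)
open import Data.List using (List; []; _∷_; foldr; map; allFin)
open import Data.Rational as ℚ using (ℚ; _/_)
open import Relation.Nullary.Decidable using (⌊_⌋)
open import Relation.Binary.PropositionalEquality using (_≡_)

-- Finite graphs with loops and multiple edges.
-- Vertices are Fin n, edges are Fin m, each edge has an (ordered) pair of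
-- endpoints.  Edge e has two half-edges:  e ↑ˡ m  (at proj₁ (ends e))
-- and  m ↑ʳ e  (at proj₂ (ends e)).  A loop has both ends equal, so it
-- contributes two half-edges at its vertex.

record Graph : Set where
  field
    n    : ℕ
    m    : ℕ
    ends : Fin m → Fin n × Fin n

module _ (G : Graph) where
  open Graph G

  HalfEdge : Set
  HalfEdge = Fin (m ℕ.+ m)

  ι : HalfEdge → HalfEdge
  ι h = [ (λ e → m ↑ʳ e) , (λ e → e ↑ˡ m) ]′ (splitAt m h)

  vert : HalfEdge → Fin n
  vert h = [ (λ e → proj₁ (ends e)) , (λ e → proj₂ (ends e)) ]′ (splitAt m h)

  data Reach (keep : Fin m → Bool) : Fin n → Fin n → Set where
    here : ∀ {u} → Reach keep u u
    fwd  : ∀ {w} (e : Fin m) → keep e ≡ true →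
           Reach keep (proj₂ (ends e)) w → Reach keep (proj₁ (ends e)) w
    bwd  : ∀ {w} (e : Fin m) → keep e ≡ true →
           Reach keep (proj₁ (ends e)) w → Reach keep (proj₂ (ends e)) w

  ConnectedVia : (Fin m → Bool) → Set
  ConnectedVia keep = ∀ u v → Reach keep u v

  countEdges : (Fin m → Bool) → ℕ
  countEdges keep = foldr (λ e acc → if keep e then suc acc else acc) 0 (allFin m)

  IsSpanningTree : (Fin m → Bool) → Set
  IsSpanningTree keep = ConnectedVia keep × (countEdges keep ℕ.+ 1 ≡ n)

  Connected : Set
  Connected = (1 ≤ n) × ConnectedVia (λ _ → true)

  -- first Betti number of a connected graph: m - n + 1
  firstBetti : ℕ
  firstBetti = (m ℕ.+ 1) ∸ n

  -- Embeddings: a permutation ρ of the half-edges, preserving vertices and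
  -- acting as a single cycle on the half-edges at each vertex (i.e. a
  -- cyclic order at every vertex).  Permutations are stored as vectors
  -- (so that equality is decidable / extensional).

  Perm : Set
  Perm = Vec HalfEdge (m ℕ.+ m)

  apply : Perm → HalfEdge → HalfEdge
  apply ρ h = lookup ρ h

  iter : (HalfEdge → HalfEdge) → ℕ → HalfEdge → HalfEdge
  iter f zero    h = h
  iter f (suc k) h = f (iter f k h)

  IsPermutation : Perm → Set
  IsPermutation ρ = ∀ h h' → apply ρ h ≡ apply ρ h' → h ≡ h'

  IsEmbedding : Perm → Set
  IsEmbedding ρ =
    IsPermutation ρ ×
    (∀ h → vert (apply ρ h) ≡ vert h) ×
    (∀ h h' → vert h ≡ vert h' → ∃ λ k → iter (apply ρ) k h ≡ h')

  facePerm : Perm → HalfEdge → HalfEdge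
  facePerm ρ h = apply ρ (ι h)

  OneFaced : Perm → Set
  OneFaced ρ = ∀ h h' → ∃ λ k → iter (facePerm ρ) k h ≡ h'

  -- Decorations, encoded as the set S of all chosen half-edges.
  -- k_v = number of chosen half-edges at v; v is chosen iff k_v > 0.

  Decoration : Set
  Decoration = Subset (m ℕ.+ m)

  kAt : Decoration → Fin n → ℕ
  kAt S v = foldr (λ h acc → if lookup S h ∧ ⌊ vert h ≟ v ⌋ then suc acc else acc)
                  0 (allFin (m ℕ.+ m))

  -- edges with neither half chosen: what remains (up to homotopy) after
  -- erasing the chosen half-edges
  remaining : Decoration → Fin m → Bool
  remaining S e = not (lookup S (e ↑ˡ m)) ∧ not (lookup S (m ↑ʳ e))

  sumOverVertices : (Fin n → ℕ) → ℕ
  sumOverVertices f = foldr (λ v acc → f v ℕ.+ acc) 0 (allFin n)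

  IsDecoration : ℕ → Decoration → Set
  IsDecoration g S =
    (∀ v → 2 ∣ kAt S v) ×
    (sumOverVertices (kAt S) ≡ 2 ℕ.* g) ×
    IsSpanningTree (remaining S)

  -- weight  2^{-2g} ∏_v 1/(k_v+1)   (unchosen vertices have k_v = 0, factor 1)
  weight : ℕ → Decoration → ℚ
  weight g S = powℚ ℚ.½ (2 ℕ.* g) ℚ.* prodℚ (map (λ v → + 1 / suc (kAt S v)) (allFin n))
    where
      powℚ : ℚ → ℕ → ℚ
      powℚ q zero    = ℚ.1ℚ
      powℚ q (suc k) = q ℚ.* powℚ q k
      prodℚ : List ℚ → ℚ
      prodℚ = foldr ℚ._*_ ℚ.1ℚ

sumℚ : List ℚ → ℚ
sumℚ = foldr ℚ._+_ ℚ.0ℚ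

-- The proof replaces counting by averaging. Attach a leaf at some vertex: the embedding is
-- 1-faced iff following the face permutation leads from every half-edge to the leaf, that is,
-- iff a functional graph on the half-edges is a rooted tree. As a function of the values of a
-- vertex rotation this indicator is alternating in a weak sense (Star below), and for such
-- functions the average over all cyclic orders of a set K is
--   Σ_{x ∈ K} Σ_{J ⊆ K ∖ x} (-1)^|J| / (|J| + 1) · g (J fixed, everything else mapped to x)
-- (cycles-sum below), where (-1)^j / (j + 1) is the integral of (- s)^j over [0, 1]. Doing this at
-- every vertex, the rooted configurations are the spanning trees together with a choice, for
-- each edge off the tree, of none or one of its halves. So the average is the integral over s of
-- the sum over spanning trees T of Π_{uv ∉ T} (1 - s_u - s_v). Substituting s = t + 1/2 turns the
-- factors into - t_u - t_v with t uniform on [-1/2, 1/2], and expanding the product gives the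
-- decorations, since t^k has mean 1 / (2^k (k + 1)) for even k and mean 0 for odd k.

module Submission where

open import Defs
open import Algebra.Bundles using (CommutativeMonoid)
open import Data.Bool as Bool using (Bool; true; false; if_then_else_; not; _∧_)
open import Data.Empty using (⊥; ⊥-elim)
open import Data.Fin as Fin using (Fin; zero; suc; _≟_; _↑ˡ_; _↑ʳ_; splitAt; join)
open import Data.Fin.Properties using (all?; any?; ¬∀⟶∃¬; pigeonhole; toℕ<n; toℕ-fromℕ<; suc-injective; splitAt-↑ˡ; splitAt-↑ʳ; join-splitAt; ↑ˡ-injective; ↑ʳ-injective)
import Data.Integer as ℤ
import Data.Integer.Properties as ℤP
open import Data.List as List using (List; []; _∷_; length; map; concatMap; _++_)
import Data.List.Membership.DecPropositional as DecMembership
open import Data.List.Membership.Propositional using (_∈_; _∉_; find; lose)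
open import Data.List.Membership.Propositional.Properties using (∈-++⁻; ∈-++⁺ˡ; ∈-++⁺ʳ; ∈-map⁺; ∈-map⁻; ∈-concatMap⁺; ∈-concatMap⁻; ∈-allFin; ∈-filter⁺; ∈-filter⁻)
open import Data.List.Membership.Propositional.Properties.WithK using (unique∧set⇒bag)
import Data.List.Properties as ListP
open import Data.List.Relation.Binary.BagAndSetEquality using (∼bag⇒↭)
open import Data.List.Relation.Binary.Permutation.Propositional as ↭ using (_↭_; refl; prep; swap; ↭-sym; ↭-trans; ↭⇒↭ₛ)
open import Data.List.Relation.Binary.Permutation.Propositional.Properties using (∈-resp-↭; All-resp-↭; ↭-length)
import Data.List.Relation.Binary.Permutation.Setoid.Properties as PermS
open import Data.List.Relation.Unary.All as All using (All; []; _∷_)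
open import Data.List.Relation.Unary.AllPairs using ([]; _∷_)
open import Data.List.Relation.Unary.Any using (here; there)
open import Data.List.Relation.Unary.Unique.Propositional using (Unique)
import Data.List.Relation.Unary.Unique.Propositional.Properties as UniqueP
open import Data.Nat as ℕ using (ℕ; zero; suc)
open import Data.Nat.Divisibility using (_∣_; _∣?_; _∣0; ∣-refl; ∣m∣n⇒∣m+n; ∣m+n∣m⇒∣n; ∣1⇒≡1)
import Data.Nat.Properties as ℕP
open import Data.Product using (_×_; _,_; proj₁; proj₂; ∃)
open import Data.Rational as ℚ using (ℚ; 0ℚ; 1ℚ; ½; _+_; _*_; _-_; -_)
import Data.Rational.Properties as ℚP
import Data.Rational.Unnormalised as ℚᵘ
import Data.Rational.Unnormalised.Properties as ℚᵘP
open import Data.Sum using (_⊎_; inj₁; inj₂; [_,_]′)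
open import Data.Vec as Vec using (Vec; []; _∷_; lookup; updateAt; _[_]≔_)
import Data.Vec.Properties as VecP
open VecP using () renaming (lookup∘updateAt to lookup-set; lookup∘updateAt′ to lookup-keep)
open import Function using (_∘_)
open import Function.Bundles using (_⇔_; mk⇔; module Equivalence)
open import Relation.Binary.PropositionalEquality using (_≡_; _≢_; refl; sym; trans; cong; cong₂; subst; subst₂; setoid; module ≡-Reasoning)
open import Relation.Nullary using (Dec; yes; no; ¬_; contradiction)
open import Relation.Nullary.Decidable using (dec⇒maybe; map′; _⊎-dec_; _×-dec_; ⌊_⌋)
open import Relation.Unary using (Decidable)
open import Tactic.RingSolver using (solve-∀)
open import Tactic.RingSolver.Core.AlmostCommutativeRing using (AlmostCommutativeRing; fromCommutativeRing)
open import Algebra.Properties.CommutativeSemigroup (CommutativeMonoid.commutativeSemigroup ℚP.+-0-commutativeMonoid) using () renaming (interchange to +-interchange; x∙yz≈y∙xz to +-swapˡ)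
open import Algebra.Properties.CommutativeSemigroup (CommutativeMonoid.commutativeSemigroup ℚP.*-1-commutativeMonoid) using () renaming (x∙yz≈y∙xz to *-swapˡ)
open import Algebra.Properties.CommutativeSemigroup ℕP.+-commutativeSemigroup using () renaming (interchange to ℕ-interchange)
open ≡-Reasoning

-- One-facedness is a property of permutations, but the averaging formula replaces a rotation by
-- assignments that are not permutations. The leaf provides an absorbing node, and "every node flows
-- to the root" makes sense for any assignment of values to rows. By the matrix-tree theorem this
-- indicator is a determinant: the row of a node `c` is the unit vector of `c` minus that of its
-- successor. Two rows carrying the same difference of unit vectors kill a determinant, which is the
-- weak alternation; below it is derived directly from the paths. Both the number of embeddings and
-- the number of 1-faced ones get multiplied by the number of places for the leaf, and this factor
-- is cancelled at the end. No integral is formed. A weight in `s` is represented by its sequence of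
-- moments, multiplication by `- s` shifts the sequence, and integration by parts is an identity
-- between reciprocals. The averaging formula is proved by inserting one element into a cyclic
-- order, and integration by parts is what makes the induction close.

ring : AlmostCommutativeRing _ _
ring = fromCommutativeRing ℚP.+-*-commutativeRing λ x → dec⇒maybe (0ℚ ℚP.≟ x)

-- Finite sums, and sums over the choice of one element of a list.

module _ {A : Set} where

  ∑ : List A → (A → ℚ) → ℚ
  ∑ xs f = sumℚ (map f xs)

  ∑-cong : ∀ xs {f g : A → ℚ} → (∀ {x} → x ∈ xs → f x ≡ g x) → ∑ xs f ≡ ∑ xs g
  ∑-cong [] h = refl
  ∑-cong (x ∷ xs) h = cong₂ _+_ (h (here refl)) (∑-cong xs (h ∘ there))

  ∑-+ : ∀ xs (f g : A → ℚ) → ∑ xs (λ x → f x + g x) ≡ ∑ xs f + ∑ xs g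
  ∑-+ [] f g = refl
  ∑-+ (x ∷ xs) f g rewrite ∑-+ xs f g = +-interchange (f x) (g x) (∑ xs f) (∑ xs g)

  ∑-* : ∀ xs k (f : A → ℚ) → ∑ xs (λ x → k * f x) ≡ k * ∑ xs f
  ∑-* [] k f = sym (ℚP.*-zeroʳ k)
  ∑-* (x ∷ xs) k f rewrite ∑-* xs k f = sym (ℚP.*-distribˡ-+ k (f x) (∑ xs f))

  ∑-0 : ∀ (xs : List A) → ∑ xs (λ _ → 0ℚ) ≡ 0ℚ
  ∑-0 [] = refl
  ∑-0 (x ∷ xs) = trans (ℚP.+-identityˡ _) (∑-0 xs)

  ∑-++ : ∀ xs ys (f : A → ℚ) → ∑ (xs ++ ys) f ≡ ∑ xs f + ∑ ys f
  ∑-++ [] ys f = sym (ℚP.+-identityˡ _)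
  ∑-++ (x ∷ xs) ys f rewrite ∑-++ xs ys f = sym (ℚP.+-assoc (f x) (∑ xs f) (∑ ys f))

  ∑-↭ : ∀ {xs ys} (f : A → ℚ) → xs ↭ ys → ∑ xs f ≡ ∑ ys f
  ∑-↭ f refl = refl
  ∑-↭ f (prep x p) = cong (f x +_) (∑-↭ f p)
  ∑-↭ f (swap {xs} {ys} x y p) rewrite ∑-↭ f p = +-swapˡ (f x) (f y) (∑ ys f)
  ∑-↭ f (↭.trans p q) = trans (∑-↭ f p) (∑-↭ f q)

module _ {A B : Set} where

  ∑-map : ∀ xs (h : A → B) (f : B → ℚ) → ∑ (map h xs) f ≡ ∑ xs (f ∘ h)
  ∑-map [] h f = refl
  ∑-map (x ∷ xs) h f = cong (f (h x) +_) (∑-map xs h f)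

  ∑-concatMap : ∀ xs (h : A → List B) (f : B → ℚ) → ∑ (concatMap h xs) f ≡ ∑ xs (λ x → ∑ (h x) f)
  ∑-concatMap [] h f = refl
  ∑-concatMap (x ∷ xs) h f = trans (∑-++ (h x) _ f) (cong (∑ (h x) f +_) (∑-concatMap xs h f))

  ∑-swap : ∀ xs ys (f : A → B → ℚ) → ∑ xs (λ x → ∑ ys (f x)) ≡ ∑ ys (λ y → ∑ xs (λ x → f x y))
  ∑-swap [] ys f = sym (∑-0 ys)
  ∑-swap (x ∷ xs) ys f = trans (cong (∑ ys (f x) +_) (∑-swap xs ys f)) (sym (∑-+ ys (f x) (λ y → ∑ xs (λ x → f x y))))

-- Recursive, so that the successor is `1ℚ + ⟦ k ⟧` by computation; `⟦⟧-/1` links it to the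
-- fractions of the theorem.
⟦_⟧ : ℕ → ℚ
⟦ zero ⟧ = 0ℚ
⟦ suc k ⟧ = 1ℚ + ⟦ k ⟧

Unique-resp-↭ : {A : Set} {xs ys : List A} → xs ↭ ys → Unique xs → Unique ys
Unique-resp-↭ p = PermS.Unique-resp-↭ (setoid _) (↭⇒↭ₛ p)

module _ {A : Set} where

  -- The summand also receives the list without the chosen element, so nested choices are at
  -- distinct positions.
  Sel : List A → (A → List A → ℚ) → ℚ
  Sel [] f = 0ℚ
  Sel (x ∷ xs) f = f x xs + Sel xs (λ y ys → f y (x ∷ ys))

  Sel-cong : ∀ xs {f g} → (∀ x ys → x ∷ ys ↭ xs → f x ys ≡ g x ys) → Sel xs f ≡ Sel xs g
  Sel-cong [] h = refl
  Sel-cong (x ∷ xs) h =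
    cong₂ _+_ (h x xs refl) (Sel-cong xs λ y ys p → h y (x ∷ ys) (↭-trans (swap y x refl) (prep x p)))

  Sel-+ : ∀ xs f g → Sel xs (λ x ys → f x ys + g x ys) ≡ Sel xs f + Sel xs g
  Sel-+ [] f g = refl
  Sel-+ (x ∷ xs) f g
    rewrite Sel-+ xs (λ y ys → f y (x ∷ ys)) (λ y ys → g y (x ∷ ys)) =
    +-interchange (f x xs) (g x xs) (Sel xs (λ y ys → f y (x ∷ ys))) (Sel xs (λ y ys → g y (x ∷ ys)))

  Sel-* : ∀ xs k f → Sel xs (λ x ys → k * f x ys) ≡ k * Sel xs f
  Sel-* [] k f = sym (ℚP.*-zeroʳ k)
  Sel-* (x ∷ xs) k f rewrite Sel-* xs k (λ y ys → f y (x ∷ ys)) = sym (ℚP.*-distribˡ-+ k _ _)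

  Sel-neg : ∀ xs f → Sel xs (λ x ys → - f x ys) ≡ - Sel xs f
  Sel-neg [] f = refl
  Sel-neg (x ∷ xs) f rewrite Sel-neg xs (λ y ys → f y (x ∷ ys)) = sym (ℚP.neg-distrib-+ (f x xs) (Sel xs (λ y ys → f y (x ∷ ys))))

  Sel-- : ∀ xs f g → Sel xs (λ x ys → f x ys - g x ys) ≡ Sel xs f - Sel xs g
  Sel-- xs f g = trans (Sel-+ xs f (λ x ys → - g x ys)) (cong (Sel xs f +_) (Sel-neg xs g))

  Sel-∑ : ∀ xs f → Sel xs (λ x _ → f x) ≡ ∑ xs f
  Sel-∑ [] f = refl
  Sel-∑ (x ∷ xs) f = cong (f x +_) (Sel-∑ xs f)

  Sel-swap : ∀ xs (f : A → A → List A → ℚ) →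
             Sel xs (λ x ys → Sel ys (λ y zs → f x y zs)) ≡ Sel xs (λ x ys → Sel ys (λ y zs → f y x zs))
  Sel-swap [] f = refl
  Sel-swap (w ∷ xs) f = begin
    P + Sel xs (λ x ys → f x w ys + Sel ys (λ y zs → f x y (w ∷ zs)))
      ≡⟨ cong (P +_) (Sel-+ xs _ _) ⟩
    P + (Q + Sel xs (λ x ys → Sel ys (λ y zs → f x y (w ∷ zs))))
      ≡⟨ cong (λ r → P + (Q + r)) (Sel-swap xs (λ x y zs → f x y (w ∷ zs))) ⟩
    P + (Q + R)
      ≡⟨ +-swapˡ P Q R ⟩
    Q + (P + R)
      ≡⟨ cong (Q +_) (Sel-+ xs _ _) ⟨
    Q + Sel xs (λ x ys → f w x ys + Sel ys (λ y zs → f y x (w ∷ zs))) ∎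
    where
    P = Sel xs (λ y zs → f w y zs)
    Q = Sel xs (λ y zs → f y w zs)
    R = Sel xs (λ x ys → Sel ys (λ y zs → f y x (w ∷ zs)))

  -- Exchanging the two choices shows that the double sum is its own negative.
  Sel-antisym : ∀ xs (f : A → A → List A → ℚ) →
    (∀ x y zs → x ∷ y ∷ zs ↭ xs → f x y zs ≡ - f y x zs) →
    Sel xs (λ x ys → Sel ys (λ y zs → f x y zs)) ≡ 0ℚ
  Sel-antisym xs f anti = double0 _ (begin
    S ≡⟨ Sel-swap xs f ⟩
    Sel xs (λ x ys → Sel ys (λ y zs → f y x zs))
      ≡⟨ Sel-cong xs (λ x ys p → Sel-cong ys (λ y zs q →
           anti y x zs (↭-trans (swap y x refl) (↭-trans (prep x q) p)))) ⟩
    Sel xs (λ x ys → Sel ys (λ y zs → - f x y zs))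
      ≡⟨ Sel-cong xs (λ x ys _ → Sel-neg ys _) ⟩
    Sel xs (λ x ys → - Sel ys (λ y zs → f x y zs))
      ≡⟨ Sel-neg xs _ ⟩
    - S ∎)
    where
    S = Sel xs (λ x ys → Sel ys (λ y zs → f x y zs))
    double0 : ∀ s → s ≡ - s → s ≡ 0ℚ
    double0 s e = begin
      s ≡⟨ half s ⟩
      ½ * (s + s) ≡⟨ cong (λ u → ½ * (s + u)) e ⟩
      ½ * (s - s) ≡⟨ zer s ⟩
      0ℚ ∎
      where
      half : ∀ s → s ≡ ½ * (s + s)
      half = solve-∀ ring
      zer : ∀ s → ½ * (s - s) ≡ 0ℚ
      zer = solve-∀ ring

-- Moments of `- s` for `s` uniform on [0, 1].

sgn : ℕ → ℚ
sgn zero = 1ℚ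
sgn (suc j) = - sgn j

opaque
  -- Opaque, so that conversion checking treats a reciprocal as an atom instead of unfolding the
  -- normalisation of fractions.
  recip : ℕ → ℚ
  recip k = ℤ.+ 1 ℚ./ suc k

  recip-/ : ∀ k → recip k ≡ ℤ.+ 1 ℚ./ suc k
  recip-/ k = refl

-- μ j is the integral of (- s) ^ j over 0 ≤ s ≤ 1.
μ : ℕ → ℚ
μ j = sgn j * recip j

⟦⟧-/1 : ∀ k → ⟦ k ⟧ ≡ ℤ.+ k ℚ./ 1
⟦⟧-/1 zero = refl
⟦⟧-/1 (suc k) = begin
  1ℚ + ⟦ k ⟧ ≡⟨ cong (λ w → 1ℚ + w) (⟦⟧-/1 k) ⟩
  1ℚ + (ℤ.+ k ℚ./ 1) ≡⟨ ℚP.toℚᵘ-injective fractions ⟩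
  ℤ.+ suc k ℚ./ 1 ∎
  where
  fractions : ℚ.toℚᵘ (1ℚ + (ℤ.+ k ℚ./ 1)) ℚᵘ.≃ ℚ.toℚᵘ (ℤ.+ suc k ℚ./ 1)
  fractions = ℚᵘP.≃-trans (ℚP.toℚᵘ-homo-+ 1ℚ (ℤ.+ k ℚ./ 1))
    (ℚᵘP.≃-trans (ℚᵘP.+-congʳ ℚᵘ.1ℚᵘ (ℚP.toℚᵘ-fromℚᵘ (ℤ.+ k ℚᵘ./ 1)))
    (ℚᵘP.≃-trans (ℚᵘ.*≡* (cong (ℤ._* (ℤ.+ 1)) (cong (λ w → ℤ.+ 1 ℤ.+ w) (ℤP.*-identityʳ (ℤ.+ k)))))
    (ℚᵘP.≃-sym (ℚP.toℚᵘ-fromℚᵘ (ℤ.+ suc k ℚᵘ./ 1)))))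

⟦⟧-inverse : ∀ k → ⟦ suc k ⟧ * recip k ≡ 1ℚ
⟦⟧-inverse k = trans (cong₂ _*_ (⟦⟧-/1 (suc k)) (recip-/ k)) (ℚP.toℚᵘ-injective
  (ℚᵘP.≃-trans (ℚP.toℚᵘ-homo-* (ℤ.+ suc k ℚ./ 1) (ℤ.+ 1 ℚ./ suc k))
  (ℚᵘP.≃-trans (ℚᵘP.*-cong (ℚP.toℚᵘ-fromℚᵘ (ℤ.+ suc k ℚᵘ./ 1)) (ℚP.toℚᵘ-fromℚᵘ (ℤ.+ 1 ℚᵘ./ suc k)))
  (ℚᵘ.*≡* (trans (ℤP.*-identityʳ (ℤ.+ suc k ℤ.* ℤ.+ 1)) (trans (ℤP.*-comm (ℤ.+ suc k) (ℤ.+ 1)) (sym (ℤP.*-identityˡ (ℤ.+ 1 ℤ.* ℤ.+ suc k)))))))))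

⟦⟧*μ : ∀ j → ⟦ suc j ⟧ * μ j ≡ sgn j
⟦⟧*μ j = begin
  ⟦ suc j ⟧ * (sgn j * q) ≡⟨ *-swapˡ ⟦ suc j ⟧ (sgn j) q ⟩
  sgn j * (⟦ suc j ⟧ * q) ≡⟨ cong (sgn j *_) (⟦⟧-inverse j) ⟩
  sgn j * 1ℚ ≡⟨ ℚP.*-identityʳ (sgn j) ⟩
  sgn j ∎
  where
  q = recip j

-- Integration by parts: the integral of the derivative of (1 - s) s ^ (j + 1) vanishes.
μ-parts : ∀ j → (μ j + μ (suc j)) + (⟦ j ⟧ * μ j + ⟦ j ⟧ * μ (suc j)) ≡ - μ (suc j)
μ-parts j = begin
  (a + b) + (⟦ j ⟧ * a + ⟦ j ⟧ * b) ≡⟨ lemma ⟦ j ⟧ a b ⟩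
  ⟦ suc j ⟧ * a + ⟦ suc (suc j) ⟧ * b - b
    ≡⟨ cong₂ (λ u v → u + v - b) (⟦⟧*μ j) (⟦⟧*μ (suc j)) ⟩
  sgn j + - sgn j - b ≡⟨ lemma₂ (sgn j) b ⟩
  - b ∎
  where
  a = μ j
  b = μ (suc j)
  lemma : ∀ j a b → (a + b) + (j * a + j * b) ≡ (1ℚ + j) * a + (1ℚ + (1ℚ + j)) * b - b
  lemma = solve-∀ ring
  lemma₂ : ∀ s b → s + - s - b ≡ - b
  lemma₂ = solve-∀ ring

-- Weakly alternating functions of the rows and their expansions.

_⁺ : (ℕ → ℚ) → ℕ → ℚ
(ω ⁺) j = ω (suc j)

module _ {N : ℕ} where

  _[_↦_] : Vec (Fin N) N → Fin N → Fin N → Vec (Fin N) N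
  b [ p ↦ x ] = b [ p ]≔ x

  infixl 9 _[_↦_]

  ↦-comm : ∀ {p q} → p ≢ q → ∀ b x y → b [ p ↦ x ] [ q ↦ y ] ≡ b [ q ↦ y ] [ p ↦ x ]
  ↦-comm {p} {q} p≢q b x y = VecP.updateAt-commutes q p (p≢q ∘ sym) b

  ↦-over : ∀ p b x y → b [ p ↦ x ] [ p ↦ y ] ≡ b [ p ↦ y ]
  ↦-over p b x y = VecP.updateAt-updateAt p b

  lookup-↦ : ∀ p b x → lookup (b [ p ↦ x ]) p ≡ x
  lookup-↦ p b x = lookup-set p b

  lookup-↦′ : ∀ {p q} → q ≢ p → ∀ b x → lookup (b [ p ↦ x ]) q ≡ lookup b q
  lookup-↦′ {p} {q} q≢p b x = lookup-keep q p q≢p b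

  -- Equivalently: with values extended linearly, g is alternating in the rows whose values
  -- have total mass zero.
  record Star (g : Vec (Fin N) N → ℚ) : Set where
    constructor star
    field
      exchange : ∀ {p q} → p ≢ q → ∀ b x y →
        g (b [ p ↦ x ] [ q ↦ y ]) + g (b [ p ↦ y ] [ q ↦ x ]) ≡
        g (b [ p ↦ x ] [ q ↦ x ]) + g (b [ p ↦ y ] [ q ↦ y ])

  open Star

  Star-+ : ∀ {f g} → Star f → Star g → Star (λ b → f b + g b)
  Star-+ {f} {g} sf sg .exchange {p} {q} p≢q b x y =
    trans (+-interchange (f (b [ p ↦ x ] [ q ↦ y ])) _ _ _)
      (trans (cong₂ _+_ (sf .exchange p≢q b x y) (sg .exchange p≢q b x y))
        (+-interchange (f (b [ p ↦ x ] [ q ↦ x ])) (f (b [ p ↦ y ] [ q ↦ y ])) (g (b [ p ↦ x ] [ q ↦ x ])) (g (b [ p ↦ y ] [ q ↦ y ]))))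

  Star-* : ∀ {f} k → Star f → Star (λ b → k * f b)
  Star-* {f} k sf .exchange {p} {q} p≢q b x y =
    trans (sym (ℚP.*-distribˡ-+ k _ _)) (trans (cong (k *_) (sf .exchange p≢q b x y)) (ℚP.*-distribˡ-+ k _ _))

  Star-0 : Star (λ _ → 0ℚ)
  Star-0 .exchange _ _ _ _ = refl

  Star-Sel : ∀ {A : Set} (xs : List A) {f : Vec (Fin N) N → A → List A → ℚ} →
             (∀ x ys → Star (λ b → f b x ys)) → Star (λ b → Sel xs (f b))
  Star-Sel [] s = Star-0
  Star-Sel (x ∷ xs) {f} s = Star-+ (s x xs) (Star-Sel xs (λ y ys → s y (x ∷ ys)))

  -- An exchange that involves the overwritten row becomes trivial; any other one commutes with the
  -- overwriting.
  Star-↦ : ∀ {g} h z → Star g → Star (λ b → g (b [ h ↦ z ]))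
  Star-↦ {g} h z sg .exchange {p} {q} p≢q b x y with h ≟ p | h ≟ q
  ... | yes refl | _ = trans (cong₂ _+_ (skip x y) (skip y x))
      (trans (ℚP.+-comm (g (b [ q ↦ y ] [ h ↦ z ])) (g (b [ q ↦ x ] [ h ↦ z ])))
        (sym (cong₂ _+_ (skip x x) (skip y y))))
    where
    skip : ∀ u v → g (b [ h ↦ u ] [ q ↦ v ] [ h ↦ z ]) ≡ g (b [ q ↦ v ] [ h ↦ z ])
    skip u v = cong g (trans (cong (_[ h ↦ z ]) (↦-comm p≢q b u v)) (↦-over h (b [ q ↦ v ]) u z))
  ... | no _ | yes refl = cong₂ _+_ (skip x y x) (skip y x y)
    where
    skip : ∀ u v w → g (b [ p ↦ u ] [ h ↦ v ] [ h ↦ z ]) ≡ g (b [ p ↦ u ] [ h ↦ w ] [ h ↦ z ])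
    skip u v w = cong g (trans (↦-over h (b [ p ↦ u ]) v z) (sym (↦-over h (b [ p ↦ u ]) w z)))
  ... | no h≢p | no h≢q =
    trans (cong₂ _+_ (move x y) (move y x)) (trans (sg .exchange p≢q (b [ h ↦ z ]) x y) (sym (cong₂ _+_ (move x x) (move y y))))
    where
    move : ∀ u v → g (b [ p ↦ u ] [ q ↦ v ] [ h ↦ z ]) ≡ g (b [ h ↦ z ] [ p ↦ u ] [ q ↦ v ])
    move u v = cong g (trans (↦-comm (h≢q ∘ sym) (b [ p ↦ u ]) v z) (cong (_[ q ↦ v ]) (↦-comm (h≢p ∘ sym) b u z)))

  -- Sum over J ⊆ A: the rows in J take their own value and the others the value x, with the
  -- weight ω ∣J∣. In the application ω j is the integral of (- s) ^ j, and ω ⁺ inserts a factor - s.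
  T : Fin N → List (Fin N) → (Vec (Fin N) N → ℚ) → Vec (Fin N) N → (ℕ → ℚ) → ℚ
  T x [] g b ω = ω 0 * g b
  T x (h ∷ A) g b ω = T x A g (b [ h ↦ x ]) ω + T x A g (b [ h ↦ h ]) (ω ⁺)

  Star-T : ∀ {g} x A ω → Star g → Star (λ b → T x A g b ω)
  Star-T x [] ω s = Star-* (ω 0) s
  Star-T {g} x (h ∷ A) ω s =
    Star-+ (Star-↦ h x (Star-T x A ω s)) (Star-↦ h h (Star-T x A (ω ⁺) s))

  T-cong-ω : ∀ x A g b {α β : ℕ → ℚ} → (∀ j → α j ≡ β j) → T x A g b α ≡ T x A g b β
  T-cong-ω x [] g b e = cong (_* g b) (e 0)
  T-cong-ω x (h ∷ A) g b e = cong₂ _+_ (T-cong-ω x A g _ e) (T-cong-ω x A g _ (e ∘ suc))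

  T-+-ω : ∀ x A g b (α β : ℕ → ℚ) → T x A g b (λ j → α j + β j) ≡ T x A g b α + T x A g b β
  T-+-ω x [] g b α β = ℚP.*-distribʳ-+ (g b) (α 0) (β 0)
  T-+-ω x (h ∷ A) g b α β rewrite T-+-ω x A g (b [ h ↦ x ]) α β | T-+-ω x A g (b [ h ↦ h ]) (α ⁺) (β ⁺) =
    +-interchange (T x A g (b [ h ↦ x ]) α) (T x A g (b [ h ↦ x ]) β) (T x A g (b [ h ↦ h ]) (α ⁺)) (T x A g (b [ h ↦ h ]) (β ⁺))

  T-neg-ω : ∀ x A g b (α : ℕ → ℚ) → T x A g b (λ j → - α j) ≡ - T x A g b α
  T-neg-ω x [] g b α = sym (ℚP.neg-distribˡ-* (α 0) (g b))
  T-neg-ω x (h ∷ A) g b α rewrite T-neg-ω x A g (b [ h ↦ x ]) α | T-neg-ω x A g (b [ h ↦ h ]) (α ⁺) =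
    sym (ℚP.neg-distrib-+ (T x A g (b [ h ↦ x ]) α) (T x A g (b [ h ↦ h ]) (α ⁺)))

  -- Row `c` carries the difference `x - z`. Passing from the default `x` to `z` changes another row
  -- by the same difference, and two rows with equal differences contribute nothing.
  T-exchange : ∀ {g c A} → Star g → All (c ≢_) A → ∀ x z b ω →
    T x A g (b [ c ↦ x ]) ω - T x A g (b [ c ↦ z ]) ω ≡ T z A g (b [ c ↦ x ]) ω - T z A g (b [ c ↦ z ]) ω
  T-exchange s [] x z b ω = refl
  T-exchange {g} {c} {h ∷ A} s (c≢h ∷ c∉A) x z b ω
    rewrite ↦-comm c≢h b x x | ↦-comm c≢h b x h | ↦-comm c≢h b z x | ↦-comm c≢h b z h = begin
    (t x x x ω + t x h x ω⁺) - (t x x z ω + t x h z ω⁺) ≡⟨ lemma₁ (t x x x ω) (t x h x ω⁺) (t x x z ω) (t x h z ω⁺) ⟩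
    (t x x x ω - t x x z ω) + (t x h x ω⁺ - t x h z ω⁺)
      ≡⟨ cong₂ _+_ (T-exchange s c∉A x z (b [ h ↦ x ]) ω) (T-exchange s c∉A x z (b [ h ↦ h ]) ω⁺) ⟩
    (t z x x ω - t z x z ω) + (t z h x ω⁺ - t z h z ω⁺)
      ≡⟨ lemma₂ (t z x x ω) (t z x z ω) (t z z x ω) (t z z z ω) (t z h x ω⁺) (t z h z ω⁺) (Star-T z A ω s .exchange (c≢h ∘ sym) b x z) ⟩
    (t z z x ω + t z h x ω⁺) - (t z z z ω + t z h z ω⁺)
      ≡⟨ cong₂ (λ u v → (T z A g u ω + t z h x ω⁺) - (T z A g v ω + t z h z ω⁺)) (sym (↦-comm c≢h b x z)) (sym (↦-comm c≢h b z z)) ⟩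
    (T z A g (b [ c ↦ x ] [ h ↦ z ]) ω + t z h x ω⁺) - (T z A g (b [ c ↦ z ] [ h ↦ z ]) ω + t z h z ω⁺) ∎
    where
    ω⁺ = ω ⁺
    t : Fin N → Fin N → Fin N → (ℕ → ℚ) → ℚ
    t w y y′ ω = T w A g (b [ h ↦ y ] [ c ↦ y′ ]) ω
    lemma₁ : ∀ a b c d → (a + b) - (c + d) ≡ (a - c) + (b - d)
    lemma₁ = solve-∀ ring
    lemma₃ : ∀ a b c d e f → (a - b) + (e - f) ≡ ((a + d) - (b + c)) + ((c + e) - (d + f))
    lemma₃ = solve-∀ ring
    lemma₄ : ∀ a b → (a - a) + b ≡ b
    lemma₄ = solve-∀ ring
    lemma₂ : ∀ a b c d e f → b + c ≡ a + d → (a - b) + (e - f) ≡ (c + e) - (d + f)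
    lemma₂ a b c d e f eq = trans (lemma₃ a b c d e f)
      (trans (cong (λ w → ((a + d) - w) + ((c + e) - (d + f))) eq) (lemma₄ (a + d) ((c + e) - (d + f))))

  -- Write the default as `z + (x - z)` and multiply out. Alternation kills all terms in which two
  -- rows carry `x - z`, so only the constant and the linear terms are left.
  T-expand : ∀ {g A} → Star g → Unique A → ∀ x z b ω →
    T x A g b ω ≡ T z A g b ω + Sel A (λ c A′ → T z A′ g (b [ c ↦ x ]) ω - T z A′ g (b [ c ↦ z ]) ω)
  T-expand s [] x z b ω = sym (ℚP.+-identityʳ _)
  T-expand {g} {h ∷ A} s (h∉A ∷ u) x z b ω = begin
    T x A g (b [ h ↦ x ]) ω + T x A g (b [ h ↦ h ]) (ω ⁺)
      ≡⟨ cong₂ _+_ first (T-expand s u x z (b [ h ↦ h ]) (ω ⁺)) ⟩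
    (Z + Sel A (D ω (b [ h ↦ z ])) + (X - Z)) + (S + Sel A (D (ω ⁺) (b [ h ↦ h ])))
      ≡⟨ lemma Z (Sel A (D ω (b [ h ↦ z ]))) (X - Z) S (Sel A (D (ω ⁺) (b [ h ↦ h ]))) ⟩
    (Z + S) + ((X - Z) + (Sel A (D ω (b [ h ↦ z ])) + Sel A (D (ω ⁺) (b [ h ↦ h ]))))
      ≡⟨ cong (λ w → (Z + S) + ((X - Z) + w)) (sym (Sel-+ A _ _)) ⟩
    (Z + S) + ((X - Z) + Sel A (λ c A′ → D ω (b [ h ↦ z ]) c A′ + D (ω ⁺) (b [ h ↦ h ]) c A′))
      ≡⟨ cong (λ w → (Z + S) + ((X - Z) + w)) (Sel-cong A λ c A′ p → rearrange c A′ (All.lookup h∉A (∈-resp-↭ p (here refl)))) ⟩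
    (Z + S) + ((X - Z) + Sel A (λ c A′ → T z (h ∷ A′) g (b [ c ↦ x ]) ω - T z (h ∷ A′) g (b [ c ↦ z ]) ω)) ∎
    where
    Z = T z A g (b [ h ↦ z ]) ω
    X = T z A g (b [ h ↦ x ]) ω
    S = T z A g (b [ h ↦ h ]) (ω ⁺)
    D : (ℕ → ℚ) → Vec (Fin N) N → Fin N → List (Fin N) → ℚ
    D ω b c A′ = T z A′ g (b [ c ↦ x ]) ω - T z A′ g (b [ c ↦ z ]) ω
    lemma₀ : ∀ a b c d → a - b ≡ c - d → a ≡ b + (c - d)
    lemma₀ a b c d e = trans (split a b) (cong (b +_) e)
      where
      split : ∀ a b → a ≡ b + (a - b)
      split = solve-∀ ring
    first : T x A g (b [ h ↦ x ]) ω ≡ Z + Sel A (D ω (b [ h ↦ z ])) + (X - Z)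
    first = trans (lemma₀ (T x A g (b [ h ↦ x ]) ω) (T x A g (b [ h ↦ z ]) ω) X Z (T-exchange s h∉A x z b ω))
      (cong (_+ (X - Z)) (T-expand s u x z (b [ h ↦ z ]) ω))
    lemma : ∀ a b c d e → (a + b + c) + (d + e) ≡ (a + d) + (c + (b + e))
    lemma = solve-∀ ring
    rearrange : ∀ c A′ → h ≢ c →
      D ω (b [ h ↦ z ]) c A′ + D (ω ⁺) (b [ h ↦ h ]) c A′ ≡
      T z (h ∷ A′) g (b [ c ↦ x ]) ω - T z (h ∷ A′) g (b [ c ↦ z ]) ω
    rearrange c A′ h≢c
      rewrite ↦-comm h≢c b z x | ↦-comm h≢c b z z | ↦-comm h≢c b h x | ↦-comm h≢c b h z =
        lemma₁ (T z A′ g (b [ c ↦ x ] [ h ↦ z ]) ω) (T z A′ g (b [ c ↦ z ] [ h ↦ z ]) ω)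
               (T z A′ g (b [ c ↦ x ] [ h ↦ h ]) (ω ⁺)) (T z A′ g (b [ c ↦ z ] [ h ↦ h ]) (ω ⁺))
      where
      lemma₁ : ∀ a b c d → (a - b) + (c - d) ≡ (a + c) - (b + d)
      lemma₁ = solve-∀ ring

  -- For each row `c` the sum over `J` splits according to whether `J` contains `c`; adding these
  -- splittings over all `c` gives the factor.
  T-count : ∀ {g A} → Unique A → ∀ x b ω →
    ⟦ length A ⟧ * T x A g b ω ≡ Sel A (λ c A′ → T x A′ g (b [ c ↦ x ]) ω + T x A′ g (b [ c ↦ c ]) (ω ⁺))
  T-count {g} [] x b ω = ℚP.*-zeroˡ (ω 0 * g b)
  T-count {g} {h ∷ A} (h∉A ∷ u) x b ω = begin
    (1ℚ + n) * (P + Q) ≡⟨ lemma n P Q ⟩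
    (P + Q) + (n * P + n * Q)
      ≡⟨ cong (λ w → (P + Q) + w) (cong₂ _+_ (T-count u x (b [ h ↦ x ]) ω) (T-count u x (b [ h ↦ h ]) (ω ⁺))) ⟩
    (P + Q) + (Sel A (E (b [ h ↦ x ]) ω) + Sel A (E (b [ h ↦ h ]) (ω ⁺)))
      ≡⟨ cong (λ w → (P + Q) + w) (sym (Sel-+ A _ _)) ⟩
    (P + Q) + Sel A (λ c A′ → E (b [ h ↦ x ]) ω c A′ + E (b [ h ↦ h ]) (ω ⁺) c A′)
      ≡⟨ cong (λ w → (P + Q) + w) (Sel-cong A λ c A′ p → rearrange c A′ (All.lookup h∉A (∈-resp-↭ p (here refl)))) ⟩
    (P + Q) + Sel A (λ c A′ → T x (h ∷ A′) g (b [ c ↦ x ]) ω + T x (h ∷ A′) g (b [ c ↦ c ]) (ω ⁺)) ∎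
    where
    n = ⟦ length A ⟧
    P = T x A g (b [ h ↦ x ]) ω
    Q = T x A g (b [ h ↦ h ]) (ω ⁺)
    E : Vec (Fin N) N → (ℕ → ℚ) → Fin N → List (Fin N) → ℚ
    E b ω c A′ = T x A′ g (b [ c ↦ x ]) ω + T x A′ g (b [ c ↦ c ]) (ω ⁺)
    lemma : ∀ n p q → (1ℚ + n) * (p + q) ≡ (p + q) + (n * p + n * q)
    lemma = solve-∀ ring
    rearrange : ∀ c A′ → h ≢ c →
      E (b [ h ↦ x ]) ω c A′ + E (b [ h ↦ h ]) (ω ⁺) c A′ ≡
      T x (h ∷ A′) g (b [ c ↦ x ]) ω + T x (h ∷ A′) g (b [ c ↦ c ]) (ω ⁺)
    rearrange c A′ h≢c
      rewrite ↦-comm h≢c b x x | ↦-comm h≢c b x c | ↦-comm h≢c b h x | ↦-comm h≢c b h c =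
        +-interchange (T x A′ g (b [ c ↦ x ] [ h ↦ x ]) ω) (T x A′ g (b [ c ↦ c ] [ h ↦ x ]) (ω ⁺))
               (T x A′ g (b [ c ↦ x ] [ h ↦ h ]) (ω ⁺)) (T x A′ g (b [ c ↦ c ] [ h ↦ h ]) (ω ⁺ ⁺))

  -- A subset `J` is counted once for each `c` in it. On the weights this is the Euler operator
  -- `s d/ds`, which multiplies `(- s) ^ j` by `j`.
  T-euler : ∀ {g A} → Unique A → ∀ x b ω →
    Sel A (λ c A′ → T x A′ g (b [ c ↦ c ]) (ω ⁺)) ≡ T x A g b (λ j → ⟦ j ⟧ * ω j)
  T-euler {g} [] x b ω = sym (trans (cong (_* g b) (ℚP.*-zeroˡ (ω 0))) (ℚP.*-zeroˡ (g b)))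
  T-euler {g} {h ∷ A} (h∉A ∷ u) x b ω = begin
    Q + Sel A (λ c A′ → T x (h ∷ A′) g (b [ c ↦ c ]) (ω ⁺))
      ≡⟨ cong (Q +_) (Sel-cong A rearrange) ⟩
    Q + Sel A (λ c A′ → T x A′ g (b [ h ↦ x ] [ c ↦ c ]) (ω ⁺) + T x A′ g (b [ h ↦ h ] [ c ↦ c ]) (ω ⁺ ⁺))
      ≡⟨ cong (Q +_) (Sel-+ A _ _) ⟩
    Q + (Sel A (λ c A′ → T x A′ g (b [ h ↦ x ] [ c ↦ c ]) (ω ⁺))
       + Sel A (λ c A′ → T x A′ g (b [ h ↦ h ] [ c ↦ c ]) (ω ⁺ ⁺)))
      ≡⟨ cong (Q +_) (cong₂ _+_ (T-euler u x (b [ h ↦ x ]) ω) (T-euler u x (b [ h ↦ h ]) (ω ⁺))) ⟩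
    Q + (U + V) ≡⟨ +-swapˡ Q U V ⟩
    U + (Q + V) ≡⟨ cong (U +_) (sym (T-+-ω x A g (b [ h ↦ h ]) _ _)) ⟩
    U + T x A g (b [ h ↦ h ]) (λ j → ω (suc j) + ⟦ j ⟧ * ω (suc j))
      ≡⟨ cong (U +_) (T-cong-ω x A g _ (λ j → lemma₁ ⟦ j ⟧ (ω (suc j)))) ⟩
    U + T x A g (b [ h ↦ h ]) (λ j → ⟦ suc j ⟧ * ω (suc j)) ∎
    where
    Q = T x A g (b [ h ↦ h ]) (ω ⁺)
    U = T x A g (b [ h ↦ x ]) (λ j → ⟦ j ⟧ * ω j)
    V = T x A g (b [ h ↦ h ]) (λ j → ⟦ j ⟧ * ω (suc j))
    lemma₁ : ∀ j w → w + j * w ≡ (1ℚ + j) * w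
    lemma₁ = solve-∀ ring
    rearrange : ∀ c A′ → c ∷ A′ ↭ A → T x (h ∷ A′) g (b [ c ↦ c ]) (ω ⁺) ≡
      T x A′ g (b [ h ↦ x ] [ c ↦ c ]) (ω ⁺) + T x A′ g (b [ h ↦ h ] [ c ↦ c ]) (ω ⁺ ⁺)
    rearrange c A′ p = cong₂ (λ u v → T x A′ g u (ω ⁺) + T x A′ g v (ω ⁺ ⁺))
      (↦-comm c≢h b c x) (↦-comm c≢h b c h)
      where
      c≢h : c ≢ h
      c≢h = All.lookup h∉A (∈-resp-↭ p (here refl)) ∘ sym

-- The terms left over when an element is inserted into a cyclic order.

module _ {N : ℕ} where

  private
    variable
      g : Vec (Fin N) N → ℚ
      A : List (Fin N)

  open Star

  -- For the common value `x`, compares redirecting one row to `z` with redirecting none, for each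
  -- of the `k` rows. The weight is `1 - s`, that is `μ` plus `μ ⁺`, except for weight 1 when row
  -- `x` itself is redirected. In the application `z` is the inserted element, and its row is a
  -- fixed point.
  redirected : (Vec (Fin N) N → ℚ) → ℕ → Fin N → Fin N → List (Fin N) → Vec (Fin N) N → ℚ
  redirected g k z x A b =
    - (⟦ k ⟧ * (T x A g (b [ x ↦ x ]) μ + T x A g (b [ x ↦ x ]) (μ ⁺)))
    + (Sel A (λ c A′ → T x A′ g (b [ x ↦ x ] [ c ↦ z ]) μ + T x A′ g (b [ x ↦ x ] [ c ↦ z ]) (μ ⁺))
      + T x A g (b [ x ↦ z ]) μ)

  -- The right-hand side is `T z (x ∷ A) g b μ` split at row `x`. On the left, the differences
  -- between redirected and unredirected rows are the linear terms of `T-expand` and so change the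
  -- default from `x` to `z`; integration by parts absorbs the remaining Euler terms.
  redirect-one : ∀ {x} → Star g → Unique (x ∷ A) → ∀ z b →
    redirected g (suc (length A)) z x A b ≡ T z A g (b [ x ↦ z ]) μ + T z A g (b [ x ↦ x ]) (μ ⁺)
  redirect-one {g} {A} {x} s (x∉A ∷ u) z b = begin
    - ((1ℚ + n) * (t₀ + t₁)) + (Sel A (λ c A′ → H c A′ μ + H c A′ (μ ⁺)) + T x A g bz μ)
      ≡⟨ cong (λ w → - ((1ℚ + n) * (t₀ + t₁)) + (w + T x A g bz μ)) (Sel-+ A (λ c A′ → H c A′ μ) (λ c A′ → H c A′ (μ ⁺))) ⟩
    - ((1ℚ + n) * (t₀ + t₁)) + ((h₀ + h₁) + T x A g bz μ)
      ≡⟨ lemma n t₀ t₁ h₀ h₁ (T x A g bz μ) ⟩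
    - (t₀ + t₁) + ((- (n * t₀ - h₀) - (n * t₁ - h₁)) + T x A g bz μ)
      ≡⟨ cong₂ (λ v w → - (t₀ + t₁) + ((- v - w) + T x A g bz μ)) (drop μ) (drop (μ ⁺)) ⟩
    - (t₀ + t₁) + ((- ((T x A g bz μ - T z A g bz μ) + d₀) - ((T x A g bz (μ ⁺) - T z A g bz (μ ⁺)) + d₁)) + T x A g bz μ)
      ≡⟨ lemma₂ t₀ t₁ d₀ d₁ (T x A g bz μ) (T z A g bz μ) (T x A g bz (μ ⁺)) (T z A g bz (μ ⁺)) ⟩
    - ((t₀ + t₁) + (d₀ + d₁)) + (T z A g bz μ - (T x A g bz (μ ⁺) - T z A g bz (μ ⁺)))
      ≡⟨ cong₂ (λ v w → - v + (T z A g bz μ - w)) parts (cong (_- T z A g bz (μ ⁺)) (negate {T x A g bz (μ ⁺)} {t₁} (T-exchange s x∉A x z b (μ ⁺)))) ⟩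
    - (- t₁) + (T z A g bz μ - (t₁ - (T z A g bx (μ ⁺) - T z A g bz (μ ⁺)) - T z A g bz (μ ⁺)))
      ≡⟨ lemma₃ t₁ (T z A g bz μ) (T z A g bx (μ ⁺)) (T z A g bz (μ ⁺)) ⟩
    T z A g bz μ + T z A g bx (μ ⁺) ∎
    where
    n = ⟦ length A ⟧
    bx = b [ x ↦ x ]
    bz = b [ x ↦ z ]
    t₀ = T x A g bx μ
    t₁ = T x A g bx (μ ⁺)
    H : Fin N → List (Fin N) → (ℕ → ℚ) → ℚ
    H c A′ ω = T x A′ g (bx [ c ↦ z ]) ω
    h₀ = Sel A (λ c A′ → H c A′ μ)
    h₁ = Sel A (λ c A′ → H c A′ (μ ⁺))
    d₀ = T x A g bx (λ j → ⟦ j ⟧ * μ j)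
    d₁ = T x A g bx (λ j → ⟦ j ⟧ * μ (suc j))
    negate : ∀ {a c d} → c - a ≡ d → a ≡ c - d
    negate {a} {c} {d} e = trans (l a c) (cong (λ w → c - w) e)
      where
      l : ∀ a c → a ≡ c - (c - a)
      l = solve-∀ ring
    lemma : ∀ n t₀ t₁ h₀ h₁ y → - ((1ℚ + n) * (t₀ + t₁)) + ((h₀ + h₁) + y) ≡
            - (t₀ + t₁) + ((- (n * t₀ - h₀) - (n * t₁ - h₁)) + y)
    lemma = solve-∀ ring
    lemma₂ : ∀ t₀ t₁ d₀ d₁ a b c d → - (t₀ + t₁) + ((- ((a - b) + d₀) - ((c - d) + d₁)) + a) ≡
             - ((t₀ + t₁) + (d₀ + d₁)) + (b - (c - d))
    lemma₂ = solve-∀ ring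
    lemma₃ : ∀ t a b c → - (- t) + (a - (t - (b - c) - c)) ≡ a + b
    lemma₃ = solve-∀ ring
    parts : (t₀ + t₁) + (d₀ + d₁) ≡ - t₁
    parts = begin
      (t₀ + t₁) + (d₀ + d₁)
        ≡⟨ cong₂ _+_ (sym (T-+-ω x A g bx μ (μ ⁺))) (sym (T-+-ω x A g bx (λ j → ⟦ j ⟧ * μ j) (λ j → ⟦ j ⟧ * μ (suc j)))) ⟩
      T x A g bx (λ j → μ j + μ (suc j)) + T x A g bx (λ j → ⟦ j ⟧ * μ j + ⟦ j ⟧ * μ (suc j))
        ≡⟨ sym (T-+-ω x A g bx _ _) ⟩
      T x A g bx (λ j → (μ j + μ (suc j)) + (⟦ j ⟧ * μ j + ⟦ j ⟧ * μ (suc j)))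
        ≡⟨ T-cong-ω x A g bx μ-parts ⟩
      T x A g bx (λ j → - μ (suc j)) ≡⟨ T-neg-ω x A g bx (μ ⁺) ⟩
      - t₁ ∎
    -- `T-count` splits each copy of the first term at a row `c`. The part with value `x` pairs with
    -- the redirection to `z`; the part with the own value gives the Euler term.
    drop : ∀ ω → n * T x A g bx ω - Sel A (λ c A′ → H c A′ ω) ≡
                 (T x A g bz ω - T z A g bz ω) + T x A g bx (λ j → ⟦ j ⟧ * ω j)
    drop ω = begin
      n * T x A g bx ω - Sel A (λ c A′ → H c A′ ω)
        ≡⟨ cong (_- Sel A (λ c A′ → H c A′ ω)) (trans (T-count u x bx ω) (Sel-+ A _ _)) ⟩
      (Sel A (λ c A′ → T x A′ g (bx [ c ↦ x ]) ω) + Sel A (λ c A′ → T x A′ g (bx [ c ↦ c ]) (ω ⁺)))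
        - Sel A (λ c A′ → H c A′ ω)
        ≡⟨ cong (λ w → (Sel A (λ c A′ → T x A′ g (bx [ c ↦ x ]) ω) + w) - Sel A (λ c A′ → H c A′ ω)) (T-euler u x bx ω) ⟩
      (Sel A (λ c A′ → T x A′ g (bx [ c ↦ x ]) ω) + D) - Sel A (λ c A′ → H c A′ ω)
        ≡⟨ l (Sel A (λ c A′ → T x A′ g (bx [ c ↦ x ]) ω)) D (Sel A (λ c A′ → H c A′ ω)) ⟩
      (Sel A (λ c A′ → T x A′ g (bx [ c ↦ x ]) ω) - Sel A (λ c A′ → H c A′ ω)) + D
        ≡⟨ cong (_+ D) (sym (Sel-- A _ _)) ⟩
      Sel A (λ c A′ → T x A′ g (bx [ c ↦ x ]) ω - T x A′ g (bx [ c ↦ z ]) ω) + D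
        ≡⟨ cong (_+ D) (Sel-cong A λ c A′ p → both c A′ (Unique-resp-↭ (↭-sym p) u) (All.lookup x∉A (∈-resp-↭ p (here refl)))) ⟩
      Sel A (λ c A′ → T z A′ g (bz [ c ↦ x ]) ω - T z A′ g (bz [ c ↦ z ]) ω) + D
        ≡⟨ cong (_+ D) (split {T x A g bz ω} (T-expand s u x z bz ω)) ⟩
      (T x A g bz ω - T z A g bz ω) + D ∎
      where
      D = T x A g bx (λ j → ⟦ j ⟧ * ω j)
      l : ∀ a b c → (a + b) - c ≡ (a - c) + b
      l = solve-∀ ring
      split : ∀ {a b c} → a ≡ b + c → c ≡ a - b
      split {a} {b} {c} e = trans (l₁ b c) (cong (_- b) (sym e))
        where
        l₁ : ∀ b c → c ≡ (b + c) - b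
        l₁ = solve-∀ ring
      -- While row `c` carries `x - z`, alternation allows first the default and then row `x` to
      -- change from `x` to `z`.
      both : ∀ c A′ → Unique (c ∷ A′) → x ≢ c →
        T x A′ g (bx [ c ↦ x ]) ω - T x A′ g (bx [ c ↦ z ]) ω ≡ T z A′ g (bz [ c ↦ x ]) ω - T z A′ g (bz [ c ↦ z ]) ω
      both c A′ (c∉A′ ∷ _) x≢c =
        trans (T-exchange s c∉A′ x z bx ω)
          (cancel (T z A′ g (bx [ c ↦ z ]) ω) (T z A′ g (bz [ c ↦ x ]) ω) (T z A′ g (bx [ c ↦ x ]) ω) (T z A′ g (bz [ c ↦ z ]) ω)
            (Star-T z A′ ω s .exchange x≢c b x z))
        where
        cancel : ∀ a b c d → a + b ≡ c + d → c - a ≡ b - d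
        cancel a b c d e = trans (l₁ a c d) (trans (cong (λ w → w - (a + d)) (sym e)) (l₂ a b d))
          where
          l₁ : ∀ a c d → c - a ≡ (c + d) - (a + d)
          l₁ = solve-∀ ring
          l₂ : ∀ a b d → (a + b) - (a + d) ≡ b - d
          l₂ = solve-∀ ring

  -- The splittings at row `x`, added over all `x`, are `T-count` read backwards.
  redirect-all : Star g → Unique A → ∀ z b →
    Sel A (λ x A′ → redirected g (length A) z x A′ b) ≡ ⟦ length A ⟧ * T z A g b μ
  redirect-all {g} {A} s u z b = trans (Sel-cong A step) (sym (T-count u z b μ))
    where
    step : ∀ x A′ → x ∷ A′ ↭ A → redirected g (length A) z x A′ b ≡ T z A′ g (b [ x ↦ z ]) μ + T z A′ g (b [ x ↦ x ]) (μ ⁺)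
    step x A′ p = trans (cong (λ k → redirected g k z x A′ b) (sym (↭-length p))) (redirect-one s (Unique-resp-↭ (↭-sym p) u) z b)

  T-↭ : ∀ {A B : List (Fin N)} {g} → A ↭ B → Unique A → ∀ x b ω → T x A g b ω ≡ T x B g b ω
  T-↭ refl _ x b ω = refl
  T-↭ (prep h p) (_ ∷ u) x b ω = cong₂ _+_ (T-↭ p u x _ ω) (T-↭ p u x _ (ω ⁺))
  T-↭ {g = g} (swap {A} {B} h k p) ((h≢k ∷ _) ∷ _ ∷ u) x b ω
    rewrite ↦-comm h≢k b x x | ↦-comm h≢k b x k | ↦-comm h≢k b h x | ↦-comm h≢k b h k =
    trans
      (+-interchange (T x A g (b [ k ↦ x ] [ h ↦ x ]) ω) (T x A g (b [ k ↦ k ] [ h ↦ x ]) (ω ⁺))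
             (T x A g (b [ k ↦ x ] [ h ↦ h ]) (ω ⁺)) (T x A g (b [ k ↦ k ] [ h ↦ h ]) (ω ⁺ ⁺)))
      (cong₂ _+_ (cong₂ _+_ (T-↭ p u x _ ω) (T-↭ p u x _ (ω ⁺)))
                 (cong₂ _+_ (T-↭ p u x _ (ω ⁺)) (T-↭ p u x _ (ω ⁺ ⁺))))
  T-↭ (↭.trans p q) u x b ω = trans (T-↭ p u x b ω) (T-↭ q (Unique-resp-↭ p u) x b ω)

  -- Averages over the cyclic orders of one block.

  -- Inserts the fixed point a into a cycle, right after c.
  ins : Fin N → Fin N → Vec (Fin N) N → Vec (Fin N) N
  ins a c b = b [ a ↦ lookup b c ] [ c ↦ a ]

  -- A cyclic order of `a ∷ A` comes from exactly one cyclic order of `A`, by placing `a` after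
  -- exactly one of its elements; hence `(length A)!` of them.
  cycles : List (Fin N) → Vec (Fin N) N → List (Vec (Fin N) N)
  cycles [] b = b ∷ []
  cycles (a ∷ []) b = b [ a ↦ a ] ∷ []
  cycles (a ∷ A@(_ ∷ _)) b = concatMap (λ b′ → map (λ c → ins a c b′) A) (cycles A b)

  ins-↦ : ∀ {a c h} → h ≢ a → h ≢ c → ∀ b y → ins a c (b [ h ↦ y ]) ≡ ins a c b [ h ↦ y ]
  ins-↦ {a} {c} {h} h≢a h≢c b y
    rewrite lookup-↦′ (h≢c ∘ sym) b y | ↦-comm h≢a b y (lookup b c) = ↦-comm h≢c (b [ a ↦ lookup b c ]) y a

  T-ins : ∀ {a c} → All (a ≢_) A → All (c ≢_) A → ∀ x b ω → T x A (g ∘ ins a c) b ω ≡ T x A g (ins a c b) ω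
  T-ins [] [] x b ω = refl
  T-ins {h ∷ A} {g} {a} {c} (a≢h ∷ a∉A) (c≢h ∷ c∉A) x b ω = cong₂ _+_
    (trans (T-ins a∉A c∉A x _ ω) (cong (λ w → T x A g w ω) (ins-↦ (a≢h ∘ sym) (c≢h ∘ sym) b x)))
    (trans (T-ins a∉A c∉A x _ (ω ⁺)) (cong (λ w → T x A g w (ω ⁺)) (ins-↦ (a≢h ∘ sym) (c≢h ∘ sym) b h)))

  ins-at-c : ∀ {a c} → a ≢ c → ∀ b y → ins a c (b [ c ↦ y ]) ≡ b [ a ↦ y ] [ c ↦ a ]
  ins-at-c {a} {c} a≢c b y rewrite lookup-↦ c b y | ↦-comm (a≢c ∘ sym) b y y = ↦-over c (b [ a ↦ y ]) y a

  ins-at-a : ∀ {a c} → a ≢ c → ∀ b y → ins a c (b [ a ↦ y ]) ≡ ins a c b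
  ins-at-a {a} {c} a≢c b y rewrite lookup-↦′ (a≢c ∘ sym) b y = cong (_[ c ↦ a ]) (↦-over a b y (lookup b c))

  -- As a function of `b`, insertion forgets row `a`, moves the content of row `c` to row `a` and
  -- puts the constant `a` into row `c`. An exchange therefore becomes one for `g` with relabelled
  -- rows.
  Star-ins : ∀ {a c} → a ≢ c → Star g → Star (g ∘ ins a c)
  Star-ins {g} {a} {c} a≢c s .exchange {p} {q} p≢q b x y with p ≟ a | q ≟ a
  ... | yes refl | yes refl = contradiction refl p≢q
  ... | yes refl | no _ = trans (cong₂ _+_ (skip x y) (skip y x))
      (trans (ℚP.+-comm (g (ins a c (b [ q ↦ y ]))) (g (ins a c (b [ q ↦ x ])))) (sym (cong₂ _+_ (skip x x) (skip y y))))
    where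
    skip : ∀ u v → g (ins a c (b [ a ↦ u ] [ q ↦ v ])) ≡ g (ins a c (b [ q ↦ v ]))
    skip u v = cong g (trans (cong (ins a c) (↦-comm p≢q b u v)) (ins-at-a a≢c (b [ q ↦ v ]) u))
  ... | no _ | yes refl = cong₂ _+_ (skip x y x) (skip y x y)
    where
    skip : ∀ u v w → g (ins a c (b [ p ↦ u ] [ a ↦ v ])) ≡ g (ins a c (b [ p ↦ u ] [ a ↦ w ]))
    skip u v w = cong g (trans (ins-at-a a≢c (b [ p ↦ u ]) v) (sym (ins-at-a a≢c (b [ p ↦ u ]) w)))
  ... | no p≢a | no q≢a with p ≟ c | q ≟ c
  ...   | yes refl | yes refl = contradiction refl p≢q
  ...   | yes refl | no q≢c = trans (cong₂ _+_ (move x y) (move y x))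
      (trans (Star-↦ c a s .exchange (q≢a ∘ sym) b x y) (sym (cong₂ _+_ (move x x) (move y y))))
    where
    move : ∀ u v → g (ins a c (b [ c ↦ u ] [ q ↦ v ])) ≡ g (b [ a ↦ u ] [ q ↦ v ] [ c ↦ a ])
    move u v = cong g (trans (cong (ins a c) (↦-comm p≢q b u v)) (trans (ins-at-c a≢c (b [ q ↦ v ]) u)
      (cong (_[ c ↦ a ]) (↦-comm q≢a b v u))))
  ...   | no p≢c | yes refl = trans (cong₂ _+_ (move x y) (move y x))
      (trans (Star-↦ c a s .exchange p≢a b x y) (sym (cong₂ _+_ (move x x) (move y y))))
    where
    move : ∀ u v → g (ins a c (b [ p ↦ u ] [ c ↦ v ])) ≡ g (b [ p ↦ u ] [ a ↦ v ] [ c ↦ a ])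
    move u v = cong g (ins-at-c a≢c (b [ p ↦ u ]) v)
  ...   | no p≢c | no q≢c = trans (cong₂ _+_ (move x y) (move y x))
      (trans (s .exchange p≢q (ins a c b) x y) (sym (cong₂ _+_ (move x x) (move y y))))
    where
    move : ∀ u v → g (ins a c (b [ p ↦ u ] [ q ↦ v ])) ≡ g (ins a c b [ p ↦ u ] [ q ↦ v ])
    move u v = cong g (trans (ins-↦ q≢a q≢c (b [ p ↦ u ]) v) (cong (_[ q ↦ v ]) (ins-↦ p≢a p≢c b u)))

∑-Sel-swap : ∀ {A B : Set} (ys : List B) (xs : List A) (f : A → List A → B → ℚ) →
             ∑ ys (λ y → Sel xs (λ x zs → f x zs y)) ≡ Sel xs (λ x zs → ∑ ys (f x zs))
∑-Sel-swap ys [] f = ∑-0 ys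
∑-Sel-swap ys (x ∷ xs) f =
  trans (∑-+ ys _ _) (cong (∑ ys (f x xs) +_) (∑-Sel-swap ys xs (λ y zs → f y (x ∷ zs))))

fac : ℕ → ℚ
fac zero = 1ℚ
fac (suc k) = ⟦ suc k ⟧ * fac k

μ-0 : μ 0 ≡ 1ℚ
μ-0 = trans (sym (ℚP.*-identityˡ (μ 0))) (⟦⟧*μ 0)

module _ {N : ℕ} where

  open Star

  spread : List (Fin N) → (Vec (Fin N) N → ℚ) → Vec (Fin N) N → ℚ
  spread K g b = Sel K (λ x K′ → T x K′ g (b [ x ↦ x ]) μ)

  Star-spread : ∀ {g} K → Star g → Star (spread K g)
  Star-spread K s = Star-Sel K (λ x K′ → Star-↦ x x (Star-T x K′ μ s))

  -- The induction step of the averaging formula. For each common value `x`, exchanges between the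
  -- rows `a` and `c` produce three kinds of terms: those where `a` is one more row of the block,
  -- those where row `a` is a fixed point, and a discrepancy `f`. By `redirect-all` the second kind
  -- adds up to the choice of `a` as the common value, and the discrepancies cancel in pairs.
  spread-ins : ∀ {g a A} → Star g → Unique (a ∷ A) → ∀ b →
               ∑ A (λ c → spread A (g ∘ ins a c) b) ≡ ⟦ length A ⟧ * spread (a ∷ A) g b
  spread-ins {g} {a} {A} s (a∉A ∷ u) b = begin
    ∑ A (λ c → spread A (g ∘ ins a c) b)
      ≡⟨ ∑-Sel-swap A A (λ x A′ c → T x A′ (g ∘ ins a c) (b [ x ↦ x ]) μ) ⟩
    Sel A (λ x A′ → ∑ A (λ c → T x A′ (g ∘ ins a c) (b [ x ↦ x ]) μ))
      ≡⟨ Sel-cong A (λ x A′ p → per-x x A′ p (Unique-resp-↭ (↭-sym p) u) (All-resp-↭ (↭-sym p) a∉A)) ⟩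
    Sel A (λ x A′ → (n * G x A′ + R x A′) + Sel A′ (f x))
      ≡⟨ Sel-+ A (λ x A′ → n * G x A′ + R x A′) (λ x A′ → Sel A′ (f x)) ⟩
    Sel A (λ x A′ → n * G x A′ + R x A′) + Sel A (λ x A′ → Sel A′ (f x))
      ≡⟨ cong₂ _+_ (Sel-+ A (λ x A′ → n * G x A′) R) (Sel-antisym A f (λ x c A″ p → anti x c A″ (Unique-resp-↭ (↭-sym p) u) (All-resp-↭ (↭-sym p) a∉A))) ⟩
    (Sel A (λ x A′ → n * G x A′) + Sel A R) + 0ℚ
      ≡⟨ cong₂ (λ v w → (v + w) + 0ℚ) (Sel-* A n G) (redirect-all s u a (b [ a ↦ a ])) ⟩
    (n * Sel A G + n * T a A g (b [ a ↦ a ]) μ) + 0ℚ ≡⟨ lemma₀ n (Sel A G) (T a A g (b [ a ↦ a ]) μ) ⟩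
    n * (T a A g (b [ a ↦ a ]) μ + Sel A G) ∎
    where
    n = ⟦ length A ⟧
    G : Fin N → List (Fin N) → ℚ
    G x A′ = T x (a ∷ A′) g (b [ x ↦ x ]) μ
    R : Fin N → List (Fin N) → ℚ
    R x A′ = redirected g (length A) a x A′ (b [ a ↦ a ])
    -- When row `c` keeps its own value, the exchange gives row `a` the value `c`, where the
    -- expansion of the larger block wants the default `x`.
    f : Fin N → Fin N → List (Fin N) → ℚ
    f x c A″ = T x A″ g (b [ x ↦ x ] [ a ↦ c ] [ c ↦ c ]) (μ ⁺) - T x A″ g (b [ x ↦ x ] [ a ↦ x ] [ c ↦ c ]) (μ ⁺)
    lemma₀ : ∀ n a b → (n * a + n * b) + 0ℚ ≡ n * (b + a)
    lemma₀ = solve-∀ ring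

    -- Rows `x` and `c` are both fixed and row `a` carries `c - x`. By `T-exchange` the default may
    -- be `x` or `c`, so interchanging them only flips the sign.
    anti : ∀ x c A″ → Unique (x ∷ c ∷ A″) → All (a ≢_) (x ∷ c ∷ A″) → f x c A″ ≡ - f c x A″
    anti x c A″ ((x≢c ∷ _) ∷ _) (a≢x ∷ a≢c ∷ a∉A″)
      rewrite ↦-comm a≢c (b [ x ↦ x ]) c c | ↦-comm a≢c (b [ x ↦ x ]) x c
            | ↦-comm a≢x (b [ c ↦ c ]) x x | ↦-comm a≢x (b [ c ↦ c ]) c x
            | ↦-comm x≢c b x c =
      lemma (t x x) (t x c) (t c x) (t c c) (T-exchange s a∉A″ x c (b [ c ↦ c ] [ x ↦ x ]) (μ ⁺))
      where
      t : Fin N → Fin N → ℚ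
      t y z = T y A″ g (b [ c ↦ c ] [ x ↦ x ] [ a ↦ z ]) (μ ⁺)
      lemma : ∀ p q r t → p - q ≡ r - t → q - p ≡ - (r - t)
      lemma p q r t e = trans (l p q) (cong -_ e)
        where
        l : ∀ p q → q - p ≡ - (p - q)
        l = solve-∀ ring

    -- After this exchange the rows `a` and `c` agree or row `a` is a fixed point.
    swapped : ∀ x A′ ω {c} → a ≢ c → ∀ b y →
      T x A′ g (b [ a ↦ y ] [ c ↦ a ]) ω ≡
      (T x A′ g (b [ a ↦ y ] [ c ↦ y ]) ω - T x A′ g (b [ a ↦ a ] [ c ↦ y ]) ω) + T x A′ g (b [ a ↦ a ] [ c ↦ a ]) ω
    swapped x A′ ω {c} a≢c b y =
      lemma (T x A′ g (b [ a ↦ y ] [ c ↦ a ]) ω) (T x A′ g (b [ a ↦ a ] [ c ↦ y ]) ω) (T x A′ g (b [ a ↦ y ] [ c ↦ y ]) ω)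
        (T x A′ g (b [ a ↦ a ] [ c ↦ a ]) ω) (Star-T x A′ ω s .exchange a≢c b y a)
      where
      lemma : ∀ p q r t → p + q ≡ r + t → p ≡ (r - q) + t
      lemma p q r t e = trans (l₁ p q) (trans (cong (_- q) e) (l₂ q r t))
        where
        l₁ : ∀ p q → p ≡ (p + q) - q
        l₁ = solve-∀ ring
        l₂ : ∀ q r t → (r + t) - q ≡ (r - q) + t
        l₂ = solve-∀ ring

    per-x : ∀ x A′ → x ∷ A′ ↭ A → Unique (x ∷ A′) → All (a ≢_) (x ∷ A′) →
      ∑ A (λ c → T x A′ (g ∘ ins a c) (b [ x ↦ x ]) μ) ≡ (n * G x A′ + R x A′) + Sel A′ (f x)
    per-x x A′ p (x∉A′ ∷ u′) (a≢x ∷ a∉A′) = begin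
      ∑ A (λ c → T x A′ (g ∘ ins a c) U μ)
        ≡⟨ ∑-↭ (λ c → T x A′ (g ∘ ins a c) U μ) (↭-sym p) ⟩
      T x A′ (g ∘ ins a x) U μ + ∑ A′ (λ c → T x A′ (g ∘ ins a c) U μ)
        ≡⟨ cong₂ _+_ own (trans (sym (Sel-∑ A′ _)) (Sel-cong A′ λ c A″ q →
             per-c c A″ q (Unique-resp-↭ (↭-sym q) u′) (All-resp-↭ (↭-sym q) a∉A′) (All-resp-↭ (↭-sym q) x∉A′))) ⟩
      ((tx - ta) + T x A′ g (b [ a ↦ a ] [ x ↦ a ]) μ) + Sel A′ (λ c A″ → ((S₂ c A″ - S₁ c A″) + H c A″) + f x c A″)
        ≡⟨ cong (((tx - ta) + T x A′ g (b [ a ↦ a ] [ x ↦ a ]) μ) +_) splitSum ⟩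
      ((tx - ta) + T x A′ g (b [ a ↦ a ] [ x ↦ a ]) μ) + (((n′ * tx - n′ * ta) + Sel A′ H) + Sel A′ (f x))
        ≡⟨ collect n′ tx ta (T x A′ g (b [ a ↦ a ] [ x ↦ a ]) μ) (Sel A′ H) (Sel A′ (f x)) ta⁺ ⟩
      ((1ℚ + n′) * (tx + ta⁺) + (- ((1ℚ + n′) * (ta + ta⁺)) + (Sel A′ H + T x A′ g (b [ a ↦ a ] [ x ↦ a ]) μ))) + Sel A′ (f x)
        ≡⟨ cong₂ (λ k v → (k * (tx + ta⁺) + (- (k * (v μ + v (μ ⁺))) + (Sel A′ H + T x A′ g (b [ a ↦ a ] [ x ↦ a ]) μ))) + Sel A′ (f x))
             (cong ⟦_⟧ (↭-length p)) (cong (λ w → T x A′ g w) (sym (↦-comm a≢x b a x))) ⟩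
      (n * G x A′ + R x A′) + Sel A′ (f x) ∎
      where
      U = b [ x ↦ x ]
      n′ = ⟦ length A′ ⟧
      tx = T x A′ g (U [ a ↦ x ]) μ
      ta = T x A′ g (U [ a ↦ a ]) μ
      ta⁺ = T x A′ g (U [ a ↦ a ]) (μ ⁺)
      H : Fin N → List (Fin N) → ℚ
      H c A″ = T x A″ g (b [ a ↦ a ] [ x ↦ x ] [ c ↦ a ]) μ + T x A″ g (b [ a ↦ a ] [ x ↦ x ] [ c ↦ a ]) (μ ⁺)
      S₁ S₂ : Fin N → List (Fin N) → ℚ
      S₁ c A″ = T x A″ g (U [ a ↦ a ] [ c ↦ x ]) μ + T x A″ g (U [ a ↦ a ] [ c ↦ c ]) (μ ⁺)
      S₂ c A″ = T x A″ g (U [ a ↦ x ] [ c ↦ x ]) μ + T x A″ g (U [ a ↦ x ] [ c ↦ c ]) (μ ⁺)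
      collect : ∀ n tx ta y h f t → ((tx - ta) + y) + (((n * tx - n * ta) + h) + f) ≡
                ((1ℚ + n) * (tx + t) + (- ((1ℚ + n) * (ta + t)) + (h + y))) + f
      collect = solve-∀ ring
      own : T x A′ (g ∘ ins a x) U μ ≡ (tx - ta) + T x A′ g (b [ a ↦ a ] [ x ↦ a ]) μ
      own = begin
        T x A′ (g ∘ ins a x) U μ ≡⟨ T-ins a∉A′ x∉A′ x U μ ⟩
        T x A′ g (ins a x U) μ ≡⟨ cong (λ w → T x A′ g w μ) (ins-at-c a≢x b x) ⟩
        T x A′ g (b [ a ↦ x ] [ x ↦ a ]) μ ≡⟨ swapped x A′ μ a≢x b x ⟩
        (T x A′ g (b [ a ↦ x ] [ x ↦ x ]) μ - T x A′ g (b [ a ↦ a ] [ x ↦ x ]) μ) + T x A′ g (b [ a ↦ a ] [ x ↦ a ]) μ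
          ≡⟨ cong₂ (λ v w → (T x A′ g v μ - T x A′ g w μ) + T x A′ g (b [ a ↦ a ] [ x ↦ a ]) μ) (↦-comm a≢x b x x) (↦-comm a≢x b a x) ⟩
        (tx - ta) + T x A′ g (b [ a ↦ a ] [ x ↦ a ]) μ ∎
      per-c : ∀ c A″ → c ∷ A″ ↭ A′ → Unique (c ∷ A″) → All (a ≢_) (c ∷ A″) → All (x ≢_) (c ∷ A″) →
        T x A′ (g ∘ ins a c) U μ ≡ ((S₂ c A″ - S₁ c A″) + H c A″) + f x c A″
      per-c c A″ q (c∉A″ ∷ _) (a≢c ∷ a∉A″) (x≢c ∷ _) = begin
        T x A′ (g ∘ ins a c) U μ ≡⟨ T-↭ (↭-sym q) u′ x U μ ⟩
        T x A″ (g ∘ ins a c) (U [ c ↦ x ]) μ + T x A″ (g ∘ ins a c) (U [ c ↦ c ]) (μ ⁺)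
          ≡⟨ cong₂ _+_ (T-ins a∉A″ c∉A″ x _ μ) (T-ins a∉A″ c∉A″ x _ (μ ⁺)) ⟩
        T x A″ g (ins a c (U [ c ↦ x ])) μ + T x A″ g (ins a c (U [ c ↦ c ])) (μ ⁺)
          ≡⟨ cong₂ (λ v w → T x A″ g v μ + T x A″ g w (μ ⁺)) (ins-at-c a≢c U x) (ins-at-c a≢c U c) ⟩
        T x A″ g (U [ a ↦ x ] [ c ↦ a ]) μ + T x A″ g (U [ a ↦ c ] [ c ↦ a ]) (μ ⁺)
          ≡⟨ cong₂ _+_ (swapped x A″ μ a≢c U x) (swapped x A″ (μ ⁺) a≢c U c) ⟩
        ((p₁ - q₁) + r₁) + ((p₂ - q₂) + r₂) ≡⟨ l p₁ q₁ r₁ p₂ q₂ r₂ (T x A″ g (U [ a ↦ x ] [ c ↦ c ]) (μ ⁺)) ⟩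
        ((S₂ c A″ - S₁ c A″) + (r₁ + r₂)) + f x c A″
          ≡⟨ cong (λ w → ((S₂ c A″ - S₁ c A″) + (T x A″ g (w [ c ↦ a ]) μ + T x A″ g (w [ c ↦ a ]) (μ ⁺))) + f x c A″) (sym (↦-comm a≢x b a x)) ⟩
        ((S₂ c A″ - S₁ c A″) + H c A″) + f x c A″ ∎
        where
        p₁ = T x A″ g (U [ a ↦ x ] [ c ↦ x ]) μ
        q₁ = T x A″ g (U [ a ↦ a ] [ c ↦ x ]) μ
        r₁ = T x A″ g (U [ a ↦ a ] [ c ↦ a ]) μ
        p₂ = T x A″ g (U [ a ↦ c ] [ c ↦ c ]) (μ ⁺)
        q₂ = T x A″ g (U [ a ↦ a ] [ c ↦ c ]) (μ ⁺)
        r₂ = T x A″ g (U [ a ↦ a ] [ c ↦ a ]) (μ ⁺)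
        l : ∀ p₁ q₁ r₁ p₂ q₂ r₂ t → ((p₁ - q₁) + r₁) + ((p₂ - q₂) + r₂) ≡
            (((p₁ + t) - (q₁ + q₂)) + (r₁ + r₂)) + (p₂ - t)
        l = solve-∀ ring
      splitSum : Sel A′ (λ c A″ → ((S₂ c A″ - S₁ c A″) + H c A″) + f x c A″) ≡
                 ((n′ * tx - n′ * ta) + Sel A′ H) + Sel A′ (f x)
      splitSum = begin
        Sel A′ (λ c A″ → ((S₂ c A″ - S₁ c A″) + H c A″) + f x c A″)
          ≡⟨ Sel-+ A′ (λ c A″ → (S₂ c A″ - S₁ c A″) + H c A″) (f x) ⟩
        Sel A′ (λ c A″ → (S₂ c A″ - S₁ c A″) + H c A″) + Sel A′ (f x)
          ≡⟨ cong (_+ Sel A′ (f x)) (Sel-+ A′ (λ c A″ → S₂ c A″ - S₁ c A″) H) ⟩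
        (Sel A′ (λ c A″ → S₂ c A″ - S₁ c A″) + Sel A′ H) + Sel A′ (f x)
          ≡⟨ cong (λ w → (w + Sel A′ H) + Sel A′ (f x)) (Sel-- A′ S₂ S₁) ⟩
        ((Sel A′ S₂ - Sel A′ S₁) + Sel A′ H) + Sel A′ (f x)
          ≡⟨ cong₂ (λ v w → ((v - w) + Sel A′ H) + Sel A′ (f x)) (sym (T-count u′ x (U [ a ↦ x ]) μ)) (sym (T-count u′ x (U [ a ↦ a ]) μ)) ⟩
        ((n′ * tx - n′ * ta) + Sel A′ H) + Sel A′ (f x) ∎

  -- By `Star-ins` the formula for `A` applies to every `g ∘ ins a c`, and `spread-ins` adds up the
  -- results.
  cycles-sum : ∀ {g a} A → Star g → Unique (a ∷ A) → ∀ b →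
               ∑ (cycles (a ∷ A) b) g ≡ fac (length A) * spread (a ∷ A) g b
  cycles-sum {g} {a} [] s u b = trans (lemma (g (b [ a ↦ a ]))) (cong (λ m → 1ℚ * (m * g (b [ a ↦ a ]) + 0ℚ)) (sym μ-0))
    where
    lemma : ∀ x → x + 0ℚ ≡ 1ℚ * (1ℚ * x + 0ℚ)
    lemma = solve-∀ ring
  cycles-sum {g} {a} A@(_ ∷ A₁) s u@(a∉A ∷ u′) b = begin
    ∑ (concatMap (λ b′ → map (λ c → ins a c b′) A) (cycles A b)) g
      ≡⟨ ∑-concatMap (cycles A b) _ g ⟩
    ∑ (cycles A b) (λ b′ → ∑ (map (λ c → ins a c b′) A) g)
      ≡⟨ ∑-cong (cycles A b) (λ {b′} _ → ∑-map A (λ c → ins a c b′) g) ⟩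
    ∑ (cycles A b) (λ b′ → ∑ A (λ c → g (ins a c b′)))
      ≡⟨ ∑-swap (cycles A b) A (λ b′ c → g (ins a c b′)) ⟩
    ∑ A (λ c → ∑ (cycles A b) (g ∘ ins a c))
      ≡⟨ ∑-cong A (λ c∈A → cycles-sum A₁ (Star-ins (All.lookup a∉A c∈A) s) u′ b) ⟩
    ∑ A (λ c → fac (length A₁) * spread A (g ∘ ins a c) b)
      ≡⟨ ∑-* A (fac (length A₁)) _ ⟩
    fac (length A₁) * ∑ A (λ c → spread A (g ∘ ins a c) b)
      ≡⟨ cong (fac (length A₁) *_) (spread-ins s u b) ⟩
    fac (length A₁) * (⟦ length A ⟧ * spread (a ∷ A) g b)
      ≡⟨ lemma (fac (length A₁)) ⟦ length A ⟧ (spread (a ∷ A) g b) ⟩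
    fac (length A) * spread (a ∷ A) g b ∎
    where
    lemma : ∀ f n s → f * (n * s) ≡ (n * f) * s
    lemma = solve-∀ ring

-- The change of variables from `s` to `t = s - 1/2`.

pow : ℚ → ℕ → ℚ
pow q zero = 1ℚ
pow q (suc k) = q * pow q k

-- With t uniform on [-1/2, 1/2] and s = t + 1/2: ν k is the mean of (- t) ^ k and
-- moment a b is the mean of (- s) ^ a * (- t) ^ b.
ν : ℕ → ℚ
ν k = (½ * (pow ½ k + pow (- ½) k)) * recip k

moment : ℕ → ℕ → ℚ
moment zero b = ν b
moment (suc a) b = moment a (suc b) - ½ * moment a b

private
  -- `∂₁` and `∂₂` are the means of the two terms in the derivative of `(- s) ^ a * (- t) ^ b` with
  -- respect to `- t`; `boundary` is the value of that product at `t = - 1/2` minus its value at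
  -- `t = 1/2`.
  ∂₁ ∂₂ boundary : ℕ → ℕ → ℚ
  ∂₁ zero b = 0ℚ
  ∂₁ (suc a) b = ⟦ suc a ⟧ * moment a b
  ∂₂ a zero = 0ℚ
  ∂₂ a (suc b) = ⟦ suc b ⟧ * moment a b
  boundary zero b = pow ½ b - pow (- ½) b
  boundary (suc a) b = boundary a (suc b) - ½ * boundary a b

  ⟦⟧*ν : ∀ k → ⟦ suc k ⟧ * ν k ≡ ½ * (pow ½ k + pow (- ½) k)
  ⟦⟧*ν k = begin
    ⟦ suc k ⟧ * (p * recip k) ≡⟨ *-swapˡ ⟦ suc k ⟧ p (recip k) ⟩
    p * (⟦ suc k ⟧ * recip k) ≡⟨ cong (p *_) (⟦⟧-inverse k) ⟩
    p * 1ℚ ≡⟨ ℚP.*-identityʳ p ⟩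
    p ∎
    where
    p = ½ * (pow ½ k + pow (- ½) k)

  -- The fundamental theorem of calculus. For `a = 0` it is built into `ν`, and the recursion in `a`
  -- is compatible with the product rule.
  moment-parts : ∀ a b → ∂₁ a b + ∂₂ a b ≡ boundary a b
  moment-parts zero zero = refl
  moment-parts zero (suc b) = begin
    0ℚ + ⟦ suc b ⟧ * ν b ≡⟨ cong (0ℚ +_) (⟦⟧*ν b) ⟩
    0ℚ + ½ * (pow ½ b + pow (- ½) b) ≡⟨ lemma (pow ½ b) (pow (- ½) b) ⟩
    ½ * pow ½ b - - ½ * pow (- ½) b ∎
    where
    lemma : ∀ x y → 0ℚ + ½ * (x + y) ≡ ½ * x - - ½ * y
    lemma = solve-∀ ring
  moment-parts (suc a) b = begin
    ⟦ suc a ⟧ * moment a b + ∂₂ (suc a) b ≡⟨ cong (⟦ suc a ⟧ * moment a b +_) (second b) ⟩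
    (1ℚ + ⟦ a ⟧) * moment a b + (⟦ b ⟧ * moment a b - ½ * ∂₂ a b)
      ≡⟨ lemma ⟦ a ⟧ ⟦ b ⟧ (moment a b) (∂₂ a b) ⟩
    (⟦ a ⟧ * moment a b + ⟦ suc b ⟧ * moment a b) - ½ * ∂₂ a b
      ≡⟨ cong (λ w → (w + ⟦ suc b ⟧ * moment a b) - ½ * ∂₂ a b) (first a) ⟩
    ((∂₁ a (suc b) - ½ * ∂₁ a b) + ⟦ suc b ⟧ * moment a b) - ½ * ∂₂ a b
      ≡⟨ lemma₂ (∂₁ a (suc b)) (∂₁ a b) (⟦ suc b ⟧ * moment a b) (∂₂ a b) ⟩
    (∂₁ a (suc b) + ∂₂ a (suc b)) - ½ * (∂₁ a b + ∂₂ a b)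
      ≡⟨ cong₂ (λ v w → v - ½ * w) (moment-parts a (suc b)) (moment-parts a b) ⟩
    boundary a (suc b) - ½ * boundary a b ∎
    where
    lemma : ∀ a b m d → (1ℚ + a) * m + (b * m - ½ * d) ≡ (a * m + (1ℚ + b) * m) - ½ * d
    lemma = solve-∀ ring
    lemma₂ : ∀ p q r s → ((p - ½ * q) + r) - ½ * s ≡ (p + r) - ½ * (q + s)
    lemma₂ = solve-∀ ring
    lemma₃ : ∀ k x y → k * (x - ½ * y) ≡ k * x - ½ * (k * y)
    lemma₃ = solve-∀ ring
    first : ∀ a → ⟦ a ⟧ * moment a b ≡ ∂₁ a (suc b) - ½ * ∂₁ a b
    first zero = ℚP.*-zeroˡ (moment 0 b)
    first (suc a) = lemma₃ ⟦ suc a ⟧ (moment a (suc b)) (moment a b)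
    second : ∀ b → ∂₂ (suc a) b ≡ ⟦ b ⟧ * moment a b - ½ * ∂₂ a b
    second zero = sym (trans (cong (_- ½ * 0ℚ) (ℚP.*-zeroˡ (moment a 0))) refl)
    second (suc b) = lemma₃ ⟦ suc b ⟧ (moment a (suc b)) (moment a b)

  -- The factor `- s` is 0 at `t = - 1/2` and `- 1` at `t = 1/2`.
  boundary-suc : ∀ a b → boundary (suc a) b ≡ sgn a * pow (- ½) b
  boundary-suc zero b = lemma (pow ½ b) (pow (- ½) b)
    where
    lemma : ∀ x y → (½ * x - - ½ * y) - ½ * (x - y) ≡ 1ℚ * y
    lemma = solve-∀ ring
  boundary-suc (suc a) b = trans
    (cong₂ (λ v w → v - ½ * w) (boundary-suc a (suc b)) (boundary-suc a b)) (lemma (sgn a) (pow (- ½) b))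
    where
    lemma : ∀ s y → s * (- ½ * y) - ½ * (s * y) ≡ - s * y
    lemma = solve-∀ ring

-- Both are the mean of `(- s) ^ a`: integrating the derivative of `(- s) ^ (a + 1)` over the range
-- of `t` leaves only the end `s = 1`.
moment-0 : ∀ a → moment a 0 ≡ μ a
moment-0 a = begin
  moment a 0 ≡⟨ sym (ℚP.*-identityˡ (moment a 0)) ⟩
  1ℚ * moment a 0 ≡⟨ cong (_* moment a 0) (sym (⟦⟧-inverse a)) ⟩
  (⟦ suc a ⟧ * recip a) * moment a 0 ≡⟨ lemma ⟦ suc a ⟧ (recip a) (moment a 0) ⟩
  (⟦ suc a ⟧ * moment a 0 + 0ℚ) * recip a
    ≡⟨ cong (_* recip a) (trans (moment-parts (suc a) 0) (boundary-suc a 0)) ⟩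
  (sgn a * 1ℚ) * recip a ≡⟨ cong (_* recip a) (ℚP.*-identityʳ (sgn a)) ⟩
  μ a ∎
  where
  lemma : ∀ x y z → (x * y) * z ≡ (x * z + 0ℚ) * y
  lemma = solve-∀ ring

inc : ∀ {k} → Fin k → Vec ℕ k → Vec ℕ k
inc u κ = updateAt κ u suc

inc-comm : ∀ {k} (u w : Fin k) κ → inc u (inc w κ) ≡ inc w (inc u κ)
inc-comm zero zero (_ ∷ _) = refl
inc-comm zero (suc w) (_ ∷ _) = refl
inc-comm (suc u) zero (_ ∷ _) = refl
inc-comm (suc u) (suc w) (j ∷ κ) = cong (j ∷_) (inc-comm u w κ)

-- The mean of the product over `u` of `(- s_u) ^ α_u * (- t_u) ^ β_u`, with one independent
-- variable per vertex.
moments : ∀ {k} → Vec ℕ k → Vec ℕ k → ℚ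
moments [] [] = 1ℚ
moments (a ∷ α) (b ∷ β) = moment a b * moments α β

moments-inc : ∀ {k} (u : Fin k) α β → moments (inc u α) β ≡ moments α (inc u β) - ½ * moments α β
moments-inc zero (a ∷ α) (b ∷ β) = lemma (moment a (suc b)) (moment a b) (moments α β)
  where
  lemma : ∀ x y z → (x - ½ * y) * z ≡ x * z - ½ * (y * z)
  lemma = solve-∀ ring
moments-inc (suc u) (a ∷ α) (b ∷ β) rewrite moments-inc u α β =
  lemma (moment a b) (moments α (inc u β)) (moments α β)
  where
  lemma : ∀ x y z → x * (y - ½ * z) ≡ x * y - ½ * (x * z)
  lemma = solve-∀ ring

W : ∀ {k} → Vec ℕ k → ℚ
W κ = moments κ (Vec.replicate _ 0)

ν-0 : ν 0 ≡ 1ℚ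
ν-0 = trans (moment-0 0) μ-0

W-0 : ∀ k → W (Vec.replicate k 0) ≡ 1ℚ
W-0 zero = refl
W-0 (suc k) = cong₂ _*_ ν-0 (W-0 k)

incs : ∀ {k} → Fin k → ℕ → Vec ℕ k → Vec ℕ k
incs u zero κ = κ
incs u (suc j) κ = incs u j (inc u κ)

-- Independence: as long as the variable of `u` has not occurred, its powers contribute a separate
-- factor.
W-incs : ∀ {k} (u : Fin k) j κ → lookup κ u ≡ 0 → W (incs u j κ) ≡ W κ * μ j
W-incs u j κ e = trans (shape u j κ) (lemma u κ e)
  where
  others : ∀ {k} → Fin k → Vec ℕ k → ℚ
  others zero (a ∷ κ) = W κ
  others (suc u) (a ∷ κ) = moment a 0 * others u κ
  factor : ∀ {k} (u : Fin k) κ → W κ ≡ moment (lookup κ u) 0 * others u κ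
  factor zero (a ∷ κ) = refl
  factor (suc u) (a ∷ κ) = trans (cong (moment a 0 *_) (factor u κ)) (*-swapˡ (moment a 0) (moment (lookup κ u) 0) (others u κ))
  others-inc : ∀ {k} (u : Fin k) κ → others u (inc u κ) ≡ others u κ
  others-inc zero (a ∷ κ) = refl
  others-inc (suc u) (a ∷ κ) = cong (moment a 0 *_) (others-inc u κ)
  others-incs : ∀ {k} (u : Fin k) j κ → others u (incs u j κ) ≡ others u κ
  others-incs u zero κ = refl
  others-incs u (suc j) κ = trans (others-incs u j (inc u κ)) (others-inc u κ)
  lookup-incs : ∀ {k} (u : Fin k) j κ → lookup (incs u j κ) u ≡ j ℕ.+ lookup κ u
  lookup-incs u zero κ = refl
  lookup-incs u (suc j) κ = trans (lookup-incs u j (inc u κ))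
    (trans (cong (j ℕ.+_) (lookup-set u κ)) (ℕP.+-suc j _))
  shape : ∀ {k} (u : Fin k) j κ → W (incs u j κ) ≡ moment (j ℕ.+ lookup κ u) 0 * others u κ
  shape u j κ = trans (factor u (incs u j κ)) (cong₂ (λ i o → moment i 0 * o) (lookup-incs u j κ) (others-incs u j κ))
  lemma : ∀ {k} (u : Fin k) κ → lookup κ u ≡ 0 → moment (j ℕ.+ lookup κ u) 0 * others u κ ≡ W κ * μ j
  lemma u κ e = begin
    moment (j ℕ.+ lookup κ u) 0 * others u κ
      ≡⟨ cong (_* others u κ) (trans (cong (λ i → moment i 0) (trans (cong (j ℕ.+_) e) (ℕP.+-identityʳ j))) (moment-0 j)) ⟩
    μ j * others u κ ≡⟨ lemma₁ (μ j) (others u κ) ⟩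
    (1ℚ * others u κ) * μ j ≡⟨ cong (λ m → (m * others u κ) * μ j) (sym ν-0) ⟩
    (moment 0 0 * others u κ) * μ j ≡⟨ cong (λ i → (moment i 0 * others u κ) * μ j) (sym e) ⟩
    (moment (lookup κ u) 0 * others u κ) * μ j ≡⟨ cong (_* μ j) (sym (factor u κ)) ⟩
    W κ * μ j ∎
    where
    lemma₁ : ∀ m o → m * o ≡ (1ℚ * o) * m
    lemma₁ = solve-∀ ring

-- Averaging over the rotations at all vertices.

unless : {P : Set} → Dec P → ℚ → ℚ
unless (yes _) q = 0ℚ
unless (no _) q = q

unless-swap : ∀ {P Q : Set} (d : Dec P) (e : Dec Q) a b c x →
  (a + unless e b) + unless d (c + unless e x) ≡ (a + unless d c) + unless e (b + unless d x)
unless-swap (yes _) (yes _) a b c x = refl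
unless-swap (yes _) (no _) a b c x = lemma a b
  where
  lemma : ∀ a b → (a + b) + 0ℚ ≡ (a + 0ℚ) + (b + 0ℚ)
  lemma = solve-∀ ring
unless-swap (no _) (yes _) a b c x = lemma a c
  where
  lemma : ∀ a c → (a + 0ℚ) + (c + 0ℚ) ≡ (a + c) + 0ℚ
  lemma = solve-∀ ring
unless-swap (no _) (no _) a b c x = +-interchange a b c x

unless-∑ : ∀ {P A : Set} (d : Dec P) (ys : List A) f → unless d (∑ ys f) ≡ ∑ ys (λ y → unless d (f y))
unless-∑ (yes _) ys f = sym (∑-0 ys)
unless-∑ (no _) ys f = refl

T-*-ω : ∀ {N} x A (g : Vec (Fin N) N → ℚ) b k (ω : ℕ → ℚ) → T x A g b (λ j → k * ω j) ≡ k * T x A g b ω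
T-*-ω x [] g b k ω = ℚP.*-assoc k (ω 0) (g b)
T-*-ω x (h ∷ A) g b k ω = trans (cong₂ _+_ (T-*-ω x A g _ k ω) (T-*-ω x A g _ k (ω ⁺)))
  (sym (ℚP.*-distribˡ-+ k (T x A g (b [ h ↦ x ]) ω) (T x A g (b [ h ↦ h ]) (ω ⁺))))

spreadAll : ∀ {N} → List (List (Fin N)) → (Vec (Fin N) N → ℚ) → Vec (Fin N) N → ℚ
spreadAll [] g = g
spreadAll (K ∷ Ks) g = spreadAll Ks (spread K g)

cyclesAll : ∀ {N} → List (List (Fin N)) → Vec (Fin N) N → List (Vec (Fin N) N)
cyclesAll [] b = b ∷ []
cyclesAll (K ∷ Ks) b = concatMap (cycles K) (cyclesAll Ks b)

cyclicOrders : ∀ {A : Set} → List A → ℚ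
cyclicOrders [] = 1ℚ
cyclicOrders (_ ∷ A) = fac (length A)

cyclicOrdersAll : ∀ {A : Set} → List (List A) → ℚ
cyclicOrdersAll [] = 1ℚ
cyclicOrdersAll (K ∷ Ks) = cyclicOrders K * cyclicOrdersAll Ks

-- The blocks are averaged one after the other; `Star-spread` keeps the function alternating for the
-- remaining blocks.
cyclesAll-sum : ∀ {N g} (Ks : List (List (Fin N))) → Star g → All (λ K → K ≢ [] × Unique K) Ks → ∀ b →
                ∑ (cyclesAll Ks b) g ≡ cyclicOrdersAll Ks * spreadAll Ks g b
cyclesAll-sum {g = g} [] s [] b = lemma (g b)
  where
  lemma : ∀ x → x + 0ℚ ≡ 1ℚ * x
  lemma = solve-∀ ring
cyclesAll-sum ([] ∷ Ks) s ((K≢[] , _) ∷ us) b = contradiction refl K≢[]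
cyclesAll-sum {g = g} (K@(_ ∷ A) ∷ Ks) s ((_ , u) ∷ us) b = begin
  ∑ (concatMap (cycles K) (cyclesAll Ks b)) g ≡⟨ ∑-concatMap (cyclesAll Ks b) (cycles K) g ⟩
  ∑ (cyclesAll Ks b) (λ b′ → ∑ (cycles K b′) g) ≡⟨ ∑-cong (cyclesAll Ks b) (λ {b′} _ → cycles-sum A s u b′) ⟩
  ∑ (cyclesAll Ks b) (λ b′ → fac (length A) * spread K g b′) ≡⟨ ∑-* (cyclesAll Ks b) (fac (length A)) (spread K g) ⟩
  fac (length A) * ∑ (cyclesAll Ks b) (spread K g)
    ≡⟨ cong (fac (length A) *_) (cyclesAll-sum Ks (Star-spread K s) us b) ⟩
  fac (length A) * (cyclicOrdersAll Ks * spreadAll Ks (spread K g) b)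
    ≡⟨ sym (ℚP.*-assoc (fac (length A)) (cyclicOrdersAll Ks) (spreadAll Ks (spread K g) b)) ⟩
  (fac (length A) * cyclicOrdersAll Ks) * spreadAll Ks (spread K g) b ∎

module _ {n N : ℕ} (v : Fin N → Fin n) where

  private
    Functional = Vec (Fin N) N → Vec ℕ n → ℚ

  -- Every row h in A takes the common value of its block or its own value, which must be
  -- different; κ counts the second case for each block.
  Scatter : Vec (Fin N) n → List (Fin N) → Functional → Functional
  Scatter x [] F b κ = F b κ
  Scatter x (h ∷ A) F b κ =
    Scatter x A F (b [ h ↦ lookup x (v h) ]) κ
    + unless (h ≟ lookup x (v h)) (Scatter x A F (b [ h ↦ h ]) (inc (v h) κ))

  Scatter-↭ : ∀ {A B} → A ↭ B → Unique A → ∀ x F b κ → Scatter x A F b κ ≡ Scatter x B F b κ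
  Scatter-↭ refl u x F b κ = refl
  Scatter-↭ (prep h p) (_ ∷ u) x F b κ =
    cong₂ _+_ (Scatter-↭ p u x F _ κ) (cong (unless (h ≟ lookup x (v h))) (Scatter-↭ p u x F _ (inc (v h) κ)))
  Scatter-↭ (swap {A} {B} h k p) ((h≢k ∷ _) ∷ _ ∷ u) x F b κ
    rewrite ↦-comm h≢k b (lookup x (v h)) (lookup x (v k)) | ↦-comm h≢k b (lookup x (v h)) k
          | ↦-comm h≢k b h (lookup x (v k)) | ↦-comm h≢k b h k | inc-comm (v k) (v h) κ = trans
    (unless-swap dh dk (S (lookup x (v h)) (lookup x (v k)) κ) (S (lookup x (v h)) k (inc (v k) κ))
      (S h (lookup x (v k)) (inc (v h) κ)) (S h k (inc (v h) (inc (v k) κ))))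
    (cong₂ _+_ (cong₂ _+_ (Scatter-↭ p u x F _ _) (cong (unless dh) (Scatter-↭ p u x F _ _)))
      (cong (unless dk) (cong₂ _+_ (Scatter-↭ p u x F _ _) (cong (unless dh) (Scatter-↭ p u x F _ _)))))
    where
    dh = h ≟ lookup x (v h)
    dk = k ≟ lookup x (v k)
    S : Fin N → Fin N → Vec ℕ n → ℚ
    S y z κ = Scatter x A F (b [ k ↦ z ] [ h ↦ y ]) κ
  Scatter-↭ (↭.trans p q) u x F b κ = trans (Scatter-↭ p u x F b κ) (Scatter-↭ q (Unique-resp-↭ p u) x F b κ)

  Scatter-++ : ∀ x A B F b κ → Scatter x (A ++ B) F b κ ≡ Scatter x A (Scatter x B F) b κ
  Scatter-++ x [] B F b κ = refl
  Scatter-++ x (h ∷ A) B F b κ =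
    cong₂ _+_ (Scatter-++ x A B F _ κ) (cong (unless (h ≟ lookup x (v h))) (Scatter-++ x A B F _ _))

  Scatter-∑ : ∀ {Y : Set} x A (ys : List Y) (F : Y → Functional) b κ →
              Scatter x A (λ b κ → ∑ ys (λ y → F y b κ)) b κ ≡ ∑ ys (λ y → Scatter x A (F y) b κ)
  Scatter-∑ x [] ys F b κ = refl
  Scatter-∑ x (h ∷ A) ys F b κ = trans
    (cong₂ _+_ (Scatter-∑ x A ys F _ κ)
      (trans (cong (unless (h ≟ lookup x (v h))) (Scatter-∑ x A ys F _ _)) (unless-∑ (h ≟ lookup x (v h)) ys _)))
    (sym (∑-+ ys _ _))

  -- Rows at other vertices leave the exponent at `u` unchanged, so `F` and `G` have to agree only
  -- where it is zero.
  Scatter-cong-0 : ∀ {x A u F G} → All (λ h → v h ≢ u) A →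
    (∀ b κ → lookup κ u ≡ 0 → F b κ ≡ G b κ) → ∀ b κ → lookup κ u ≡ 0 → Scatter x A F b κ ≡ Scatter x A G b κ
  Scatter-cong-0 [] e b κ κu = e b κ κu
  Scatter-cong-0 {x} {h ∷ A} {u} (vh≢u ∷ d) e b κ κu = cong₂ _+_ (Scatter-cong-0 d e _ κ κu)
    (cong (unless (h ≟ lookup x (v h)))
      (Scatter-cong-0 d e _ (inc (v h) κ) (trans (lookup-keep u (v h) (vh≢u ∘ sym) κ) κu)))

  Scatter-local : ∀ {x x′ A F} → All (λ h → lookup x (v h) ≡ lookup x′ (v h)) A → ∀ b κ →
                  Scatter x A F b κ ≡ Scatter x′ A F b κ
  Scatter-local [] b κ = refl
  Scatter-local {A = h ∷ A} (e ∷ es) b κ rewrite e = cong₂ _+_ (Scatter-local es _ κ)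
    (cong (unless (h ≟ _)) (Scatter-local es _ _))

  Scatter-T : ∀ {x A u} → All (λ h → v h ≡ u × h ≢ lookup x u) A → ∀ g b κ →
    Scatter x A (λ b κ → W κ * g b) b κ ≡ T (lookup x u) A g b (λ j → W (incs u j κ))
  Scatter-T [] g b κ = refl
  Scatter-T {x} {h ∷ A} ((refl , h≢x) ∷ d) g b κ with h ≟ lookup x (v h)
  ... | yes h≡x = contradiction h≡x h≢x
  ... | no _ = cong₂ _+_ (Scatter-T d g _ κ) (Scatter-T d g _ (inc (v h) κ))

  -- The other rows follow `T`, with the moments of `u` as weights. In row `y` the own value is the
  -- common value, and `unless` prevents counting it twice.
  spread-block : ∀ {K u} → Unique K → All (λ h → v h ≡ u) K → ∀ x g b κ → lookup κ u ≡ 0 →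
    W κ * spread K g b ≡ ∑ K (λ y → Scatter (x [ u ]≔ y) K (λ b κ → W κ * g b) b κ)
  spread-block {K} {u} uK vK x g b κ κu = begin
    W κ * spread K g b ≡⟨ sym (Sel-* K (W κ) _) ⟩
    Sel K (λ y K′ → W κ * T y K′ g (b [ y ↦ y ]) μ)
      ≡⟨ Sel-cong K (λ y K′ p → sym (step y K′ p (Unique-resp-↭ (↭-sym p) uK) (All-resp-↭ (↭-sym p) vK))) ⟩
    Sel K (λ y _ → Scatter (x [ u ]≔ y) K (λ b κ → W κ * g b) b κ) ≡⟨ Sel-∑ K _ ⟩
    ∑ K (λ y → Scatter (x [ u ]≔ y) K (λ b κ → W κ * g b) b κ) ∎
    where
    step : ∀ y K′ → y ∷ K′ ↭ K → Unique (y ∷ K′) → All (λ h → v h ≡ u) (y ∷ K′) →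
      Scatter (x [ u ]≔ y) K (λ b κ → W κ * g b) b κ ≡ W κ * T y K′ g (b [ y ↦ y ]) μ
    step y K′ p (y∉K′ ∷ _) (refl ∷ vK′) = begin
      Scatter x′ K F b κ ≡⟨ Scatter-↭ (↭-sym p) uK x′ F b κ ⟩
      Scatter x′ K′ F (b [ y ↦ lookup x′ (v y) ]) κ + unless (y ≟ lookup x′ (v y)) _
        ≡⟨ own (y ≟ lookup x′ (v y)) ⟩
      Scatter x′ K′ F (b [ y ↦ lookup x′ (v y) ]) κ
        ≡⟨ Scatter-T (All.zipWith (λ (e , ne) → e , λ h≡ → ne (trans (sym x′u) (sym h≡))) (vK′ , y∉K′)) g _ κ ⟩
      T (lookup x′ (v y)) K′ g (b [ y ↦ lookup x′ (v y) ]) (λ j → W (incs (v y) j κ))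
        ≡⟨ cong (λ w → T w K′ g (b [ y ↦ w ]) (λ j → W (incs (v y) j κ))) x′u ⟩
      T y K′ g (b [ y ↦ y ]) (λ j → W (incs (v y) j κ))
        ≡⟨ T-cong-ω y K′ g _ (λ j → W-incs (v y) j κ κu) ⟩
      T y K′ g (b [ y ↦ y ]) (λ j → W κ * μ j) ≡⟨ T-*-ω y K′ g _ (W κ) μ ⟩
      W κ * T y K′ g (b [ y ↦ y ]) μ ∎
      where
      x′ = x [ v y ]≔ y
      F : Functional
      F b κ = W κ * g b
      x′u : lookup x′ (v y) ≡ y
      x′u = lookup-set (v y) x
      own : ∀ {q p} → (d : Dec (y ≡ lookup x′ (v y))) → p + unless d q ≡ p
      own (yes _) = ℚP.+-identityʳ _
      own (no ne) = contradiction (sym x′u) ne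

  module _ (K : Fin n → List (Fin N)) where

    choices : Vec (Fin N) n → List (Fin n) → List (Vec (Fin N) n)
    choices x [] = x ∷ []
    choices x (u ∷ us) = concatMap (λ x′ → map (λ y → x′ [ u ]≔ y) (K u)) (choices x us)

    blocks : List (Fin n) → List (Fin N)
    blocks [] = []
    blocks (u ∷ us) = blocks us ++ K u

    module _ (uK : ∀ u → Unique (K u)) (vK : ∀ u → All (λ h → v h ≡ u) (K u)) where

      v-blocks : ∀ {u us} → All (u ≢_) us → All (λ h → v h ≢ u) (blocks us)
      v-blocks [] = []
      v-blocks {u} {w ∷ us} (u≢w ∷ d) =
        All.tabulate λ {h} h∈ → case-∈ h (∈-++⁻ (blocks us) h∈)
        where
        case-∈ : ∀ h → h ∈ blocks us ⊎ h ∈ K w → v h ≢ u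
        case-∈ h (inj₁ i) = All.lookup (v-blocks d) i
        case-∈ h (inj₂ i) e = u≢w (trans (sym e) (All.lookup (vK w) i))

      -- All sums over common values move to the front, where `x′` records one value per vertex; the
      -- weights of all vertices are deferred to one factor `W κ` at the end.
      spreadAll-Scatter : ∀ x us → Unique us → ∀ g b κ → All (λ u → lookup κ u ≡ 0) us →
        W κ * spreadAll (map K us) g b ≡ ∑ (choices x us) (λ x′ → Scatter x′ (blocks us) (λ b κ → W κ * g b) b κ)
      spreadAll-Scatter x [] _ g b κ _ = sym (ℚP.+-identityʳ _)
      spreadAll-Scatter x (u ∷ us) (u∉us ∷ uus) g b κ (κu ∷ κus) = begin
        W κ * spreadAll (map K us) (spread (K u) g) b
          ≡⟨ spreadAll-Scatter x us uus (spread (K u) g) b κ κus ⟩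
        ∑ (choices x us) (λ x′ → Scatter x′ (blocks us) (λ b κ → W κ * spread (K u) g b) b κ)
          ≡⟨ ∑-cong (choices x us) (λ {x′} _ → step x′) ⟩
        ∑ (choices x us) (λ x′ → ∑ (K u) (λ y → Scatter (x′ [ u ]≔ y) (blocks us ++ K u) F b κ))
          ≡⟨ ∑-cong (choices x us) (λ {x′} _ → sym (∑-map (K u) _ _)) ⟩
        ∑ (choices x us) (λ x′ → ∑ (map (λ y → x′ [ u ]≔ y) (K u)) (λ x″ → Scatter x″ (blocks us ++ K u) F b κ))
          ≡⟨ sym (∑-concatMap (choices x us) _ _) ⟩
        ∑ (choices x (u ∷ us)) (λ x′ → Scatter x′ (blocks (u ∷ us)) F b κ) ∎
        where
        F : Functional
        F b κ = W κ * g b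
        step : ∀ x′ → Scatter x′ (blocks us) (λ b κ → W κ * spread (K u) g b) b κ ≡
                      ∑ (K u) (λ y → Scatter (x′ [ u ]≔ y) (blocks us ++ K u) F b κ)
        step x′ = begin
          Scatter x′ (blocks us) (λ b κ → W κ * spread (K u) g b) b κ
            ≡⟨ Scatter-cong-0 (v-blocks u∉us) (λ b κ κu → spread-block (uK u) (vK u) x′ g b κ κu) b κ κu ⟩
          Scatter x′ (blocks us) (λ b κ → ∑ (K u) (λ y → Scatter (x′ [ u ]≔ y) (K u) F b κ)) b κ
            ≡⟨ Scatter-∑ x′ (blocks us) (K u) (λ y → Scatter (x′ [ u ]≔ y) (K u) F) b κ ⟩
          ∑ (K u) (λ y → Scatter x′ (blocks us) (Scatter (x′ [ u ]≔ y) (K u) F) b κ)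
            ≡⟨ ∑-cong (K u) (λ {y} _ → trans
                 (Scatter-local (All.map (λ vh≢u → sym (lookup-keep _ u vh≢u x′)) (v-blocks u∉us)) b κ)
                 (sym (Scatter-++ _ (blocks us) (K u) F b κ))) ⟩
          ∑ (K u) (λ y → Scatter (x′ [ u ]≔ y) (blocks us ++ K u) F b κ) ∎

-- Orbits of a self-map of a finite set.

module _ {k : ℕ} (f : Fin k → Fin k) where

  iterate : ℕ → Fin k → Fin k
  iterate zero c = c
  iterate (suc i) c = iterate i (f c)

  iterate-+ : ∀ i j c → iterate (i ℕ.+ j) c ≡ iterate j (iterate i c)
  iterate-+ zero j c = refl
  iterate-+ (suc i) j c = iterate-+ i j (f c)

module _ {k : ℕ} (f : Fin k → Fin k) (R : Fin k → Set) where

  data Hit : Fin k → Set where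
    now   : ∀ {c} → R c → Hit c
    later : ∀ {c d} → f c ≡ d → Hit d → Hit c

  from-iterate : ∀ i {c} → R (iterate f i c) → Hit c
  from-iterate zero r = now r
  from-iterate (suc i) r = later refl (from-iterate i r)

  to-iterate : ∀ {c} → Hit c → ∃ λ i → R (iterate f i c)
  to-iterate (now r) = 0 , r
  to-iterate (later refl h) = let i , r = to-iterate h in suc i , r

  -- A path of more than `k` steps visits some node twice; cutting out the loop makes it strictly
  -- shorter, which pays for the decrease of `fuel`.
  shorten : ∀ fuel i c → i ℕ.≤ fuel → R (iterate f i c) → ∃ λ (l : Fin (suc k)) → R (iterate f (Fin.toℕ l) c)
  shorten fuel i c i≤fuel r with i ℕ.<? suc k
  ... | yes i<1+k = Fin.fromℕ< i<1+k , subst (λ l → R (iterate f l c)) (sym (toℕ-fromℕ< i<1+k)) r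
  shorten zero zero c ℕ.z≤n r | no i≮1+k = contradiction (ℕ.s≤s ℕ.z≤n) i≮1+k
  shorten (suc fuel) i c i≤fuel r | no i≮1+k
    with pigeonhole (ℕP.n<1+n k) (λ (l : Fin (suc k)) → iterate f (Fin.toℕ l) c)
  ... | p , q , p<q , same =
    shorten fuel (Fin.toℕ p ℕ.+ (i ℕ.∸ Fin.toℕ q)) c shorter (subst R step r)
    where
    q≤i : Fin.toℕ q ℕ.≤ i
    q≤i = ℕP.≤-trans (ℕP.<⇒≤ (toℕ<n q)) (ℕP.≮⇒≥ i≮1+k)
    step : iterate f i c ≡ iterate f (Fin.toℕ p ℕ.+ (i ℕ.∸ Fin.toℕ q)) c
    step = begin
      iterate f i c ≡⟨ cong (λ l → iterate f l c) (sym (ℕP.m+[n∸m]≡n q≤i)) ⟩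
      iterate f (Fin.toℕ q ℕ.+ (i ℕ.∸ Fin.toℕ q)) c ≡⟨ iterate-+ f (Fin.toℕ q) _ c ⟩
      iterate f (i ℕ.∸ Fin.toℕ q) (iterate f (Fin.toℕ q) c) ≡⟨ cong (iterate f (i ℕ.∸ Fin.toℕ q)) (sym same) ⟩
      iterate f (i ℕ.∸ Fin.toℕ q) (iterate f (Fin.toℕ p) c) ≡⟨ sym (iterate-+ f (Fin.toℕ p) _ c) ⟩
      iterate f (Fin.toℕ p ℕ.+ (i ℕ.∸ Fin.toℕ q)) c ∎
    shorter : Fin.toℕ p ℕ.+ (i ℕ.∸ Fin.toℕ q) ℕ.≤ fuel
    shorter = ℕP.≤-pred (ℕP.≤-trans (ℕP.<-≤-trans (ℕP.+-monoˡ-< _ p<q) (ℕP.≤-reflexive (ℕP.m+[n∸m]≡n q≤i))) i≤fuel)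

  opaque
    Hit? : Decidable R → Decidable Hit
    Hit? R? c = map′ (λ (l , r) → from-iterate (Fin.toℕ l) r)
      (λ h → let i , r = to-iterate h in shorten i i c ℕP.≤-refl r)
      (any? (λ (l : Fin (suc k)) → R? (iterate f (Fin.toℕ l) c)))

indicator : {P : Set} → Dec P → ℚ
indicator (yes _) = 1ℚ
indicator (no _) = 0ℚ

indicator-yes : ∀ {A : Set} (d : Dec A) → A → indicator d ≡ 1ℚ
indicator-yes (yes _) a = refl
indicator-yes (no n) a = contradiction a n

indicator-no : ∀ {A : Set} (d : Dec A) → ¬ A → indicator d ≡ 0ℚ
indicator-no (yes a) n = contradiction a n
indicator-no (no _) n = refl

indicator-⇔ : ∀ {P Q : Set} (d : Dec P) (e : Dec Q) → (P → Q) → (Q → P) → indicator d ≡ indicator e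
indicator-⇔ (yes _) (yes _) f g = refl
indicator-⇔ (yes p) (no ¬q) f g = contradiction (f p) ¬q
indicator-⇔ (no ¬p) (yes q) f g = contradiction (g q) ¬p
indicator-⇔ (no _) (no _) f g = refl

-- Rootedness of a functional graph is weakly alternating.

module _ {M : ℕ} (j : Fin (suc M) → Fin (suc M)) where

  private
    Node = Fin (suc M)
    Assignment = Vec Node (suc M)

  -- The face permutation, with `j` in the role of `ι`: a node reads the row of its opposite
  -- half-edge.
  next : Assignment → Node → Node
  next b c = lookup b (j c)

  Rooted : Assignment → Set
  Rooted b = ∀ c → Hit (next b) (_≡ zero) c

  Rooted? : ∀ b → Dec (Rooted b)
  Rooted? b = all? (Hit? (next b) (_≡ zero) (_≟ zero))

  rooted : Assignment → ℚ
  rooted b = indicator (Rooted? b)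

  Hit-mono : ∀ (b b′ : Assignment) → (∀ c → c ≢ zero → next b c ≡ next b′ c) →
             ∀ {c} → Hit (next b) (_≡ zero) c → Hit (next b′) (_≡ zero) c
  Hit-mono b b′ e (now r) = now r
  Hit-mono b b′ e {c} (later refl h) with c ≟ zero
  ... | yes c≡0 = now c≡0
  ... | no c≢0 = later (sym (e c c≢0)) (Hit-mono b b′ e h)

  module _ (j-invol : ∀ h → j (j h) ≡ h) (j-zero : j zero ≡ zero) where

    j≢ : ∀ {c p} → c ≢ j p → j c ≢ p
    j≢ c≢jp refl = c≢jp (sym (j-invol _))

    -- As `j` fixes the root, only the root itself reads its row, and there the path has already
    -- ended.
    rooted-zero : ∀ b u w → rooted (b [ zero ↦ u ]) ≡ rooted (b [ zero ↦ w ])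
    rooted-zero b u w = indicator-⇔ (Rooted? (b [ zero ↦ u ])) (Rooted? (b [ zero ↦ w ]))
      (λ r c → Hit-mono (b [ zero ↦ u ]) (b [ zero ↦ w ]) (same u w) (r c))
      (λ r c → Hit-mono (b [ zero ↦ w ]) (b [ zero ↦ u ]) (same w u) (r c))
      where
      same : ∀ u w c → c ≢ zero → next (b [ zero ↦ u ]) c ≡ next (b [ zero ↦ w ]) c
      same u w c c≢0 = trans (lookup-↦′ jc≢0 b u) (sym (lookup-↦′ jc≢0 b w))
        where
        jc≢0 : j c ≢ zero
        jc≢0 = j≢ (λ e → c≢0 (trans e j-zero))

    -- Off the rows p and q every node flows to the root, to j p or to j q. Only these three
    -- destinations of the values of the rows p and q matter.
    module _ {p q : Node} (p≢q : p ≢ q) (p≢0 : p ≢ zero) (q≢0 : q ≢ zero) (b : Assignment) where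

      private
        data End : Set where
          O P Q : End

        point : End → Node
        point O = zero
        point P = j p
        point Q = j q

        jp≢0 : j p ≢ zero
        jp≢0 e = p≢0 (trans (sym (j-invol p)) (trans (cong j e) j-zero))
        jq≢0 : j q ≢ zero
        jq≢0 e = q≢0 (trans (sym (j-invol q)) (trans (cong j e) j-zero))

        isEnd : Node → Set
        isEnd c = c ≡ zero ⊎ (c ≡ j p ⊎ c ≡ j q)

        isEnd? : ∀ c → Dec (isEnd c)
        isEnd? c = c ≟ zero ⊎-dec (c ≟ j p ⊎-dec c ≟ j q)

        point-root : ∀ e → point e ≡ zero → e ≡ O
        point-root O _ = refl
        point-root P eq = contradiction eq jp≢0
        point-root Q eq = contradiction eq jq≢0

        data EndsAt : Node → End → Set where
          stop : ∀ {c e} → c ≡ point e → EndsAt c e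
          go   : ∀ {c e} → ¬ isEnd c → EndsAt (next b c) e → EndsAt c e

        endsNow : ∀ {c} → isEnd c → ∃ (EndsAt c)
        endsNow (inj₁ e) = O , stop e
        endsNow (inj₂ (inj₁ e)) = P , stop e
        endsNow (inj₂ (inj₂ e)) = Q , stop e

        ends : ∀ {c} → Hit (next b) isEnd c → ∃ (EndsAt c)
        ends (now r) = endsNow r
        ends {c} (later refl h) with isEnd? c
        ... | yes r = endsNow r
        ... | no n = let e , x = ends h in e , go n x

        set : Node → Node → Assignment
        set α β = b [ p ↦ α ] [ q ↦ β ]

        set-p : ∀ α β → next (set α β) (j p) ≡ α
        set-p α β = trans (cong (lookup (set α β)) (j-invol p))
          (trans (lookup-↦′ p≢q (b [ p ↦ α ]) β) (lookup-↦ p b α))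

        set-q : ∀ α β → next (set α β) (j q) ≡ β
        set-q α β = trans (cong (lookup (set α β)) (j-invol q)) (lookup-↦ q (b [ p ↦ α ]) β)

        set-other : ∀ α β {c} → ¬ isEnd c → next (set α β) c ≡ next b c
        set-other α β n = trans (lookup-↦′ (j≢ (n ∘ inj₂ ∘ inj₂)) (b [ p ↦ α ]) β) (lookup-↦′ (j≢ (n ∘ inj₂ ∘ inj₁)) b α)

        -- A path that avoids `j p` and `j q` never reads the rows `p` and `q`, so it also avoids
        -- the root for all values of these rows.
        never : ∀ α β {c} → ¬ Hit (next b) isEnd c → ¬ Hit (next (set α β)) (_≡ zero) c
        never α β n (now e) = n (now (inj₁ e))
        never α β {c} n (later e h) with isEnd? c
        ... | yes r = n (now r)
        ... | no ne = never α β (n ∘ later (trans (sym (set-other α β ne)) e)) h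

        Hit₀ : Node → Node → Node → Set
        Hit₀ α β = Hit (next (set α β)) (_≡ zero)

        module _ (α β : Node) {eα eβ : End} (xα : EndsAt α eα) (xβ : EndsAt β eβ) where

          follow : ∀ {c e} → EndsAt c e → Hit₀ α β (point e) → Hit₀ α β c
          follow (stop refl) h = h
          follow (go n x) h = later (set-other α β n) (follow x h)

          hit-p : Hit₀ α β α → Hit₀ α β (j p)
          hit-p h = later (set-p α β) h

          hit-q : Hit₀ α β β → Hit₀ α β (j q)
          hit-q h = later (set-q α β) h

          -- A set of ends that is closed under the two arrows and omits the root cannot be left.
          trapped : (S : End → Set) → ¬ S O → (S P → S eα) → (S Q → S eβ) → ∀ {c e} → EndsAt c e → S e → ¬ Hit₀ α β c
          trapped S ¬O sP sQ (stop refl) s (now e) =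
            ¬O (subst S (point-root _ e) s)
          trapped S ¬O sP sQ {e = O} (stop refl) s (later _ h) = ¬O s
          trapped S ¬O sP sQ {e = P} (stop refl) s (later e h) =
            trapped S ¬O sP sQ (subst (λ d → EndsAt d eα) (trans (sym (set-p α β)) e) xα) (sP s) h
          trapped S ¬O sP sQ {e = Q} (stop refl) s (later e h) =
            trapped S ¬O sP sQ (subst (λ d → EndsAt d eβ) (trans (sym (set-q α β)) e) xβ) (sQ s) h
          trapped S ¬O sP sQ (go n x) s (now e) = n (inj₁ e)
          trapped S ¬O sP sQ (go n x) s (later e h) =
            trapped S ¬O sP sQ (subst (λ d → EndsAt d _) (trans (sym (set-other α β n)) e) x) s h

        -- Contracted to three nodes, the graph has an arrow from `P` to the first argument and one
        -- from `Q` to the second. The value is 1 exactly when this is a tree with root `O`.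
        table : End → End → ℚ
        table O O = 1ℚ
        table O P = 1ℚ
        table Q O = 1ℚ
        table _ _ = 0ℚ

        module _ (hits : ∀ c → ∃ (EndsAt c)) where

          reach : ∀ {α β eα eβ} (xα : EndsAt α eα) (xβ : EndsAt β eβ) → Hit₀ α β (j p) → Hit₀ α β (j q) →
                  Rooted (set α β)
          reach {α} {β} xα xβ hp hq c with hits c
          ... | O , x = follow α β xα xβ x (now refl)
          ... | P , x = follow α β xα xβ x hp
          ... | Q , x = follow α β xα xβ x hq

          rooted-table : ∀ α β {eα eβ} → EndsAt α eα → EndsAt β eβ → rooted (set α β) ≡ table eα eβ
          rooted-table α β {O} {O} xα xβ = indicator-yes (Rooted? (set α β))
            (reach xα xβ (hit-p α β xα xβ (follow α β xα xβ xα (now refl))) (hit-q α β xα xβ (follow α β xα xβ xβ (now refl))))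
          rooted-table α β {O} {P} xα xβ = indicator-yes (Rooted? (set α β)) (reach xα xβ hp (hit-q α β xα xβ (follow α β xα xβ xβ hp)))
            where
            hp = hit-p α β xα xβ (follow α β xα xβ xα (now refl))
          rooted-table α β {Q} {O} xα xβ = indicator-yes (Rooted? (set α β)) (reach xα xβ (hit-p α β xα xβ (follow α β xα xβ xα hq)) hq)
            where
            hq = hit-q α β xα xβ (follow α β xα xβ xβ (now refl))
          rooted-table α β {P} {e} xα xβ = trans (indicator-no (Rooted? (set α β)) (λ r →
            trapped α β xα xβ (_≡ P) (λ ()) (λ _ → refl) (λ ()) {e = P} (stop refl) refl (r (j p)))) (sym (zeroP e))
            where
            zeroP : ∀ e → table P e ≡ 0ℚ
            zeroP O = refl
            zeroP P = refl
            zeroP Q = refl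
          rooted-table α β {O} {Q} xα xβ = indicator-no (Rooted? (set α β)) (λ r →
            trapped α β xα xβ (_≡ Q) (λ ()) (λ ()) (λ _ → refl) {e = Q} (stop refl) refl (r (j q)))
          rooted-table α β {Q} {Q} xα xβ = indicator-no (Rooted? (set α β)) (λ r →
            trapped α β xα xβ (_≡ Q) (λ ()) (λ ()) (λ _ → refl) {e = Q} (stop refl) refl (r (j q)))
          rooted-table α β {Q} {P} xα xβ = indicator-no (Rooted? (set α β)) (λ r →
            trapped α β xα xβ (_≢ O) (λ ne → ne refl) (λ _ ()) (λ _ ()) {e = P} (stop refl) (λ ()) (r (j p)))

          table-exchange : ∀ d e → table d e + table e d ≡ table d d + table e e
          table-exchange O O = refl
          table-exchange O P = refl
          table-exchange O Q = refl
          table-exchange P O = refl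
          table-exchange P P = refl
          table-exchange P Q = refl
          table-exchange Q O = refl
          table-exchange Q P = refl
          table-exchange Q Q = refl

      rooted-exchange : ∀ x y →
        rooted (b [ p ↦ x ] [ q ↦ y ]) + rooted (b [ p ↦ y ] [ q ↦ x ]) ≡
        rooted (b [ p ↦ x ] [ q ↦ x ]) + rooted (b [ p ↦ y ] [ q ↦ y ])
      rooted-exchange x y with all? (Hit? (next b) isEnd isEnd?)
      ... | yes h = let hits = λ c → ends (h c) ; ex , dx = hits x ; ey , dy = hits y in
        trans (cong₂ _+_ (rooted-table hits x y dx dy) (rooted-table hits y x dy dx))
          (trans (table-exchange hits ex ey) (sym (cong₂ _+_ (rooted-table hits x x dx dx) (rooted-table hits y y dy dy))))
      ... | no ¬h with ¬∀⟶∃¬ _ _ (Hit? (next b) isEnd isEnd?) ¬h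
      ...   | c , n = trans (cong₂ _+_ (none x y) (none y x)) (sym (cong₂ _+_ (none x x) (none y y)))
        where
        none : ∀ α β → rooted (set α β) ≡ 0ℚ
        none α β = indicator-no (Rooted? (set α β)) (λ r → never α β n (r c))

    Star-rooted : Star rooted
    Star-rooted .Star.exchange {p} {q} p≢q b x y with p ≟ zero | q ≟ zero
    ... | yes refl | yes refl = contradiction refl p≢q
    ... | yes refl | no _ = trans (cong₂ _+_ (skip x y y) (skip y x x)) (ℚP.+-comm (rooted (b [ p ↦ y ] [ q ↦ y ])) (rooted (b [ p ↦ x ] [ q ↦ x ])))
      where
      skip : ∀ u w v → rooted (b [ zero ↦ u ] [ q ↦ v ]) ≡ rooted (b [ zero ↦ w ] [ q ↦ v ])
      skip u w v = trans (cong rooted (↦-comm p≢q b u v))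
        (trans (rooted-zero (b [ q ↦ v ]) u w) (cong rooted (sym (↦-comm p≢q b w v))))
    ... | no _ | yes refl = cong₂ _+_ (rooted-zero (b [ p ↦ x ]) y x) (rooted-zero (b [ p ↦ y ]) x y)
    ... | no p≢0 | no q≢0 = rooted-exchange p≢q p≢0 q≢0 b x y

-- Rooted configurations of a graph with a leaf.

Scatter-vanish : ∀ {n N} {v : Fin N → Fin n} {x F} (Q : List (Fin N) → Vec (Fin N) N → Set) →
  (∀ {h A b} → Q (h ∷ A) b → Q A (b [ h ↦ lookup x (v h) ]) × Q A (b [ h ↦ h ])) →
  (∀ {b κ} → Q [] b → F b κ ≡ 0ℚ) → ∀ A {b κ} → Q A b → Scatter v x A F b κ ≡ 0ℚ
Scatter-vanish Q step base [] q = base q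
Scatter-vanish {v = v} {x} {F} Q step base (h ∷ A) {b} {κ} q =
  trans (cong₂ _+_ (Scatter-vanish Q step base A (proj₁ (step q)))
    (cong (unless (h ≟ lookup x (v h))) (Scatter-vanish Q step base A (proj₂ (step q)))))
    (zeroes (h ≟ lookup x (v h)))
  where
  zeroes : ∀ {P : Set} (d : Dec P) → 0ℚ + unless d 0ℚ ≡ 0ℚ
  zeroes (yes _) = refl
  zeroes (no _) = refl

-- A graph with n + 1 vertices and m edges to which a leaf has been attached: zero is the leaf
-- together with its half-edge, attached at the vertex zero; v, l, r, j give the vertex of a
-- half-edge, the two halves of an edge and the other half.
record Rooting (n M m : ℕ) : Set where
  field
    v : Fin (suc M) → Fin (suc n)
    v-zero : v zero ≡ zero
    j : Fin (suc M) → Fin (suc M)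
    j-invol : ∀ h → j (j h) ≡ h
    j-zero : j zero ≡ zero
    l r : Fin m → Fin (suc M)
    j-l : ∀ e → j (l e) ≡ r e
    cover : ∀ h → h ≡ zero ⊎ ∃ λ e → h ≡ l e ⊎ h ≡ r e
    l≢0 : ∀ e → l e ≢ zero
    r≢0 : ∀ e → r e ≢ zero
    l-injective : ∀ {e e′} → l e ≡ l e′ → e ≡ e′
    r-injective : ∀ {e e′} → r e ≡ r e′ → e ≡ e′
    l≢r : ∀ e e′ → l e ≢ r e′

  j-r : ∀ e → j (r e) ≡ l e
  j-r e = trans (cong j (sym (j-l e))) (j-invol (l e))

module _ {n M m : ℕ} (R : Rooting n M m) where
  open Rooting R

  private
    Node = Fin (suc M)
    Assignment = Vec Node (suc M)
    Hit₀ : Assignment → Node → Set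
    Hit₀ b = Hit (next j b) (_≡ zero)

  -- `x` names at each vertex the half-edge that should lead towards the root; this is the vertex at
  -- its other end.
  parent : Vec Node (suc n) → Fin (suc n) → Fin (suc n)
  parent x u = v (j (lookup x u))

  Tree : Vec Node (suc n) → Set
  Tree x = lookup x zero ≡ zero × (∀ u → Hit (parent x) (_≡ zero) u)

  Tree? : ∀ x → Dec (Tree x)
  Tree? x = (lookup x zero ≟ zero) ×-dec all? (Hit? (parent x) (_≡ zero) (_≟ zero))

  halves : List (Fin m) → List Node
  halves [] = []
  halves (e ∷ es) = l e ∷ r e ∷ halves es

  l∉halves : ∀ {e es} → All (e ≢_) es → All (l e ≢_) (halves es)
  l∉halves [] = []
  l∉halves {e} {e′ ∷ _} (e≢ ∷ d) = e≢ ∘ l-injective ∷ l≢r e e′ ∷ l∉halves d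

  r∉halves : ∀ {e es} → All (e ≢_) es → All (r e ≢_) (halves es)
  r∉halves [] = []
  r∉halves {e} {e′ ∷ _} (e≢ ∷ d) = (λ p → l≢r e′ e (sym p)) ∷ e≢ ∘ r-injective ∷ r∉halves d

  halves-unique : ∀ es → Unique es → Unique (halves es)
  halves-unique [] _ = []
  halves-unique (e ∷ es) (e∉ ∷ u) = (l≢r e e ∷ l∉halves e∉) ∷ r∉halves e∉ ∷ halves-unique es u

  zero∉halves : ∀ es → All (zero ≢_) (halves es)
  zero∉halves [] = []
  zero∉halves (e ∷ es) = l≢0 e ∘ sym ∷ r≢0 e ∘ sym ∷ zero∉halves es

  l∈halves : ∀ {e es} → e ∈ es → l e ∈ halves es
  l∈halves (here refl) = here refl
  l∈halves (there i) = there (there (l∈halves i))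

  r∈halves : ∀ {e es} → e ∈ es → r e ∈ halves es
  r∈halves (here refl) = there (here refl)
  r∈halves (there i) = there (there (r∈halves i))

  module _ (x : Vec Node (suc n)) (x-section : ∀ u → v (lookup x u) ≡ u) where

    private
      X : Node → Node
      X h = lookup x (v h)

      Valid : Assignment → Node → Set
      Valid b h = lookup b h ≡ X h ⊎ lookup b h ≡ h

      valid-x : ∀ b u → Valid b (lookup x u) → lookup b (lookup x u) ≡ lookup x u
      valid-x b u (inj₁ e) = trans e (cong (lookup x) (x-section u))
      valid-x b u (inj₂ e) = e

      Fixed : Assignment → Fin m → Set
      Fixed b e = lookup b (l e) ≡ l e × lookup b (r e) ≡ r e

    -- A node `c` reads row `j c`. If this row holds the chosen half-edge of its vertex, the path
    -- enters the tree. If it is fixed, the next row read is `c`, which is then not fixed, and the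
    -- path enters the tree at the vertex of `c`. Chosen half-edges are always fixed, so on the tree
    -- their opposite rows are not, and the path goes on from parent to parent.
    tree-rooted : Tree x → ∀ b → (∀ h → Valid b h) → (∀ e → ¬ Fixed b e) → Rooted j b
    tree-rooted (x0 , t) b valid ¬fixed = hit
      where
      ¬both : ∀ h → h ≢ zero → lookup b h ≡ h → lookup b (j h) ≡ j h → ⊥
      ¬both h h≢0 p q with cover h
      ... | inj₁ h≡0 = h≢0 h≡0
      ... | inj₂ (e , inj₁ refl) = ¬fixed e (p , subst (λ d → lookup b d ≡ d) (j-l e) q)
      ... | inj₂ (e , inj₂ refl) = ¬fixed e (subst (λ d → lookup b d ≡ d) (j-r e) q , p)
      j≢0 : ∀ {c} → c ≢ zero → j c ≢ zero
      j≢0 c≢0 e = c≢0 (trans (sym (j-invol _)) (trans (cong j e) j-zero))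
      hit-x : ∀ {u} → Hit (parent x) (_≡ zero) u → Hit₀ b (lookup x u)
      hit-x (now refl) = now x0
      hit-x {u} (later refl h) with lookup x u ≟ zero
      ... | yes e = now e
      ... | no c≢0 with valid (j (lookup x u))
      ...   | inj₁ e = later e (hit-x h)
      ...   | inj₂ e = contradiction (trans (cong (lookup b) (j-invol (lookup x u)))
                         (trans (valid-x b u (valid (lookup x u))) (sym (j-invol (lookup x u))))) (¬both _ (j≢0 c≢0) e)
      hit : ∀ c → Hit₀ b c
      hit c with c ≟ zero
      ... | yes e = now e
      ... | no c≢0 with valid (j c) | valid c
      ...   | inj₁ e | _ = later e (hit-x (t (v (j c))))
      ...   | inj₂ e | inj₁ f = later e (later (trans (cong (lookup b) (j-invol c)) f) (hit-x (t (v c))))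
      ...   | inj₂ e | inj₂ f = contradiction e (¬both c c≢0 f)

    -- From the chosen half-edge of `u` the path moves to that of the parent or, if the opposite row
    -- is fixed, returns to its start after two steps. Since the path reaches the root, so does the
    -- chain of parents.
    rooted-tree : ∀ b → (∀ h → Valid b h) → Rooted j b → Tree x
    rooted-tree b valid rt = x0 , λ u → to-parent (rt (lookup x u)) refl
      where
      at-root : ∀ {u} → lookup x u ≡ zero → u ≡ zero
      at-root {u} e = trans (sym (x-section u)) (trans (cong v e) v-zero)
      to-parent : ∀ {c u} → Hit₀ b c → c ≡ lookup x u → Hit (parent x) (_≡ zero) u
      to-parent (now c≡0) refl = now (at-root c≡0)
      to-parent {u = u} (later refl h) refl with valid (j (lookup x u))
      ... | inj₁ e = later refl (to-parent h e)
      to-parent {u = u} (later refl (now d≡0)) refl | inj₂ e =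
        now (at-root (trans (sym (j-invol _)) (trans (cong j (trans (sym e) d≡0)) j-zero)))
      to-parent {u = u} (later refl (later refl h)) refl | inj₂ e =
        to-parent h (trans (cong (lookup b) (trans (cong j e) (j-invol _))) (valid-x b u (valid (lookup x u))))
      -- Unless the leaf is chosen at its vertex, no arrow from another node enters the root.
      x0 : lookup x zero ≡ zero
      x0 with lookup x zero ≟ zero
      ... | yes e = e
      ... | no ne = contradiction ne (stuck (rt (lookup x zero)))
        where
        stuck : ∀ {c} → Hit₀ b c → c ≢ zero → ⊥
        stuck (now e) c≢0 = c≢0 e
        stuck {c} (later refl h) c≢0 = stuck h λ e → case-valid e (valid (j c))
          where
          case-valid : lookup b (j c) ≡ zero → Valid b (j c) → ⊥
          case-valid e (inj₁ f) = let g = trans (sym f) e in ne (subst (λ u → lookup x u ≡ zero) (at-root g) g)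
          case-valid e (inj₂ f) = c≢0 (trans (sym (j-invol c)) (trans (cong j (trans (sym f) e)) j-zero))

    -- The two halves form a cycle of length two.
    fixed-unrooted : ∀ b e → Fixed b e → ¬ Rooted j b
    fixed-unrooted b e (p , q) rt = trapped (rt (l e)) (inj₁ refl)
      where
      trapped : ∀ {c} → Hit₀ b c → c ≡ l e ⊎ c ≡ r e → ⊥
      trapped (now refl) (inj₁ c≡) = l≢0 e (sym c≡)
      trapped (now refl) (inj₂ c≡) = r≢0 e (sym c≡)
      trapped (later refl h) (inj₁ refl) = trapped h (inj₂ (trans (cong (lookup b) (j-l e)) q))
      trapped (later refl h) (inj₂ refl) = trapped h (inj₁ (trans (cong (lookup b) (j-r e)) p))

    private
      G : Assignment → Vec ℕ (suc n) → ℚ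
      G b κ = W κ * rooted j b

      Scatter-fixed : ∀ {A e} → All (l e ≢_) A → All (r e ≢_) A → ∀ b κ → Fixed b e → Scatter v x A G b κ ≡ 0ℚ
      Scatter-fixed {A} {e} l∉A r∉A b κ fixed =
        Scatter-vanish (λ A b → All (l e ≢_) A × All (r e ≢_) A × Fixed b e)
          (λ {h} {A} {b} → λ { (l≢h ∷ l∉ , r≢h ∷ r∉ , p , q) →
            let keep = λ y → trans (lookup-↦′ l≢h b y) p , trans (lookup-↦′ r≢h b y) q in
            (l∉ , r∉ , keep (lookup x (v h))) , (l∉ , r∉ , keep h) })
          (λ {b} {κ} (_ , _ , f) → trans (cong (W κ *_) (indicator-no (Rooted? j b) (fixed-unrooted b e f))) (ℚP.*-zeroʳ (W κ)))
          A (l∉A , r∉A , fixed)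

    Scatter-¬tree : ∀ A → (∀ h → h ∈ A) → ¬ Tree x → ∀ b κ → Scatter v x A G b κ ≡ 0ℚ
    Scatter-¬tree A all∈ ¬t b κ =
      Scatter-vanish (λ A b → ∀ h → h ∈ A ⊎ Valid b h)
        (λ {h} {A} {b} q → assign h A b (inj₁ refl) q , assign h A b (inj₂ refl) q)
        (λ {b} {κ} q → trans (cong (W κ *_) (indicator-no (Rooted? j b) (¬t ∘ rooted-tree b (done b q)))) (ℚP.*-zeroʳ (W κ)))
        A (inj₁ ∘ all∈)
      where
      done : ∀ b → (∀ h → h ∈ [] ⊎ Valid b h) → ∀ h → Valid b h
      done b q h with q h
      ... | inj₂ d = d
      assign : ∀ h A b {y} → y ≡ X h ⊎ y ≡ h → (∀ h′ → h′ ∈ h ∷ A ⊎ Valid b h′) → ∀ h′ → h′ ∈ A ⊎ Valid (b [ h ↦ y ]) h′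
      assign h A b {y} y≡ q h′ with h′ ≟ h
      ... | yes refl = inj₂ (subst (λ w → w ≡ X h ⊎ w ≡ h) (sym (lookup-↦ h b y)) y≡)
      ... | no h′≢h with q h′
      ...   | inj₁ (here e) = contradiction e h′≢h
      ...   | inj₁ (there i) = inj₁ i
      ...   | inj₂ d = inj₂ (subst (λ w → w ≡ X h′ ⊎ w ≡ h′) (sym (lookup-↦′ h′≢h b y)) d)

    OnTree : Fin m → Set
    OnTree e = l e ≡ lookup x (v (l e)) ⊎ r e ≡ lookup x (v (r e))

    onTree? : ∀ e → Dec (OnTree e)
    onTree? e = (l e ≟ X (l e)) ⊎-dec (r e ≟ X (r e))

    -- The expanded product over the edges off the tree, with factors `1 - s - s′` in `orient₃` and
    -- `- t - t′` in `orient₂`; the multi-index collects the exponents.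
    orient₃ orient₂ : List (Fin m) → (Vec ℕ (suc n) → ℚ) → Vec ℕ (suc n) → ℚ
    orient₃ [] Φ κ = Φ κ
    orient₃ (e ∷ es) Φ κ with onTree? e
    ... | yes _ = orient₃ es Φ κ
    ... | no _ = orient₃ es Φ κ + (orient₃ es Φ (inc (v (l e)) κ) + orient₃ es Φ (inc (v (r e)) κ))
    orient₂ [] Φ κ = Φ κ
    orient₂ (e ∷ es) Φ κ with onTree? e
    ... | yes _ = orient₂ es Φ κ
    ... | no _ = orient₂ es Φ (inc (v (l e)) κ) + orient₂ es Φ (inc (v (r e)) κ)

    module _ (t : Tree x) where

      -- The ends of `e` would be each other's parents, a cycle that misses the root.
      ¬both-x : ∀ e → l e ≡ X (l e) → r e ≡ X (r e) → ⊥
      ¬both-x e p q = trapped (proj₂ t (v (l e))) (inj₁ refl)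
        where
        vl≢0 : v (l e) ≢ zero
        vl≢0 eq = l≢0 e (trans p (trans (cong (lookup x) eq) (proj₁ t)))
        vr≢0 : v (r e) ≢ zero
        vr≢0 eq = r≢0 e (trans q (trans (cong (lookup x) eq) (proj₁ t)))
        trapped : ∀ {u} → Hit (parent x) (_≡ zero) u → u ≡ v (l e) ⊎ u ≡ v (r e) → ⊥
        trapped (now refl) (inj₁ eq) = vl≢0 (sym eq)
        trapped (now refl) (inj₂ eq) = vr≢0 (sym eq)
        trapped (later refl h) (inj₁ refl) = trapped h (inj₂ (trans (cong (v ∘ j) (sym p)) (cong v (j-l e))))
        trapped (later refl h) (inj₂ refl) = trapped h (inj₁ (trans (cong (v ∘ j) (sym q)) (cong v (j-r e))))

      private
        Good : Assignment → Fin m → Set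
        Good b e = Valid b (l e) × Valid b (r e) × ¬ Fixed b e

        Inv : List (Fin m) → Assignment → Set
        Inv es b = Valid b zero × (∀ e → e ∈ es ⊎ Good b e)

        module _ {e : Fin m} {es : List (Fin m)} (e∉es : All (e ≢_) es) where

          at-l : ∀ b y z → lookup (b [ l e ↦ y ] [ r e ↦ z ]) (l e) ≡ y
          at-l b y z = trans (lookup-↦′ (l≢r e e) (b [ l e ↦ y ]) z) (lookup-↦ (l e) b y)

          at-r : ∀ b y z → lookup (b [ l e ↦ y ] [ r e ↦ z ]) (r e) ≡ z
          at-r b y z = lookup-↦ (r e) (b [ l e ↦ y ]) z

          kill : ∀ b {y z} κ → y ≡ l e → z ≡ r e → Scatter v x (halves es) G (b [ l e ↦ y ] [ r e ↦ z ]) κ ≡ 0ℚ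
          kill b {y} {z} κ y≡ z≡ = Scatter-fixed (l∉halves e∉es) (r∉halves e∉es) (b [ l e ↦ y ] [ r e ↦ z ]) κ
            (trans (at-l b y z) y≡ , trans (at-r b y z) z≡)

          keep : ∀ b {y z} → Inv (e ∷ es) b → y ≡ X (l e) ⊎ y ≡ l e → z ≡ X (r e) ⊎ z ≡ r e → ¬ (y ≡ l e × z ≡ r e) →
                 Inv es (b [ l e ↦ y ] [ r e ↦ z ])
          keep b {y} {z} (v0 , inv) y≡ z≡ ¬yz = valid-at zero (λ eq → l≢0 e (sym eq)) (λ eq → r≢0 e (sym eq)) v0 , good
            where
            b′ = b [ l e ↦ y ] [ r e ↦ z ]
            same : ∀ h → h ≢ l e → h ≢ r e → lookup b′ h ≡ lookup b h
            same h h≢l h≢r = trans (lookup-↦′ h≢r (b [ l e ↦ y ]) z) (lookup-↦′ h≢l b y)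
            valid-at : ∀ h → h ≢ l e → h ≢ r e → Valid b h → Valid b′ h
            valid-at h h≢l h≢r = subst (λ w → w ≡ X h ⊎ w ≡ h) (sym (same h h≢l h≢r))
            good : ∀ e′ → e′ ∈ es ⊎ Good b′ e′
            good e′ with e′ ≟ e
            ... | yes refl = inj₂ (subst (λ w → w ≡ X (l e) ⊎ w ≡ l e) (sym (at-l b y z)) y≡
                                 , subst (λ w → w ≡ X (r e) ⊎ w ≡ r e) (sym (at-r b y z)) z≡
                                 , λ (p , q) → ¬yz (trans (sym (at-l b y z)) p , trans (sym (at-r b y z)) q))
            ... | no e′≢e with inv e′
            ...   | inj₁ (here eq) = contradiction eq e′≢e
            ...   | inj₁ (there i) = inj₁ i
            ...   | inj₂ (p , q , ¬f) =
              let ll = e′≢e ∘ l-injective ; rr = e′≢e ∘ r-injective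
                  lr = l≢r e′ e ; rl = λ eq → l≢r e e′ (sym eq) in
              inj₂ (valid-at (l e′) ll lr p , valid-at (r e′) rl rr q
                   , λ (p′ , q′) → ¬f (trans (sym (same (l e′) ll lr)) p′ , trans (sym (same (r e′) rl rr)) q′))

      -- Fixing both rows of an edge gives zero. On a tree edge the chosen half is fixed anyway, so
      -- the other must not be and one of the four ways survives; off the tree three survive.
      Scatter-orient : ∀ es → Unique es → ∀ b κ → Inv es b → Scatter v x (halves es) G b κ ≡ orient₃ es W κ
      Scatter-orient [] _ b κ (v0 , inv) =
        trans (cong (W κ *_) (indicator-yes (Rooted? j b) (tree-rooted t b valid (λ e → proj₂ (proj₂ (good e))))))
          (ℚP.*-identityʳ (W κ))
        where
        good : ∀ e → Good b e
        good e with inv e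
        ... | inj₂ g = g
        valid : ∀ h → Valid b h
        valid h with cover h
        ... | inj₁ refl = v0
        ... | inj₂ (e , inj₁ refl) = proj₁ (good e)
        ... | inj₂ (e , inj₂ refl) = proj₁ (proj₂ (good e))
      Scatter-orient (e ∷ es) (e∉ ∷ u) b κ inv with l e ≟ X (l e) | r e ≟ X (r e)
      ... | yes p | yes q = contradiction q (¬both-x e p)
      ... | yes p | no ¬q = trans
        (cong₂ (λ a c → (a + c) + 0ℚ)
          (Scatter-orient es u _ κ (keep e∉ b inv (inj₁ refl) (inj₁ refl) (λ (_ , q) → ¬q (sym q))))
          (kill e∉ b _ (sym p) refl))
        (trans (ℚP.+-identityʳ _) (ℚP.+-identityʳ (orient₃ es W κ)))
      ... | no ¬p | yes q = trans
        (cong₂ (λ a c → (a + 0ℚ) + (c + 0ℚ))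
          (Scatter-orient es u _ κ (keep e∉ b inv (inj₁ refl) (inj₁ refl) (λ (p , _) → ¬p (sym p))))
          (kill e∉ b _ refl (sym q)))
        (trans (ℚP.+-identityʳ _) (ℚP.+-identityʳ (orient₃ es W κ)))
      ... | no ¬p | no ¬q = trans
        (cong₂ _+_
          (cong₂ _+_ (Scatter-orient es u _ κ (keep e∉ b inv (inj₁ refl) (inj₁ refl) (λ (p , _) → ¬p (sym p))))
                     (Scatter-orient es u _ _ (keep e∉ b inv (inj₁ refl) (inj₂ refl) (λ (p , _) → ¬p (sym p)))))
          (cong₂ _+_ (Scatter-orient es u _ _ (keep e∉ b inv (inj₂ refl) (inj₁ refl) (λ (_ , q) → ¬q (sym q))))
                     (kill e∉ b _ refl refl)))
        (lemma (orient₃ es W κ) (orient₃ es W (inc (v (r e)) κ)) (orient₃ es W (inc (v (l e)) κ)))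
        where
        lemma : ∀ a c d → (a + c) + (d + 0ℚ) ≡ a + (d + c)
        lemma = solve-∀ ring

      Scatter-tree : ∀ es → Unique es → (∀ e → e ∈ es) → ∀ b κ → Scatter v x (zero ∷ halves es) G b κ ≡ orient₃ es W κ
      Scatter-tree es u all∈ b κ = trans
        (cong₂ _+_ (Scatter-orient es u _ κ (inj₁ (lookup-↦ zero b (X zero)) , inj₁ ∘ all∈)) (own (zero ≟ X zero)))
        (ℚP.+-identityʳ (orient₃ es W κ))
        where
        own : ∀ {q} → (d : Dec (zero ≡ X zero)) → unless d q ≡ 0ℚ
        own (yes _) = refl
        own (no ne) = contradiction (sym (trans (cong (lookup x) v-zero) (proj₁ t))) ne

    orient₂-inc : ∀ es Φ u κ → orient₂ es (Φ ∘ inc u) κ ≡ orient₂ es Φ (inc u κ)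
    orient₂-inc [] Φ u κ = refl
    orient₂-inc (e ∷ es) Φ u κ with onTree? e
    ... | yes _ = orient₂-inc es Φ u κ
    ... | no _ = cong₂ _+_ (trans (orient₂-inc es Φ u _) (cong (orient₂ es Φ) (inc-comm u (v (l e)) κ)))
                           (trans (orient₂-inc es Φ u _) (cong (orient₂ es Φ) (inc-comm u (v (r e)) κ)))

    -- A factor `- s_u = - t_u - 1/2` can be taken through the expansion over the edges.
    orient₂-moments : ∀ es u α β →
      orient₂ es (moments (inc u α)) β ≡ orient₂ es (moments α) (inc u β) - ½ * orient₂ es (moments α) β
    orient₂-moments [] u α β = moments-inc u α β
    orient₂-moments (e ∷ es) u α β with onTree? e
    ... | yes _ = orient₂-moments es u α β
    ... | no _ rewrite inc-comm (v (l e)) u β | inc-comm (v (r e)) u β =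
      trans (cong₂ _+_ (orient₂-moments es u α (inc (v (l e)) β)) (orient₂-moments es u α (inc (v (r e)) β)))
        (lemma (orient₂ es (moments α) (inc u (inc (v (l e)) β))) a (orient₂ es (moments α) (inc u (inc (v (r e)) β))) c)
      where
      a = orient₂ es (moments α) (inc (v (l e)) β)
      c = orient₂ es (moments α) (inc (v (r e)) β)
      lemma : ∀ p a q c → (p - ½ * a) + (q - ½ * c) ≡ (p + q) - ½ * (a + c)
      lemma = solve-∀ ring

    -- The weight 1 - s - s′ of an edge off the tree, averaged over s and s′, is the weight
    -- - t - t′.
    orient₃≡orient₂ : ∀ es α β → orient₃ es (λ α → moments α β) α ≡ orient₂ es (moments α) β
    orient₃≡orient₂ [] α β = refl
    orient₃≡orient₂ (e ∷ es) α β with onTree? e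
    ... | yes _ = orient₃≡orient₂ es α β
    ... | no _ = begin
      orient₃ es Φ α + (orient₃ es Φ (inc (v (l e)) α) + orient₃ es Φ (inc (v (r e)) α))
        ≡⟨ cong₂ _+_ (orient₃≡orient₂ es α β) (cong₂ _+_ (orient₃≡orient₂ es _ β) (orient₃≡orient₂ es _ β)) ⟩
      a + (orient₂ es (moments (inc (v (l e)) α)) β + orient₂ es (moments (inc (v (r e)) α)) β)
        ≡⟨ cong (a +_) (cong₂ _+_ (orient₂-moments es (v (l e)) α β) (orient₂-moments es (v (r e)) α β)) ⟩
      a + ((p - ½ * a) + (q - ½ * a)) ≡⟨ lemma a p q ⟩
      p + q ∎
      where
      Φ : Vec ℕ (suc n) → ℚ
      Φ α = moments α β
      a = orient₂ es (moments α) β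
      p = orient₂ es (moments α) (inc (v (l e)) β)
      q = orient₂ es (moments α) (inc (v (r e)) β)
      lemma : ∀ a p q → a + ((p - ½ * a) + (q - ½ * a)) ≡ p + q
      lemma = solve-∀ ring

-- Enumerations without repetition.

Unique-map : ∀ {A B : Set} (f : A → B) {xs} → Unique xs → (∀ {x y} → x ∈ xs → y ∈ xs → f x ≡ f y → x ≡ y) → Unique (map f xs)
Unique-map f [] inj = []
Unique-map f {x ∷ xs} (x∉ ∷ u) inj =
  All.tabulate (λ i e → let y , y∈ , eq = ∈-map⁻ f i in All.lookup x∉ y∈ (inj (here refl) (there y∈) (trans e eq)))
  ∷ Unique-map f u (λ i k → inj (there i) (there k))

Unique-concatMap : ∀ {A B : Set} (f : A → List B) {xs} → Unique xs → (∀ {x} → x ∈ xs → Unique (f x)) →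
  (∀ {x x′ y} → x ∈ xs → x′ ∈ xs → y ∈ f x → y ∈ f x′ → x ≡ x′) → Unique (concatMap f xs)
Unique-concatMap f [] uf inj = []
Unique-concatMap f {x ∷ xs} (x∉ ∷ u) uf inj =
  UniqueP.++⁺ (uf (here refl)) (Unique-concatMap f u (uf ∘ there) (λ i k → inj (there i) (there k)))
    λ (y∈ , i) → let x′ , x′∈ , y∈′ = find (∈-concatMap⁻ f {xs = xs} i) in
      All.lookup x∉ x′∈ (inj (here refl) (there x′∈) y∈ y∈′)

Vec-ext : ∀ {A : Set} {k} {xs ys : Vec A k} → (∀ i → lookup xs i ≡ lookup ys i) → xs ≡ ys
Vec-ext {xs = []} {[]} e = refl
Vec-ext {xs = x ∷ xs} {y ∷ ys} e = cong₂ _∷_ (e zero) (Vec-ext (e ∘ suc))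

Hit-trans : ∀ {k} {f : Fin k → Fin k} {x y z} → Hit f (_≡ y) x → Hit f (_≡ z) y → Hit f (_≡ z) x
Hit-trans (now refl) h = h
Hit-trans (later e g) h = later e (Hit-trans g h)

-- f lists, for every x in P and without repetition, the fibre over x of a map from Q to P.
record Fibres {X Y : Set} (P : X → Set) (f : X → List Y) (Q : Y → Set) : Set where
  field
    sound    : ∀ {x y} → P x → y ∈ f x → Q y
    complete : ∀ {y} → Q y → ∃ λ x → P x × y ∈ f x
    disjoint : ∀ {x x′ y} → P x → P x′ → y ∈ f x → y ∈ f x′ → x ≡ x′
    unique   : ∀ {x} → P x → Unique (f x)

open Fibres

Fibres-∘ : ∀ {X Y Z : Set} {P : X → Set} {f : X → List Y} {Q : Y → Set} {g : Y → List Z} {R : Z → Set} →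
           Fibres P f Q → Fibres Q g R → Fibres P (λ x → concatMap g (f x)) R
Fibres-∘ {f = f} {g = g} F G .sound {x} p i =
  let y , y∈ , z∈ = find (∈-concatMap⁻ g {xs = f x} i) in G .sound (F .sound p y∈) z∈
Fibres-∘ {f = f} {g = g} F G .complete r =
  let y , q , z∈ = G .complete r
      x , p , y∈ = F .complete q
  in x , p , ∈-concatMap⁺ g (lose y∈ z∈)
Fibres-∘ {f = f} {g = g} F G .disjoint {x} {x′} p p′ i i′ =
  let y , y∈ , z∈ = find (∈-concatMap⁻ g {xs = f x} i)
      y′ , y′∈ , z∈′ = find (∈-concatMap⁻ g {xs = f x′} i′)
      y≡y′ = G .disjoint (F .sound p y∈) (F .sound p′ y′∈) z∈ z∈′
  in F .disjoint p p′ y∈ (subst (_∈ f x′) (sym y≡y′) y′∈)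
Fibres-∘ {f = f} {g = g} F G .unique p =
  Unique-concatMap g (F .unique p) (λ y∈ → G .unique (F .sound p y∈))
    (λ y∈ y′∈ → G .disjoint (F .sound p y∈) (F .sound p y′∈))

Fibres-single : ∀ {X : Set} {P Q : X → Set} {f : X → X} → (∀ {x} → P x → f x ≡ x) →
                (∀ {x} → P x → Q x) → (∀ {x} → Q x → P x) → Fibres P (λ x → f x ∷ []) Q
Fibres-single {Q = Q} fx pq qp .sound p (here refl) = subst Q (sym (fx p)) (pq p)
Fibres-single fx pq qp .complete q = _ , qp q , here (sym (fx (qp q)))
Fibres-single fx pq qp .disjoint p p′ (here e) (here e′) = trans (sym (fx p)) (trans (sym e) (trans e′ (fx p′)))
Fibres-single fx pq qp .unique p = [] ∷ []

-- Embeddings as the results of successive insertions.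

module _ {n M : ℕ} (v : Fin M → Fin n) where

  open DecMembership {A = Fin M} _≟_ using (_∈?_)

  -- A partial embedding: the half-edges in `D` have been placed, the others are still fixed points.
  record Emb (D : List (Fin M)) (b : Vec (Fin M) M) : Set where
    field
      injective  : ∀ {h h′} → lookup b h ≡ lookup b h′ → h ≡ h′
      fixes      : ∀ {h} → h ∉ D → lookup b h ≡ h
      preserves  : ∀ h → v (lookup b h) ≡ v h
      transitive : ∀ {h h′} → h ∈ D → h′ ∈ D → v h ≡ v h′ → Hit (lookup b) (_≡ h′) h

  open Emb

  module _ {D : List (Fin M)} {a : Fin M} (a∉D : a ∉ D) where

    private
      transpose : Fin M → Fin M → Fin M
      transpose c h with h ≟ a | h ≟ c
      ... | yes _ | _ = c
      ... | no _ | yes _ = a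
      ... | no _ | no _ = h

      transpose-a : ∀ c → transpose c a ≡ c
      transpose-a c with a ≟ a
      ... | yes _ = refl
      ... | no ne = contradiction refl ne

      transpose-c : ∀ c → transpose c c ≡ a
      transpose-c c with c ≟ a | c ≟ c
      ... | yes e | _ = e
      ... | no _ | yes _ = refl
      ... | no _ | no ne = contradiction refl ne

      transpose-other : ∀ {c h} → h ≢ a → h ≢ c → transpose c h ≡ h
      transpose-other {c} {h} h≢a h≢c with h ≟ a | h ≟ c
      ... | yes e | _ = contradiction e h≢a
      ... | no _ | yes e = contradiction e h≢c
      ... | no _ | no _ = refl

      transpose-involutive : ∀ c h → transpose c (transpose c h) ≡ h
      transpose-involutive c h = by-cases (h ≟ a) (h ≟ c)
        where
        by-cases : Dec (h ≡ a) → Dec (h ≡ c) → transpose c (transpose c h) ≡ h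
        by-cases (yes refl) _ = trans (cong (transpose c) (transpose-a c)) (transpose-c c)
        by-cases (no _) (yes refl) = trans (cong (transpose c) (transpose-c c)) (transpose-a c)
        by-cases (no h≢a) (no h≢c) = trans (cong (transpose c) e) e
          where
          e = transpose-other h≢a h≢c

      transpose-injective : ∀ c {h h′} → transpose c h ≡ transpose c h′ → h ≡ h′
      transpose-injective c {h} {h′} e =
        trans (sym (transpose-involutive c h)) (trans (cong (transpose c) e) (transpose-involutive c h′))

      transpose-v : ∀ {c} → v c ≡ v a → ∀ h → v (transpose c h) ≡ v h
      transpose-v {c} vc h with h ≟ a | h ≟ c
      ... | yes refl | _ = vc
      ... | no _ | yes refl = sym vc
      ... | no _ | no _ = refl

      ≢a : ∀ {c} → c ∈ D → c ≢ a
      ≢a c∈D refl = a∉D c∈D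

      -- When `b` fixes `a`, insertion is precomposition with a transposition, so injectivity passes
      -- from `b` to the result and back.
      lookup-ins : ∀ {c} b → lookup b a ≡ a → c ≢ a → ∀ h → lookup (ins a c b) h ≡ lookup b (transpose c h)
      lookup-ins {c} b ba c≢a h = by-cases (h ≟ a) (h ≟ c)
        where
        by-cases : Dec (h ≡ a) → Dec (h ≡ c) → lookup (ins a c b) h ≡ lookup b (transpose c h)
        by-cases (yes refl) _ = trans (lookup-↦′ (c≢a ∘ sym) (b [ a ↦ lookup b c ]) a)
          (trans (lookup-↦ a b _) (cong (lookup b) (sym (transpose-a c))))
        by-cases (no _) (yes refl) = trans (lookup-↦ c (b [ a ↦ lookup b c ]) a) (trans (sym ba) (cong (lookup b) (sym (transpose-c c))))
        by-cases (no h≢a) (no h≢c) = trans (lookup-↦′ h≢c (b [ a ↦ lookup b c ]) a)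
          (trans (lookup-↦′ h≢a b _) (cong (lookup b) (sym (transpose-other h≢a h≢c))))

    Emb-ins : ∀ {b c} → Emb D b → c ∈ D → v c ≡ v a → Emb (a ∷ D) (ins a c b)
    Emb-ins {b} {c} E c∈D vc = record
      { injective = λ {h} {h′} e → transpose-injective c (E .injective (trans (sym (at h)) (trans e (at h′))))
      ; fixes = λ {h} h∉ → let h≢c = λ { refl → h∉ (there c∈D) } in
          trans (at h) (trans (cong (lookup b) (transpose-other (h∉ ∘ here) h≢c)) (E .fixes (h∉ ∘ there)))
      ; preserves = λ h → trans (cong v (at h)) (trans (E .preserves _) (transpose-v vc h))
      ; transitive = trans′ }
      where
      ba : lookup b a ≡ a
      ba = E .fixes a∉D
      c≢a = ≢a c∈D
      b⁺ = ins a c b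
      at : ∀ h → lookup b⁺ h ≡ lookup b (transpose c h)
      at = lookup-ins b ba c≢a
      at-a : lookup b⁺ a ≡ lookup b c
      at-a = trans (at a) (cong (lookup b) (transpose-a c))
      at-c : lookup b⁺ c ≡ a
      at-c = trans (at c) (trans (cong (lookup b) (transpose-c c)) ba)
      lift : ∀ {h h′} → h ≢ a → Hit (lookup b) (_≡ h′) h → Hit (lookup b⁺) (_≡ h′) h
      lift h≢a (now e) = now e
      lift {h} h≢a (later refl p) with h ≟ c | lift (λ e → h≢a (E .injective (trans e (sym ba)))) p
      ... | yes refl | q = later at-c (later at-a q)
      ... | no h≢c | q = later (trans (at h) (cong (lookup b) (transpose-other h≢a h≢c))) q
      bc∈D : lookup b c ∈ D
      bc∈D with lookup b c ∈? D
      ... | yes i = i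
      ... | no ni = subst (_∈ D) (sym (E .injective (E .fixes ni))) c∈D
      trans′ : ∀ {h h′} → h ∈ a ∷ D → h′ ∈ a ∷ D → v h ≡ v h′ → Hit (lookup b⁺) (_≡ h′) h
      trans′ (here refl) (here refl) e = now refl
      trans′ (here refl) (there i) e = later at-a (lift (≢a bc∈D) (E .transitive bc∈D i (trans (E .preserves c) (trans vc e))))
      trans′ (there i) (here refl) e = Hit-trans (lift (≢a i) (E .transitive i c∈D (trans e (sym vc)))) (later at-c (now refl))
      trans′ (there i) (there k) e = lift (≢a i) (E .transitive i k e)

    -- The witness `c` is the predecessor of `a` on its cycle. It differs from `a` because the cycle
    -- also contains `c₀`; `b′` lets the cycle bypass `a`.
    Emb-remove : ∀ {b c₀} → Emb (a ∷ D) b → c₀ ∈ D → v c₀ ≡ v a →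
                 ∃ λ b′ → Emb D b′ × ∃ λ c → c ∈ D × v c ≡ v a × b ≡ ins a c b′
    Emb-remove {b} {c₀} E c₀∈D vc₀ = b′ , E′ , c , c∈D , vc , Vec-ext (λ h →
      trans (cong (lookup b) (sym (transpose-involutive c h))) (trans (sym (at′ (transpose c h))) (sym (lookup-ins b′ b′a c≢a h))))
      where
      before : ∀ {h} → h ≢ a → Hit (lookup b) (_≡ a) h → ∃ λ c → c ≢ a × lookup b c ≡ a
      before h≢a (now e) = contradiction e h≢a
      before {h} h≢a (later {d = d} e p) with d ≟ a
      ... | yes refl = h , h≢a , e
      ... | no d≢a = before d≢a p
      pred = before (≢a c₀∈D) (E .transitive (there c₀∈D) (here refl) vc₀)
      c = proj₁ pred
      c≢a = proj₁ (proj₂ pred)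
      bc = proj₂ (proj₂ pred)
      vc : v c ≡ v a
      vc = trans (sym (E .preserves c)) (cong v bc)
      c∈D : c ∈ D
      c∈D with c ∈? a ∷ D
      ... | yes (here e) = contradiction e c≢a
      ... | yes (there i) = i
      ... | no ni = contradiction (trans (sym (E .fixes ni)) bc) c≢a
      b′ = b [ c ↦ lookup b a ] [ a ↦ a ]
      b′a : lookup b′ a ≡ a
      b′a = lookup-↦ a (b [ c ↦ lookup b a ]) a
      at′ : ∀ h → lookup b′ h ≡ lookup b (transpose c h)
      at′ h = by-cases (h ≟ a) (h ≟ c)
        where
        by-cases : Dec (h ≡ a) → Dec (h ≡ c) → lookup b′ h ≡ lookup b (transpose c h)
        by-cases (yes refl) _ = trans b′a (trans (sym bc) (cong (lookup b) (sym (transpose-a c))))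
        by-cases (no h≢a) (yes refl) = trans (lookup-↦′ h≢a (b [ c ↦ lookup b a ]) a)
          (trans (lookup-↦ c b (lookup b a)) (cong (lookup b) (sym (transpose-c c))))
        by-cases (no h≢a) (no h≢c) = trans (lookup-↦′ h≢a (b [ c ↦ lookup b a ]) a)
          (trans (lookup-↦′ h≢c b (lookup b a)) (cong (lookup b) (sym (transpose-other h≢a h≢c))))
      at′-other : ∀ {h} → h ≢ a → h ≢ c → lookup b′ h ≡ lookup b h
      at′-other {h} h≢a h≢c = trans (at′ h) (cong (lookup b) (transpose-other h≢a h≢c))
      -- Cuts `a` out of a path: the step from `c` to `a` is merged with the one after it.
      lower : ∀ {h h′} → h ≢ a → h′ ≢ a → Hit (lookup b) (_≡ h′) h → Hit (lookup b′) (_≡ h′) h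
      lower h≢a h′≢a (now e) = now e
      lower {h} h≢a h′≢a (later e p) with h ≟ c
      lower {h} h≢a h′≢a (later e (now d≡)) | yes refl = contradiction (trans (sym d≡) (trans (sym e) bc)) h′≢a
      lower {h} h≢a h′≢a (later e (later e′ p)) | yes refl =
        later (trans (at′ c) (trans (cong (lookup b) (trans (transpose-c c) (trans (sym bc) e))) e′))
          (lower (λ d≡a → c≢a (E .injective (trans bc (trans (sym d≡a) (trans (sym e′) (cong (lookup b) (trans (sym e) bc))))))) h′≢a p)
      lower {h} h≢a h′≢a (later e p) | no h≢c =
        later (trans (at′-other h≢a h≢c) e)
          (lower (λ d≡a → h≢c (E .injective (trans e (trans d≡a (sym bc))))) h′≢a p)
      E′ : Emb D b′
      E′ = record
        { injective = λ {h} {h′} e → transpose-injective c (E .injective (trans (sym (at′ h)) (trans e (at′ h′))))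
        ; fixes = λ {h} h∉ → fixes′ h h∉ (h ≟ a)
        ; preserves = λ h → trans (cong v (at′ h)) (trans (E .preserves _) (transpose-v vc h))
        ; transitive = λ i k e → lower (≢a i) (≢a k) (E .transitive (there i) (there k) e) }
        where
        fixes′ : ∀ h → h ∉ D → Dec (h ≡ a) → lookup b′ h ≡ h
        fixes′ h h∉ (yes refl) = b′a
        fixes′ h h∉ (no h≢a) = trans (at′-other h≢a (λ { refl → h∉ c∈D }))
          (E .fixes λ { (here e) → h≢a e ; (there i) → h∉ i })

    ins-injective : ∀ {b b′ c c′} → Emb D b → Emb D b′ → c ∈ D → c′ ∈ D → ins a c b ≡ ins a c′ b′ → c ≡ c′ × b ≡ b′
    ins-injective {b} {b′} {c} {c′} E E′ i i′ e = c≡c′ , Vec-ext λ h →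
      trans (cong (lookup b) (sym (transpose-involutive c h))) (trans (same (transpose c h))
        (cong (lookup b′) (trans (cong (λ d → transpose d (transpose c h)) (sym c≡c′)) (transpose-involutive c h))))
      where
      same : ∀ h → lookup b (transpose c h) ≡ lookup b′ (transpose c′ h)
      same h = trans (sym (lookup-ins b (E .fixes a∉D) (≢a i) h))
        (trans (cong (λ w → lookup w h) e) (lookup-ins b′ (E′ .fixes a∉D) (≢a i′) h))
      c≡c′ : c ≡ c′
      c≡c′ = transpose-injective c′ (trans (E′ .injective (trans (sym (same c))
        (trans (cong (lookup b) (transpose-c c)) (trans (E .fixes a∉D) (sym (E′ .fixes a∉D)))))) (sym (transpose-c c′)))

    Emb-alone : ∀ {b} → (∀ {c} → c ∈ D → v c ≢ v a) → Emb D b → Emb (a ∷ D) b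
    Emb-alone {b} alone E = record
      { injective = E .injective
      ; fixes = λ h∉ → E .fixes (h∉ ∘ there)
      ; preserves = E .preserves
      ; transitive = trans′ }
      where
      trans′ : ∀ {h h′} → h ∈ a ∷ D → h′ ∈ a ∷ D → v h ≡ v h′ → Hit (lookup b) (_≡ h′) h
      trans′ (here refl) (here refl) e = now refl
      trans′ (here refl) (there k) e = contradiction (sym e) (alone k)
      trans′ (there i) (here refl) e = contradiction e (alone i)
      trans′ (there i) (there k) e = E .transitive i k e

    Emb-unalone : ∀ {b} → (∀ {c} → c ∈ D → v c ≢ v a) → Emb (a ∷ D) b → Emb D b
    Emb-unalone {b} alone E = record
      { injective = E .injective
      ; fixes = λ {h} h∉ → fixes′ h h∉ (h ≟ a)
      ; preserves = E .preserves
      ; transitive = λ i k → E .transitive (there i) (there k) }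
      where
      ba : lookup b a ≡ a
      ba with lookup b a ∈? a ∷ D
      ... | yes (here e) = e
      ... | yes (there i) = contradiction (E .preserves a) (alone i)
      ... | no ni = E .injective (E .fixes ni)
      fixes′ : ∀ h → h ∉ D → Dec (h ≡ a) → lookup b h ≡ h
      fixes′ h h∉ (yes refl) = ba
      fixes′ h h∉ (no h≢a) = E .fixes λ { (here e) → h≢a e ; (there i) → h∉ i }

    Fibres-ins : ∀ {A c₀} → Unique A → c₀ ∈ A → (∀ {c} → c ∈ A → c ∈ D × v c ≡ v a) → (∀ {c} → c ∈ D → v c ≡ v a → c ∈ A) →
                 Fibres (Emb D) (λ b → map (λ c → ins a c b) A) (Emb (a ∷ D))
    Fibres-ins {A} {c₀} u c₀∈A AD DA .sound {b} E i with ∈-map⁻ (λ c → ins a c b) i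
    ... | c , c∈A , refl = Emb-ins E (proj₁ (AD c∈A)) (proj₂ (AD c∈A))
    Fibres-ins {A} {c₀} u c₀∈A AD DA .complete E with Emb-remove E (proj₁ (AD c₀∈A)) (proj₂ (AD c₀∈A))
    ... | b′ , E′ , c , c∈D , vc , refl = b′ , E′ , ∈-map⁺ (λ c → ins a c b′) (DA c∈D vc)
    Fibres-ins {A} {c₀} u c₀∈A AD DA .disjoint {b} {b′} E E′ i i′ with ∈-map⁻ (λ c → ins a c b) i | ∈-map⁻ (λ c → ins a c b′) i′
    ... | c , c∈A , e | c′ , c′∈A , e′ = proj₂ (ins-injective E E′ (proj₁ (AD c∈A)) (proj₁ (AD c′∈A)) (trans (sym e) e′))
    Fibres-ins {A} {c₀} u c₀∈A AD DA .unique {b} E =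
      Unique-map (λ c → ins a c b) u (λ i k e → proj₁ (ins-injective E E (proj₁ (AD i)) (proj₁ (AD k)) e))

  Fibres-cycles : ∀ {D u} → All (λ c → v c ≢ u) D → ∀ A → Unique A → All (λ h → v h ≡ u) A →
                  Fibres (Emb D) (cycles A) (Emb (A ++ D))
  Fibres-cycles d [] _ _ = Fibres-single (λ _ → refl) (λ E → E) (λ E → E)
  Fibres-cycles {D} d (a ∷ []) _ (refl ∷ []) =
    Fibres-single (λ {b} E → Vec-ext (λ h → fixed b E h (h ≟ a))) (Emb-alone a∉D (All.lookup d)) (Emb-unalone a∉D (All.lookup d))
    where
    a∉D : a ∉ D
    a∉D i = All.lookup d i refl
    fixed : ∀ b → Emb D b → ∀ h → Dec (h ≡ a) → lookup (b [ a ↦ a ]) h ≡ lookup b h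
    fixed b E h (yes refl) = trans (lookup-↦ a b a) (sym (E .fixes a∉D))
    fixed b E h (no h≢a) = lookup-↦′ h≢a b a
  Fibres-cycles {D} {u} d (a ∷ A@(_ ∷ _)) (a∉A ∷ uA) (refl ∷ vA) =
    Fibres-∘ (Fibres-cycles d A uA vA) (Fibres-ins a∉ uA (here refl)
      (λ i → ∈-++⁺ˡ i , All.lookup vA i) (λ i e → back (∈-++⁻ A i) e))
    where
    a∉ : a ∉ A ++ D
    a∉ i with ∈-++⁻ A i
    ... | inj₁ k = All.lookup a∉A k refl
    ... | inj₂ k = All.lookup d k refl
    back : ∀ {c} → c ∈ A ⊎ c ∈ D → v c ≡ v a → c ∈ A
    back (inj₁ i) e = i
    back (inj₂ i) e = contradiction e (All.lookup d i)

  module _ (K : Fin n → List (Fin M)) (uK : ∀ u → Unique (K u)) (vK : ∀ u → All (λ h → v h ≡ u) (K u)) where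

    joined : List (Fin n) → List (Fin M)
    joined [] = []
    joined (u ∷ us) = K u ++ joined us

    Fibres-cyclesAll : ∀ us → Unique us → Fibres (Emb []) (cyclesAll (map K us)) (Emb (joined us))
    Fibres-cyclesAll [] _ = Fibres-single (λ _ → refl) (λ E → E) (λ E → E)
    Fibres-cyclesAll (u ∷ us) (u∉ ∷ uus) = Fibres-∘ (Fibres-cyclesAll us uus) (Fibres-cycles (other u∉) (K u) (uK u) (vK u))
      where
      other : ∀ {us} → All (u ≢_) us → All (λ c → v c ≢ u) (joined us)
      other [] = []
      other {w ∷ us} (u≢w ∷ d) = All.tabulate λ i → by (∈-++⁻ (K w) i)
        where
        by : ∀ {c} → c ∈ K w ⊎ c ∈ joined us → v c ≢ u
        by (inj₁ i) e = u≢w (trans (sym e) (All.lookup (vK w) i))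
        by (inj₂ i) = All.lookup (other d) i

-- Counting with sums over `Fin`.

sumFin : ∀ k → (Fin k → ℕ) → ℕ
sumFin zero f = 0
sumFin (suc k) f = f zero ℕ.+ sumFin k (f ∘ suc)

sumFin-cong : ∀ k {f g} → (∀ i → f i ≡ g i) → sumFin k f ≡ sumFin k g
sumFin-cong zero e = refl
sumFin-cong (suc k) e = cong₂ ℕ._+_ (e zero) (sumFin-cong k (e ∘ suc))

sumFin-+ : ∀ k f g → sumFin k (λ i → f i ℕ.+ g i) ≡ sumFin k f ℕ.+ sumFin k g
sumFin-+ zero f g = refl
sumFin-+ (suc k) f g rewrite sumFin-+ k (f ∘ suc) (g ∘ suc) =
  ℕ-interchange (f zero) (g zero) (sumFin k (f ∘ suc)) (sumFin k (g ∘ suc))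

sumFin-0 : ∀ k → sumFin k (λ _ → 0) ≡ 0
sumFin-0 zero = refl
sumFin-0 (suc k) = sumFin-0 k

sumFin-1 : ∀ k → sumFin k (λ _ → 1) ≡ k
sumFin-1 zero = refl
sumFin-1 (suc k) = cong suc (sumFin-1 k)

sumFin-swap : ∀ k l (f : Fin k → Fin l → ℕ) →
              sumFin k (λ a → sumFin l (f a)) ≡ sumFin l (λ b → sumFin k (λ a → f a b))
sumFin-swap zero l f = sym (sumFin-0 l)
sumFin-swap (suc k) l f = trans (cong (sumFin l (f zero) ℕ.+_) (sumFin-swap k l (f ∘ suc))) (sym (sumFin-+ l _ _))

sumFin-split : ∀ k l f → sumFin (k ℕ.+ l) f ≡ sumFin k (λ a → f (a ↑ˡ l)) ℕ.+ sumFin l (λ b → f (k ↑ʳ b))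
sumFin-split zero l f = refl
sumFin-split (suc k) l f = trans (cong (f zero ℕ.+_) (sumFin-split k l (f ∘ suc))) (sym (ℕP.+-assoc (f zero) _ _))

sumFin-≤ : ∀ k {f g} → (∀ i → f i ℕ.≤ g i) → sumFin k f ℕ.≤ sumFin k g
sumFin-≤ zero le = ℕ.z≤n
sumFin-≤ (suc k) le = ℕP.+-mono-≤ (le zero) (sumFin-≤ k (le ∘ suc))

-- Serves to pass from equal totals to an equality edge by edge.
sumFin-≤-≡ : ∀ k {f g} → (∀ i → f i ℕ.≤ g i) → sumFin k f ≡ sumFin k g → ∀ i → f i ≡ g i
sumFin-≤-≡ (suc k) {f} {g} le eq = λ { zero → head ; (suc i) → sumFin-≤-≡ k (le ∘ suc) (tail head) i }
  where
  head : f zero ≡ g zero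
  head with ℕP.m≤n⇒m<n∨m≡n (le zero)
  ... | inj₁ lt = contradiction eq (ℕP.<⇒≢ (ℕP.+-mono-<-≤ lt (sumFin-≤ k (le ∘ suc))))
  ... | inj₂ e = e
  tail : f zero ≡ g zero → sumFin k (f ∘ suc) ≡ sumFin k (g ∘ suc)
  tail e = ℕP.+-cancelˡ-≡ (f zero) _ _ (trans eq (cong (ℕ._+ sumFin k (g ∘ suc)) (sym e)))

bit : Bool → ℕ
bit true = 1
bit false = 0

⌊⌋-true : ∀ {P : Set} (d : Dec P) → P → ⌊ d ⌋ ≡ true
⌊⌋-true (yes _) p = refl
⌊⌋-true (no ¬p) p = contradiction p ¬p

⌊⌋-false : ∀ {P : Set} (d : Dec P) → ¬ P → ⌊ d ⌋ ≡ false
⌊⌋-false (yes p) ¬p = contradiction p ¬p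
⌊⌋-false (no _) ¬p = refl

sumFin-none : ∀ k {p : Fin k → Bool} → (∀ i → p i ≡ false) → sumFin k (bit ∘ p) ≡ 0
sumFin-none k e = trans (sumFin-cong k (cong bit ∘ e)) (sumFin-0 k)

sumFin-one : ∀ k {p : Fin k → Bool} i → p i ≡ true → (∀ i′ → i′ ≢ i → p i′ ≡ false) → sumFin k (bit ∘ p) ≡ 1
sumFin-one (suc k) zero pi others = cong₂ ℕ._+_ (cong bit pi) (sumFin-none k (λ i → others (suc i) λ ()))
sumFin-one (suc k) (suc i) pi others =
  cong₂ ℕ._+_ (cong bit (others zero λ ())) (sumFin-one k i pi (λ i′ ne → others (suc i′) (ne ∘ suc-injective)))

-- Spanning trees as choices of one half-edge per vertex.

module _ {n M m : ℕ} (R : Rooting n M m) where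
  open Rooting R

  private
    Node = Fin (suc M)

  Section : Vec Node (suc n) → Set
  Section x = ∀ u → v (lookup x u) ≡ u

  module _ (x : Vec Node (suc n)) (s : Section x) (t : Tree R x) where

    no-2-cycle : ∀ {u w} → u ≢ zero → w ≢ zero → parent R x u ≡ w → parent R x w ≡ u → ⊥
    no-2-cycle {u} {w} u≢0 w≢0 e f = trapped (proj₂ t u) (inj₁ refl)
      where
      trapped : ∀ {y} → Hit (parent R x) (_≡ zero) y → y ≡ u ⊎ y ≡ w → ⊥
      trapped (now refl) (inj₁ eq) = u≢0 (sym eq)
      trapped (now refl) (inj₂ eq) = w≢0 (sym eq)
      trapped (later refl h) (inj₁ refl) = trapped h (inj₂ e)
      trapped (later refl h) (inj₂ refl) = trapped h (inj₁ f)

    x≢0 : ∀ {u} → u ≢ zero → lookup x u ≢ zero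
    x≢0 u≢0 e = u≢0 (trans (sym (s _)) (trans (cong v e) v-zero))

    OnTree-half : ∀ {u e} → lookup x u ≡ l e ⊎ lookup x u ≡ r e → OnTree R x s e
    OnTree-half {u} (inj₁ p) = inj₁ (trans (sym p) (cong (lookup x) (trans (sym (s u)) (cong v p))))
    OnTree-half {u} (inj₂ p) = inj₂ (trans (sym p) (cong (lookup x) (trans (sym (s u)) (cong v p))))

    private
      half : ∀ u → ∃ λ e → lookup x (suc u) ≡ l e ⊎ lookup x (suc u) ≡ r e
      half u with cover (lookup x (suc u))
      ... | inj₁ e = contradiction e (x≢0 λ ())
      ... | inj₂ p = p

      edge : Fin n → Fin m
      edge u = proj₁ (half u)

      same-edge : ∀ u u′ → edge u ≡ edge u′ → u ≡ u′
      same-edge u u′ e = suc-injective (by-cases (proj₂ (half u)) (proj₂ (half u′)))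
        where
        via : lookup x (suc u) ≡ lookup x (suc u′) → Fin.suc u ≡ suc u′
        via eq = trans (sym (s (suc u))) (trans (cong v eq) (s (suc u′)))
        at : ∀ w {h} → lookup x w ≡ h → h ≡ lookup x (v h)
        at w p = trans (sym p) (cong (lookup x) (trans (sym (s w)) (cong v p)))
        by-cases : lookup x (suc u) ≡ l (edge u) ⊎ lookup x (suc u) ≡ r (edge u) →
                   lookup x (suc u′) ≡ l (edge u′) ⊎ lookup x (suc u′) ≡ r (edge u′) → Fin.suc u ≡ suc u′
        by-cases (inj₁ p) (inj₁ q) = via (trans p (trans (cong l e) (sym q)))
        by-cases (inj₂ p) (inj₂ q) = via (trans p (trans (cong r e) (sym q)))
        by-cases (inj₁ p) (inj₂ q) =
          ⊥-elim (¬both-x R x s t (edge u) (at (suc u) p) (at (suc u′) (trans q (cong r (sym e)))))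
        by-cases (inj₂ p) (inj₁ q) =
          ⊥-elim (¬both-x R x s t (edge u) (at (suc u′) (trans q (cong l (sym e)))) (at (suc u) p))

      on-edge : ∀ e → OnTree R x s e → ∃ λ u → edge u ≡ e
      on-edge e o = by-cases o
        where
        find-u : ∀ h → h ≢ zero → h ≡ lookup x (v h) → (∀ {e′} → h ≡ l e′ ⊎ h ≡ r e′ → e′ ≡ e) → ∃ λ u → edge u ≡ e
        find-u h h≢0 eq is with v h
        ... | zero = contradiction (trans eq (proj₁ t)) h≢0
        ... | suc u = u , is (shift-half (proj₂ (half u)))
          where
          shift-half : ∀ {e′} → lookup x (suc u) ≡ l e′ ⊎ lookup x (suc u) ≡ r e′ → h ≡ l e′ ⊎ h ≡ r e′
          shift-half (inj₁ p) = inj₁ (trans eq p)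
          shift-half (inj₂ p) = inj₂ (trans eq p)
        by-cases : OnTree R x s e → ∃ λ u → edge u ≡ e
        by-cases (inj₁ eq) = find-u (l e) (l≢0 e) eq λ { (inj₁ p) → sym (l-injective p) ; (inj₂ p) → contradiction p (l≢r e _) }
        by-cases (inj₂ eq) = find-u (r e) (r≢0 e) eq λ { (inj₁ p) → contradiction (sym p) (l≢r _ e) ; (inj₂ p) → sym (r-injective p) }

    -- Each of the `n` vertices other than the root chooses an edge. Different vertices choose
    -- different edges, and the chosen edges are those of the tree.
    tree-count : sumFin m (λ e → bit ⌊ onTree? R x s e ⌋) ≡ n
    tree-count = begin
      sumFin m (λ e → bit ⌊ onTree? R x s e ⌋) ≡⟨ sumFin-cong m per-edge ⟩
      sumFin m (λ e → sumFin n (λ u → bit ⌊ edge u ≟ e ⌋)) ≡⟨ sumFin-swap m n _ ⟩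
      sumFin n (λ u → sumFin m (λ e → bit ⌊ edge u ≟ e ⌋))
        ≡⟨ sumFin-cong n (λ u → sumFin-one m (edge u) (⌊⌋-true (edge u ≟ edge u) refl) (λ e ne → ⌊⌋-false (edge u ≟ e) (ne ∘ sym))) ⟩
      sumFin n (λ _ → 1) ≡⟨ sumFin-1 n ⟩
      n ∎
      where
      per-edge : ∀ e → bit ⌊ onTree? R x s e ⌋ ≡ sumFin n (λ u → bit ⌊ edge u ≟ e ⌋)
      per-edge e with onTree? R x s e
      ... | yes o = let u , eq = on-edge e o in
        sym (sumFin-one n u (⌊⌋-true (edge u ≟ e) eq) (λ u′ ne → ⌊⌋-false (edge u′ ≟ e) (λ eq′ → ne (same-edge u′ u (trans eq′ (sym eq))))))
      ... | no ¬o = sym (sumFin-none n (λ u → ⌊⌋-false (edge u ≟ e) (λ { refl → ¬o (OnTree-half (proj₂ (half u))) })))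

  -- A rooted tree is determined by its set of edges: by induction on the distance to the
  -- root, since two orientations of an edge at u would make u the parent of its parent.
  tree-unique : ∀ {x x′} (s : Section x) (s′ : Section x′) → Tree R x → Tree R x′ →
                (∀ e → OnTree R x s e → OnTree R x′ s′ e) → x ≡ x′
  tree-unique {x} {x′} s s′ t t′ on = Vec-ext λ u → same (proj₂ t u)
    where
    same : ∀ {u} → Hit (parent R x) (_≡ zero) u → lookup x u ≡ lookup x′ u
    same (now refl) = trans (proj₁ t) (sym (proj₁ t′))
    same {u} (later refl h) with u ≟ zero
    ... | yes refl = trans (proj₁ t) (sym (proj₁ t′))
    ... | no u≢0 with cover (lookup x u)
    ...   | inj₁ e = contradiction e (x≢0 x s t u≢0)
    ...   | inj₂ (e , p) = by-cases p (on e (OnTree-half x s t p))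
      where
      same-parent : lookup x (parent R x u) ≡ lookup x′ (parent R x u)
      same-parent = same h
      own : ∀ {h} → lookup x u ≡ h → h ≡ lookup x′ (v h) → lookup x u ≡ lookup x′ u
      own q q′ = trans q (trans q′ (cong (lookup x′) (trans (cong v (sym q)) (s u))))
      other : ∀ {h} → h ≢ zero → j (lookup x u) ≡ h → h ≡ lookup x′ (v h) → ⊥
      other {h} h≢0 q q′ = no-2-cycle x s t u≢0 w≢0 refl
        (trans (cong (v ∘ j) (trans (trans same-parent (trans (cong (lookup x′ ∘ v) q) (sym q′))) (sym q)))
          (trans (cong v (j-invol (lookup x u))) (s u)))
        where
        w≢0 : parent R x u ≢ zero
        w≢0 e = h≢0 (trans q′ (trans (cong (lookup x′) (trans (cong v (sym q)) e)) (proj₁ t′)))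
      by-cases : lookup x u ≡ l e ⊎ lookup x u ≡ r e → OnTree R x′ s′ e → lookup x u ≡ lookup x′ u
      by-cases (inj₁ q) (inj₁ q′) = own q q′
      by-cases (inj₂ q) (inj₂ q′) = own q q′
      by-cases (inj₁ q) (inj₂ q′) = ⊥-elim (other (r≢0 e) (trans (cong j q) (j-l e)) q′)
      by-cases (inj₂ q) (inj₁ q′) = ⊥-elim (other (l≢0 e) (trans (cong j q) (j-r e)) q′)

  module _ (keep : Fin m → Bool) where

    Steps : Fin m → (Fin (suc n) → Set) → Fin (suc n) → Set
    Steps e L u = keep e ≡ true × ((v (l e) ≡ u × L (v (r e))) ⊎ (v (r e) ≡ u × L (v (l e))))

    Within : ℕ → Fin (suc n) → Set
    Within zero u = u ≡ zero
    Within (suc k) u = Within k u ⊎ ∃ λ e → Steps e (Within k) u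

    Within? : ∀ k u → Dec (Within k u)
    Within? zero u = u ≟ zero
    Within? (suc k) u = Within? k u ⊎-dec any? (λ e → (keep e Bool.≟ true) ×-dec
      (((v (l e) ≟ u) ×-dec Within? k (v (r e))) ⊎-dec ((v (r e) ≟ u) ×-dec Within? k (v (l e)))))

    Within-≤ : ∀ {k k′ u} → k ℕ.≤′ k′ → Within k u → Within k′ u
    Within-≤ ℕ.≤′-refl w = w
    Within-≤ (ℕ.≤′-step le) w = inj₁ (Within-≤ le w)

    -- Records the exact distance from the root, together with an edge that decreases it; `Within`
    -- knows only upper bounds.
    First : Fin (suc n) → Set
    First u = u ≡ zero ⊎ ∃ λ k → ¬ Within k u × ∃ λ e → Steps e (Within k) u

    first : ∀ {u} k → Within k u → First u
    first zero w = inj₁ w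
    first {u} (suc k) w with Within? k u
    first (suc k) w | yes w′ = first k w′
    first (suc k) (inj₁ w) | no ¬w = contradiction w ¬w
    first (suc k) (inj₂ p) | no ¬w = inj₂ (k , ¬w , p)

    module _ (reach : ∀ u → ∃ λ k → Within k u) where

      private
        pick : ∀ {u} → First u → Node
        pick (inj₁ _) = zero
        pick (inj₂ (k , _ , e , _ , inj₁ _)) = l e
        pick (inj₂ (k , _ , e , _ , inj₂ _)) = r e

        firsts : ∀ u → First u
        firsts u = first (proj₁ (reach u)) (proj₂ (reach u))

      bfs : Vec Node (suc n)
      bfs = Vec.tabulate (λ u → pick (firsts u))

      private
        lookup-bfs : ∀ u → lookup bfs u ≡ pick (firsts u)
        lookup-bfs = VecP.lookup∘tabulate (λ u → pick (firsts u))

      bfs-section : Section bfs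
      bfs-section u = trans (cong v (lookup-bfs u)) (at (firsts u))
        where
        at : ∀ (f : First u) → v (pick f) ≡ u
        at (inj₁ refl) = v-zero
        at (inj₂ (k , _ , e , _ , inj₁ (p , _))) = p
        at (inj₂ (k , _ , e , _ , inj₂ (p , _))) = p

      bfs-tree : Tree R bfs
      bfs-tree = trans (lookup-bfs zero) (at-zero (firsts zero)) , λ u → hit (proj₁ (reach u)) (proj₂ (reach u))
        where
        zero-within : ∀ k → Within k zero
        zero-within zero = refl
        zero-within (suc k) = inj₁ (zero-within k)
        at-zero : ∀ (f : First zero) → pick f ≡ zero
        at-zero (inj₁ _) = refl
        at-zero (inj₂ (k , ¬w , _)) = contradiction (zero-within k) ¬w
        hit : ∀ {u} k → Within k u → Hit (parent R bfs) (_≡ zero) u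
        hit zero w = now w
        hit {u} (suc k) w = by-cases (firsts u) (lookup-bfs u)
          where
          -- `u` is within distance `suc k` but not within `k′`, hence `k′ ≤ k`; this lets the
          -- recursion descend to the parent.
          closer : ∀ {k′ y} → ¬ Within k′ u → Within k′ y → Within k y
          closer {k′} ¬w w′ with k′ ℕ.≤? k
          ... | yes le = Within-≤ (ℕP.≤⇒≤′ le) w′
          ... | no ¬le = contradiction (Within-≤ (ℕP.≤⇒≤′ (ℕP.≰⇒> ¬le)) w) ¬w
          by-cases : ∀ (f : First u) → lookup bfs u ≡ pick f → Hit (parent R bfs) (_≡ zero) u
          by-cases (inj₁ e) _ = now e
          by-cases (inj₂ (k′ , ¬w , e , _ , inj₁ (_ , w′))) eq =
            later (trans (cong (v ∘ j) eq) (cong v (j-l e))) (hit k (closer ¬w w′))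
          by-cases (inj₂ (k′ , ¬w , e , _ , inj₂ (_ , w′))) eq =
            later (trans (cong (v ∘ j) eq) (cong v (j-r e))) (hit k (closer ¬w w′))

      bfs-keep : ∀ e → OnTree R bfs bfs-section e → keep e ≡ true
      bfs-keep e (inj₁ eq) = at (firsts (v (l e))) (trans eq (lookup-bfs (v (l e))))
        where
        at : ∀ {u} (f : First u) → l e ≡ pick f → keep e ≡ true
        at (inj₁ _) p = contradiction p (l≢0 e)
        at (inj₂ (k , _ , e′ , ke , inj₁ _)) p = subst (λ d → keep d ≡ true) (sym (l-injective p)) ke
        at (inj₂ (k , _ , e′ , ke , inj₂ _)) p = contradiction p (l≢r e e′)
      bfs-keep e (inj₂ eq) = at (firsts (v (r e))) (trans eq (lookup-bfs (v (r e))))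
        where
        at : ∀ {u} (f : First u) → r e ≡ pick f → keep e ≡ true
        at (inj₁ _) p = contradiction p (r≢0 e)
        at (inj₂ (k , _ , e′ , ke , inj₁ _)) p = contradiction (sym p) (l≢r e′ e)
        at (inj₂ (k , _ , e′ , ke , inj₂ _)) p = subst (λ d → keep d ≡ true) (sym (r-injective p)) ke

count-sumFin : ∀ {k} {A : Set} (p : A → Bool) (f : Fin k → A) →
  List.foldr (λ h acc → if p h then suc acc else acc) 0 (List.tabulate f) ≡ sumFin k (bit ∘ p ∘ f)
count-sumFin {zero} p f = refl
count-sumFin {suc k} p f with p (f zero)
... | true = cong suc (count-sumFin p (f ∘ suc))
... | false = count-sumFin p (f ∘ suc)

sum-sumFin : ∀ {k} {A : Set} (w : A → ℕ) (f : Fin k → A) →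
  List.foldr (λ u acc → w u ℕ.+ acc) 0 (List.tabulate f) ≡ sumFin k (w ∘ f)
sum-sumFin {zero} w f = refl
sum-sumFin {suc k} w f = cong (w (f zero) ℕ.+_) (sum-sumFin w (f ∘ suc))

sumFin-suc : ∀ k {f g : Fin k → ℕ} i → g i ≡ suc (f i) → (∀ i′ → i′ ≢ i → g i′ ≡ f i′) → sumFin k g ≡ suc (sumFin k f)
sumFin-suc (suc k) zero e others = cong₂ ℕ._+_ e (sumFin-cong k (λ i → others (suc i) λ ()))
sumFin-suc (suc k) {f} (suc i) e others = trans
  (cong₂ ℕ._+_ (others zero λ ()) (sumFin-suc k i e (λ i′ ne → others (suc i′) (ne ∘ suc-injective))))
  (ℕP.+-suc (f zero) _)

-- Enumeration of all choices of one half-edge per vertex.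

module _ {n N : ℕ} (v : Fin N → Fin n) (K : Fin n → List (Fin N)) (uK : ∀ u → Unique (K u))
  (K⇒v : ∀ {u h} → h ∈ K u → v h ≡ u) (v⇒K : ∀ {u h} → v h ≡ u → h ∈ K u) (x₀ : Vec (Fin N) n) where

  open DecMembership {A = Fin n} _≟_ using (_∈?_)

  -- Prescribing the value outside `D` makes each partial choice correspond to a single vector.
  Chosen : List (Fin n) → Vec (Fin N) n → Set
  Chosen D x = (∀ u → u ∈ D → v (lookup x u) ≡ u) × (∀ u → u ∉ D → lookup x u ≡ lookup x₀ u)

  Fibres-choice : ∀ {u D} → u ∉ D → Fibres (Chosen D) (λ x → map (λ y → x [ u ]≔ y) (K u)) (Chosen (u ∷ D))
  Fibres-choice {u} {D} u∉D .sound {x} (c , d) i with ∈-map⁻ (λ y → x [ u ]≔ y) i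
  ... | y , y∈ , refl = (λ w w∈ → chosen w w∈ (w ≟ u)) , λ w w∉ →
      trans (lookup-keep w u (w∉ ∘ here) x) (d w (w∉ ∘ there))
    where
    chosen : ∀ w → w ∈ u ∷ D → Dec (w ≡ u) → v (lookup (x [ u ]≔ y) w) ≡ w
    chosen w w∈ (yes refl) = trans (cong v (lookup-set w x)) (K⇒v y∈)
    chosen w (here e) (no w≢u) = contradiction e w≢u
    chosen w (there w∈) (no w≢u) = trans (cong v (lookup-keep w u w≢u x)) (c w w∈)
  Fibres-choice {u} {D} u∉D .complete {x} (c , d) =
    x′ , ((λ w w∈ → let w≢u = λ { refl → u∉D w∈ } in trans (cong v (lookup-keep w u w≢u x)) (c w (there w∈)))
         , λ w w∉ → rest w w∉ (w ≟ u)) ,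
    subst (_∈ map (λ y → x′ [ u ]≔ y) (K u)) back (∈-map⁺ (λ y → x′ [ u ]≔ y) (v⇒K (c u (here refl))))
    where
    x′ = x [ u ]≔ lookup x₀ u
    rest : ∀ w → w ∉ D → Dec (w ≡ u) → lookup x′ w ≡ lookup x₀ w
    rest w w∉ (yes refl) = lookup-set w x
    rest w w∉ (no w≢u) = trans (lookup-keep w u w≢u x) (d w λ { (here e) → w≢u e ; (there i) → w∉ i })
    back : x′ [ u ]≔ lookup x u ≡ x
    back = trans (VecP.updateAt-updateAt u x) (VecP.[]≔-lookup x u)
  Fibres-choice {u} {D} u∉D .disjoint {x} {x′} (_ , d) (_ , d′) i i′
    with ∈-map⁻ (λ y → x [ u ]≔ y) i | ∈-map⁻ (λ y → x′ [ u ]≔ y) i′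
  ... | y , _ , e | y′ , _ , e′ = Vec-ext λ w → at w (w ≟ u)
    where
    at : ∀ w → Dec (w ≡ u) → lookup x w ≡ lookup x′ w
    at w (yes refl) = trans (d w u∉D) (sym (d′ w u∉D))
    at w (no w≢u) = trans (sym (lookup-keep w u w≢u x))
      (trans (cong (λ z → lookup z w) (trans (sym e) e′)) (lookup-keep w u w≢u x′))
  Fibres-choice {u} u∉D .unique {x} _ = Unique-map _ (uK u) λ {y} {y′} _ _ e →
    trans (sym (lookup-set u x)) (trans (cong (λ z → lookup z u) e) (lookup-set u x))

  Fibres-choices : ∀ us → Unique us → Fibres (_≡ x₀) (λ x → choices v K x us) (Chosen us)
  Fibres-choices [] _ = Fibres-single (λ _ → refl) (λ { refl → (λ _ ()) , λ _ _ → refl }) (λ (_ , d) → Vec-ext λ u → d u λ ())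
  Fibres-choices (u ∷ us) (u∉ ∷ uus) = Fibres-∘ (Fibres-choices us uus) (Fibres-choice λ i → All.lookup u∉ i refl)

-- The leaf attached to the given graph, and markings of half-edges.

module _ {n m : ℕ} (ends : Fin m → Fin (suc n) × Fin (suc n)) where

  G : Graph
  G = record { n = suc n ; m = m ; ends = ends }

  private
    lᴹ rᴹ : Fin m → Fin (m ℕ.+ m)
    lᴹ e = e ↑ˡ m
    rᴹ e = m ↑ʳ e

  sides : ∀ h → ∃ λ e → h ≡ lᴹ e ⊎ h ≡ rᴹ e
  sides h = by-cases (splitAt m h) (join-splitAt m m h)
    where
    by-cases : ∀ s → join m m s ≡ h → ∃ λ e → h ≡ lᴹ e ⊎ h ≡ rᴹ e
    by-cases (inj₁ e) p = e , inj₁ (sym p)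
    by-cases (inj₂ e) p = e , inj₂ (sym p)

  ι-l : ∀ e → ι G (lᴹ e) ≡ rᴹ e
  ι-l e = cong [ (λ e → m ↑ʳ e) , (λ e → e ↑ˡ m) ]′ (splitAt-↑ˡ m e m)

  ι-r : ∀ e → ι G (rᴹ e) ≡ lᴹ e
  ι-r e = cong [ (λ e → m ↑ʳ e) , (λ e → e ↑ˡ m) ]′ (splitAt-↑ʳ m m e)

  ι-involutive : ∀ h → ι G (ι G h) ≡ h
  ι-involutive h with sides h
  ... | e , inj₁ refl = trans (cong (ι G) (ι-l e)) (ι-r e)
  ... | e , inj₂ refl = trans (cong (ι G) (ι-r e)) (ι-l e)

  vert-l : ∀ e → vert G (lᴹ e) ≡ proj₁ (ends e)
  vert-l e = cong [ (λ e → proj₁ (ends e)) , (λ e → proj₂ (ends e)) ]′ (splitAt-↑ˡ m e m)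

  vert-r : ∀ e → vert G (rᴹ e) ≡ proj₂ (ends e)
  vert-r e = cong [ (λ e → proj₁ (ends e)) , (λ e → proj₂ (ends e)) ]′ (splitAt-↑ʳ m m e)

  l≢rᴹ : ∀ e e′ → lᴹ e ≢ rᴹ e′
  l≢rᴹ e e′ p with trans (sym (splitAt-↑ˡ m e m)) (trans (cong (splitAt m) p) (splitAt-↑ʳ m m e′))
  ... | ()

  -- Half-edges are shifted by one to make room for the leaf at index zero.
  rooting : Rooting n (m ℕ.+ m) m
  rooting = record
    { v = λ { zero → zero ; (suc h) → vert G h }
    ; v-zero = refl
    ; j = λ { zero → zero ; (suc h) → suc (ι G h) }
    ; j-invol = λ { zero → refl ; (suc h) → cong suc (ι-involutive h) }
    ; j-zero = refl
    ; l = suc ∘ lᴹ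
    ; r = suc ∘ rᴹ
    ; j-l = λ e → cong suc (ι-l e)
    ; cover = λ { zero → inj₁ refl ; (suc h) → inj₂ (by-side (sides h)) }
    ; l≢0 = λ _ ()
    ; r≢0 = λ _ ()
    ; l-injective = λ p → ↑ˡ-injective m _ _ (suc-injective p)
    ; r-injective = λ p → ↑ʳ-injective m _ _ (suc-injective p)
    ; l≢r = λ e e′ p → l≢rᴹ e e′ (suc-injective p) }
    where
    by-side : ∀ {h} → (∃ λ e → h ≡ lᴹ e ⊎ h ≡ rᴹ e) → ∃ λ e → Fin.suc h ≡ suc (lᴹ e) ⊎ Fin.suc h ≡ suc (rᴹ e)
    by-side (e , inj₁ refl) = e , inj₁ refl
    by-side (e , inj₂ refl) = e , inj₂ refl

  open Rooting rooting

  kVec : Decoration G → Vec ℕ (suc n)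
  kVec S = Vec.tabulate (kAt G S)

  kAt-sumFin : ∀ S u → kAt G S u ≡ sumFin (m ℕ.+ m) (λ h → bit (lookup S h ∧ ⌊ vert G h ≟ u ⌋))
  kAt-sumFin S u = count-sumFin (λ h → lookup S h ∧ ⌊ vert G h ≟ u ⌋) (λ h → h)

  kVec-mark : ∀ S h → lookup S h ≡ false → kVec (S [ h ]≔ true) ≡ inc (vert G h) (kVec S)
  kVec-mark S h Sh = Vec-ext λ u → trans (VecP.lookup∘tabulate (kAt G S′) u) (trans (kAt-sumFin S′ u) (at u (vert G h ≟ u)))
    where
    S′ = S [ h ]≔ true
    other : ∀ u h′ → h′ ≢ h → bit (lookup S′ h′ ∧ ⌊ vert G h′ ≟ u ⌋) ≡ bit (lookup S h′ ∧ ⌊ vert G h′ ≟ u ⌋)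
    other u h′ ne = cong (λ s → bit (s ∧ ⌊ vert G h′ ≟ u ⌋)) (lookup-keep h′ h ne S)
    at : ∀ u → Dec (vert G h ≡ u) → sumFin (m ℕ.+ m) (λ h′ → bit (lookup S′ h′ ∧ ⌊ vert G h′ ≟ u ⌋)) ≡ lookup (inc (vert G h) (kVec S)) u
    at u (yes refl) = trans
      (sumFin-suc (m ℕ.+ m) h
        (trans (cong bit (cong₂ _∧_ (lookup-set h S) (⌊⌋-true (vert G h ≟ vert G h) refl)))
          (cong (λ s → suc (bit (s ∧ ⌊ vert G h ≟ vert G h ⌋))) (sym Sh)))
        (other u))
      (trans (cong suc (sym (trans (VecP.lookup∘tabulate (kAt G S) u) (kAt-sumFin S u)))) (sym (lookup-set u (kVec S))))
    at u (no ne) = trans (sumFin-cong (m ℕ.+ m) same)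
      (sym (trans (lookup-keep u (vert G h) (ne ∘ sym) (kVec S)) (trans (VecP.lookup∘tabulate (kAt G S) u) (kAt-sumFin S u))))
      where
      same : ∀ h′ → bit (lookup S′ h′ ∧ ⌊ vert G h′ ≟ u ⌋) ≡ bit (lookup S h′ ∧ ⌊ vert G h′ ≟ u ⌋)
      same h′ with h′ ≟ h
      ... | no h′≢h = other u h′ h′≢h
      ... | yes refl = cong bit (trans (cong₂ _∧_ (lookup-set h S) (⌊⌋-false (vert G h ≟ u) ne))
                         (sym (cong₂ _∧_ Sh refl)))

  ∅ : Decoration G
  ∅ = Vec.replicate _ false

  kVec-∅ : kVec ∅ ≡ Vec.replicate _ 0
  kVec-∅ = Vec-ext λ u → trans (VecP.lookup∘tabulate (kAt G ∅) u) (trans (kAt-sumFin ∅ u)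
    (trans (sumFin-none (m ℕ.+ m) (λ h → cong (_∧ ⌊ vert G h ≟ u ⌋) (VecP.lookup-replicate h false))) (sym (VecP.lookup-replicate u 0))))

  module _ (x : Vec (Fin (suc (m ℕ.+ m))) (suc n)) (s : Section rooting x) where

    OneHalf : Decoration G → Fin m → Set
    OneHalf S e = (lookup S (lᴹ e) ≡ true × lookup S (rᴹ e) ≡ false) ⊎ (lookup S (lᴹ e) ≡ false × lookup S (rᴹ e) ≡ true)

    NoHalf : Decoration G → Fin m → Set
    NoHalf S e = lookup S (lᴹ e) ≡ false × lookup S (rᴹ e) ≡ false

    -- Describes one term of the product of the `- t - t′`: exactly one half of every edge off the
    -- tree.
    Marking : Decoration G → Fin m → Set
    Marking S e = (OnTree rooting x s e × NoHalf S e) ⊎ (¬ OnTree rooting x s e × OneHalf S e)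

    Marked : List (Fin m) → Decoration G → Set
    Marked D S = (∀ e → e ∈ D → Marking S e) × (∀ e → e ∉ D → NoHalf S e)

    mark : Fin m → Decoration G → List (Decoration G)
    mark e S with onTree? rooting x s e
    ... | yes _ = S ∷ []
    ... | no _ = S [ lᴹ e ]≔ true ∷ S [ rᴹ e ]≔ true ∷ []

    marks : List (Fin m) → Decoration G → List (Decoration G)
    marks [] S = S ∷ []
    marks (e ∷ es) S = concatMap (mark e) (marks es S)

    private
      module Set-edge (e : Fin m) (S S′ : Decoration G)
        (agree : ∀ e′ → e′ ≢ e → lookup S (lᴹ e′) ≡ lookup S′ (lᴹ e′) × lookup S (rᴹ e′) ≡ lookup S′ (rᴹ e′)) where

        NoHalf-other : ∀ e′ → e′ ≢ e → NoHalf S e′ → NoHalf S′ e′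
        NoHalf-other e′ ne = let p , q = agree e′ ne in subst₂ (λ a c → a ≡ false × c ≡ false) p q

        Marking-other : ∀ e′ → e′ ≢ e → Marking S e′ → Marking S′ e′
        Marking-other e′ ne = let p , q = agree e′ ne in subst₂ (λ a c →
          (OnTree rooting x s e′ × a ≡ false × c ≡ false) ⊎
          (¬ OnTree rooting x s e′ × ((a ≡ true × c ≡ false) ⊎ (a ≡ false × c ≡ true)))) p q

        add : ∀ {D} → Marked D S → Marking S′ e → Marked (e ∷ D) S′
        add {D} (c , d) me = (λ e′ i → at e′ i (e′ ≟ e)) , λ e′ ni → NoHalf-other e′ (ni ∘ here) (d e′ (ni ∘ there))
          where
          at : ∀ e′ → e′ ∈ e ∷ D → Dec (e′ ≡ e) → Marking S′ e′
          at e′ i (yes refl) = me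
          at e′ (here p) (no ne) = contradiction p ne
          at e′ (there i) (no ne) = Marking-other e′ ne (c e′ i)

        remove : ∀ {D} → e ∉ D → Marked (e ∷ D) S → NoHalf S′ e → Marked D S′
        remove {D} e∉D (c , d) me = (λ e′ i → Marking-other e′ (λ { refl → e∉D i }) (c e′ (there i))) , λ e′ ni → at e′ ni (e′ ≟ e)
          where
          at : ∀ e′ → e′ ∉ D → Dec (e′ ≡ e) → NoHalf S′ e′
          at e′ ni (yes refl) = me
          at e′ ni (no ne) = NoHalf-other e′ ne (d e′ λ { (here p) → ne p ; (there i) → ni i })

      agree-l : ∀ e (S : Decoration G) b e′ → e′ ≢ e → lookup S (lᴹ e′) ≡ lookup (S [ lᴹ e ]≔ b) (lᴹ e′) × lookup S (rᴹ e′) ≡ lookup (S [ lᴹ e ]≔ b) (rᴹ e′)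
      agree-l e S b e′ ne = sym (lookup-keep _ _ (λ p → ne (↑ˡ-injective m _ _ p)) S)
                          , sym (lookup-keep _ _ (λ p → l≢rᴹ e e′ (sym p)) S)

      agree-r : ∀ e (S : Decoration G) b e′ → e′ ≢ e → lookup S (lᴹ e′) ≡ lookup (S [ rᴹ e ]≔ b) (lᴹ e′) × lookup S (rᴹ e′) ≡ lookup (S [ rᴹ e ]≔ b) (rᴹ e′)
      agree-r e S b e′ ne = sym (lookup-keep _ _ (l≢rᴹ e′ e) S)
                          , sym (lookup-keep _ _ (λ p → ne (↑ʳ-injective m _ _ p)) S)

      true≢false : true ≢ false
      true≢false ()

    Fibres-mark : ∀ {e D} → e ∉ D → Fibres (Marked D) (mark e) (Marked (e ∷ D))
    Fibres-mark {e} {D} e∉D with onTree? rooting x s e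
    ... | yes o = Fibres-single (λ _ → refl)
        (λ {S} M → Set-edge.add e S S (λ _ _ → refl , refl) M (inj₁ (o , proj₂ M e e∉D)))
        (λ {S} M → Set-edge.remove e S S (λ _ _ → refl , refl) e∉D M (none {S} (proj₁ M e (here refl))))
      where
      none : ∀ {S} → Marking S e → NoHalf S e
      none (inj₁ (_ , p)) = p
      none (inj₂ (¬o , _)) = contradiction o ¬o
    ... | no ¬o = record { sound = sound′ ; complete = complete′ ; disjoint = disjoint′ ; unique = unique′ }
      where
      with-l with-r : Decoration G → Decoration G
      with-l S = S [ lᴹ e ]≔ true
      with-r S = S [ rᴹ e ]≔ true
      sound′ : ∀ {S S′} → Marked D S → S′ ∈ with-l S ∷ with-r S ∷ [] → Marked (e ∷ D) S′
      sound′ {S} M (here refl) = Set-edge.add e S (with-l S) (agree-l e S true) M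
        (inj₂ (¬o , inj₁ (lookup-set (lᴹ e) S , trans (lookup-keep _ _ (λ p → l≢rᴹ e e (sym p)) S) (proj₂ (proj₂ M e e∉D)))))
      sound′ {S} M (there (here refl)) = Set-edge.add e S (with-r S) (agree-r e S true) M
        (inj₂ (¬o , inj₂ (trans (lookup-keep _ _ (l≢rᴹ e e) S) (proj₁ (proj₂ M e e∉D)) , lookup-set (rᴹ e) S)))
      complete′ : ∀ {S} → Marked (e ∷ D) S → ∃ λ S₀ → Marked D S₀ × S ∈ with-l S₀ ∷ with-r S₀ ∷ []
      complete′ {S} M with proj₁ M e (here refl)
      ... | inj₁ (o , _) = contradiction o ¬o
      ... | inj₂ (_ , inj₁ (p , q)) = S₀ , Set-edge.remove e S S₀ (agree-l e S false) e∉D M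
              (lookup-set (lᴹ e) S , trans (lookup-keep _ _ (λ p → l≢rᴹ e e (sym p)) S) q) ,
            here (sym (trans (VecP.updateAt-updateAt (lᴹ e) S) (trans (cong (S [ lᴹ e ]≔_) (sym p)) (VecP.[]≔-lookup S (lᴹ e)))))
        where
        S₀ = S [ lᴹ e ]≔ false
      ... | inj₂ (_ , inj₂ (p , q)) = S₀ , Set-edge.remove e S S₀ (agree-r e S false) e∉D M
              (trans (lookup-keep _ _ (l≢rᴹ e e) S) p , lookup-set (rᴹ e) S) ,
            there (here (sym (trans (VecP.updateAt-updateAt (rᴹ e) S) (trans (cong (S [ rᴹ e ]≔_) (sym q)) (VecP.[]≔-lookup S (rᴹ e))))))
        where
        S₀ = S [ rᴹ e ]≔ false
      restore : ∀ {S S′} h → lookup S h ≡ false → lookup S′ h ≡ false → S [ h ]≔ true ≡ S′ [ h ]≔ true → S ≡ S′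
      restore {S} {S′} h p p′ eq = trans (sym (back S p)) (trans (cong (_[ h ]≔ false) eq) (back S′ p′))
        where
        back : ∀ S → lookup S h ≡ false → S [ h ]≔ true [ h ]≔ false ≡ S
        back S p = trans (VecP.updateAt-updateAt h S) (trans (cong (S [ h ]≔_) (sym p)) (VecP.[]≔-lookup S h))
      clash : ∀ {S S′} → NoHalf S′ e → with-l S ≢ with-r S′
      clash {S} {S′} (p , _) eq = true≢false (trans (sym (lookup-set (lᴹ e) S))
        (trans (cong (λ w → lookup w (lᴹ e)) eq) (trans (lookup-keep _ _ (l≢rᴹ e e) S′) p)))
      disjoint′ : ∀ {S S′ S″} → Marked D S → Marked D S′ → S″ ∈ with-l S ∷ with-r S ∷ [] → S″ ∈ with-l S′ ∷ with-r S′ ∷ [] → S ≡ S′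
      disjoint′ M M′ (here p) (here q) = restore (lᴹ e) (proj₁ (proj₂ M e e∉D)) (proj₁ (proj₂ M′ e e∉D)) (trans (sym p) q)
      disjoint′ M M′ (here p) (there (here q)) = contradiction (trans (sym p) q) (clash (proj₂ M′ e e∉D))
      disjoint′ M M′ (there (here p)) (here q) = contradiction (trans (sym q) p) (clash (proj₂ M e e∉D))
      disjoint′ M M′ (there (here p)) (there (here q)) = restore (rᴹ e) (proj₂ (proj₂ M e e∉D)) (proj₂ (proj₂ M′ e e∉D)) (trans (sym p) q)
      unique′ : ∀ {S} → Marked D S → Unique (with-l S ∷ with-r S ∷ [])
      unique′ {S} M = (clash (proj₂ M e e∉D) ∷ []) ∷ [] ∷ []

    Fibres-marks : ∀ es → Unique es → Fibres (_≡ ∅) (marks es) (Marked es)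
    Fibres-marks [] _ = Fibres-single (λ _ → refl)
      (λ { refl → (λ _ ()) , λ e _ → VecP.lookup-replicate (lᴹ e) false , VecP.lookup-replicate (rᴹ e) false })
      (λ {S} (_ , d) → Vec-ext λ h → trans (unmarked S d h) (sym (VecP.lookup-replicate h false)))
      where
      unmarked : ∀ S → (∀ e → e ∉ [] → NoHalf S e) → ∀ h → lookup S h ≡ false
      unmarked S d h with sides h
      ... | e , inj₁ refl = proj₁ (d e λ ())
      ... | e , inj₂ refl = proj₂ (d e λ ())
    Fibres-marks (e ∷ es) (e∉ ∷ u) = Fibres-∘ (Fibres-marks es u) (Fibres-mark λ i → All.lookup e∉ i refl)

    -- The terms of the expanded product are the markings, and the multi-index of a term counts the
    -- marks at each vertex.
    orient₂-marks : ∀ es → Unique es → ∀ Ψ → orient₂ rooting x s es Ψ (kVec ∅) ≡ ∑ (marks es ∅) (Ψ ∘ kVec)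
    orient₂-marks [] _ Ψ = sym (ℚP.+-identityʳ _)
    orient₂-marks (e ∷ es) (e∉ ∷ u) Ψ =
      trans (by-mark (λ i → Fibres-marks es u .sound refl i)) (sym (∑-concatMap (marks es ∅) (mark e) (Ψ ∘ kVec)))
      where
      e∉es : e ∉ es
      e∉es i = All.lookup e∉ i refl
      by-mark : (∀ {S} → S ∈ marks es ∅ → Marked es S) →
        orient₂ rooting x s (e ∷ es) Ψ (kVec ∅) ≡ ∑ (marks es ∅) (λ S → ∑ (mark e S) (Ψ ∘ kVec))
      by-mark marked with onTree? rooting x s e
      ... | yes _ = trans (orient₂-marks es u Ψ) (∑-cong (marks es ∅) (λ {S} _ → sym (ℚP.+-identityʳ (Ψ (kVec S)))))
      ... | no _ = begin
        -- The increment moves into `Ψ`, since the induction hypothesis starts from the empty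
        -- marking.
        orient₂ rooting x s es Ψ (inc (v (l e)) (kVec ∅)) + orient₂ rooting x s es Ψ (inc (v (r e)) (kVec ∅))
          ≡⟨ cong₂ _+_ (sym (orient₂-inc rooting x s es Ψ (v (l e)) (kVec ∅))) (sym (orient₂-inc rooting x s es Ψ (v (r e)) (kVec ∅))) ⟩
        orient₂ rooting x s es (Ψ ∘ inc (v (l e))) (kVec ∅) + orient₂ rooting x s es (Ψ ∘ inc (v (r e))) (kVec ∅)
          ≡⟨ cong₂ _+_ (orient₂-marks es u (Ψ ∘ inc (v (l e)))) (orient₂-marks es u (Ψ ∘ inc (v (r e)))) ⟩
        ∑ (marks es ∅) (λ S → Ψ (inc (v (l e)) (kVec S))) + ∑ (marks es ∅) (λ S → Ψ (inc (v (r e)) (kVec S)))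
          ≡⟨ sym (∑-+ (marks es ∅) _ _) ⟩
        ∑ (marks es ∅) (λ S → Ψ (inc (v (l e)) (kVec S)) + Ψ (inc (v (r e)) (kVec S)))
          ≡⟨ ∑-cong (marks es ∅) (λ {S} i → let no-l , no-r = proj₂ (marked i) e e∉es in
               cong₂ _+_ (cong Ψ (sym (kVec-mark S (lᴹ e) no-l)))
                 (trans (cong Ψ (sym (kVec-mark S (rᴹ e) no-r))) (sym (ℚP.+-identityʳ (Ψ (kVec (S [ rᴹ e ]≔ true))))))) ⟩
        ∑ (marks es ∅) (λ S → Ψ (kVec (S [ lᴹ e ]≔ true)) + (Ψ (kVec (S [ rᴹ e ]≔ true)) + 0ℚ)) ∎

-- Moments of `t` and the weight of a decoration.

parity : ∀ k → (2 ∣ k × pow (- ½) k ≡ pow ½ k) ⊎ (¬ 2 ∣ k × pow (- ½) k ≡ - pow ½ k)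
parity zero = inj₁ (2 ∣0 , refl)
parity (suc zero) = inj₂ ((λ d → contradiction (∣1⇒≡1 d) λ ()) , refl)
parity (suc (suc k)) with parity k
... | inj₁ (d , e) = inj₁ (∣m∣n⇒∣m+n ∣-refl d , trans (cong (λ w → - ½ * (- ½ * w)) e) (square (pow ½ k)))
  where
  square : ∀ w → - ½ * (- ½ * w) ≡ ½ * (½ * w)
  square = solve-∀ ring
... | inj₂ (nd , e) = inj₂ ((λ d → nd (∣m+n∣m⇒∣n d ∣-refl)) , trans (cong (λ w → - ½ * (- ½ * w)) e) (square (pow ½ k)))
  where
  square : ∀ w → - ½ * (- ½ * - w) ≡ - (½ * (½ * w))
  square = solve-∀ ring

ν-even : ∀ k → 2 ∣ k → ν k ≡ pow ½ k * recip k
ν-even k d with parity k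
... | inj₂ (nd , _) = contradiction d nd
... | inj₁ (_ , e) = cong (_* recip k) (trans (cong (λ w → ½ * (pow ½ k + w)) e) (mean (pow ½ k)))
  where
  mean : ∀ w → ½ * (w + w) ≡ w
  mean = solve-∀ ring

ν-odd : ∀ k → ¬ 2 ∣ k → ν k ≡ 0ℚ
ν-odd k nd with parity k
... | inj₁ (d , _) = contradiction d nd
... | inj₂ (_ , e) = trans (cong (λ w → (½ * (pow ½ k + w)) * recip k) e) (cancel (pow ½ k) (recip k))
  where
  cancel : ∀ w q → (½ * (w - w)) * q ≡ 0ℚ
  cancel = solve-∀ ring

pow-+ : ∀ q k l → pow q (k ℕ.+ l) ≡ pow q k * pow q l
pow-+ q zero l = sym (ℚP.*-identityˡ (pow q l))
pow-+ q (suc k) l = trans (cong (q *_) (pow-+ q k l)) (sym (ℚP.*-assoc q (pow q k) (pow q l)))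

moments-even : ∀ k (f : Fin k → ℕ) → (∀ i → 2 ∣ f i) →
  moments (Vec.replicate k 0) (Vec.tabulate f) ≡
  pow ½ (sumFin k f) * List.foldr _*_ 1ℚ (List.tabulate (λ i → ℤ.+ 1 ℚ./ suc (f i)))
moments-even zero f even = refl
moments-even (suc k) f even = begin
  ν (f zero) * moments (Vec.replicate k 0) (Vec.tabulate (f ∘ suc))
    ≡⟨ cong₂ _*_ (trans (ν-even (f zero) (even zero)) (cong (pow ½ (f zero) *_) (recip-/ (f zero)))) (moments-even k (f ∘ suc) (even ∘ suc)) ⟩
  (pow ½ (f zero) * q) * (pow ½ (sumFin k (f ∘ suc)) * p) ≡⟨ lemma (pow ½ (f zero)) q (pow ½ (sumFin k (f ∘ suc))) p ⟩
  (pow ½ (f zero) * pow ½ (sumFin k (f ∘ suc))) * (q * p) ≡⟨ cong (_* (q * p)) (sym (pow-+ ½ (f zero) (sumFin k (f ∘ suc)))) ⟩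
  pow ½ (sumFin (suc k) f) * (q * p) ∎
  where
  q = ℤ.+ 1 ℚ./ suc (f zero)
  p = List.foldr _*_ 1ℚ (List.tabulate (λ i → ℤ.+ 1 ℚ./ suc (f (suc i))))
  lemma : ∀ a b c d → (a * b) * (c * d) ≡ (a * c) * (b * d)
  lemma = solve-∀ ring

moments-odd : ∀ k (f : Fin k → ℕ) i → ¬ 2 ∣ f i → moments (Vec.replicate k 0) (Vec.tabulate f) ≡ 0ℚ
moments-odd (suc k) f zero nd =
  trans (cong (_* moments (Vec.replicate k 0) (Vec.tabulate (f ∘ suc))) (ν-odd (f zero) nd)) (ℚP.*-zeroˡ (moments (Vec.replicate k 0) (Vec.tabulate (f ∘ suc))))
moments-odd (suc k) f (suc i) nd =
  trans (cong (ν (f zero) *_) (moments-odd k (f ∘ suc) i nd)) (ℚP.*-zeroʳ (ν (f zero)))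

rotate : ∀ a b c → (a * b) * c ≡ (b * c) * a
rotate = solve-∀ ring

-- Identifies a power through its recursion alone, which is all that is accessible of the one inside
-- `weight`.
pow-unique : (F : ℚ → ℕ → ℚ → ℚ) → (∀ q p → F q 0 p ≡ 1ℚ * p) → (∀ q k p → F q (suc k) p ≡ F q k p * q) →
             ∀ q k p → F q k p ≡ pow q k * p
pow-unique F F0 Fs q zero p = F0 q p
pow-unique F F0 Fs q (suc k) p =
  trans (Fs q k p) (trans (cong (_* q) (pow-unique F F0 Fs q k p)) (sym (rotate q (pow q k) p)))

mutual

  -- The exponentiation inside the definition of weight is local to it and has no name here;
  -- the function below is found by unification.
  scaled-pow : (H : Graph) → ℕ → Decoration H → ℚ → ℕ → ℚ → ℚ
  scaled-pow = _

  weight-pow : ∀ H g S → weight H g S ≡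
    pow ½ (2 ℕ.* g) * List.foldr _*_ 1ℚ (map (λ u → ℤ.+ 1 ℚ./ suc (kAt H S u)) (List.allFin (Graph.n H)))
  weight-pow H g S
    -- Once base, exponent and product are variables, the unknown function is applied to distinct
    -- variables, so that unification determines it.
    with ½ | 2 ℕ.* g | List.foldr _*_ 1ℚ (map (λ u → ℤ.+ 1 ℚ./ suc (kAt H S u)) (List.allFin (Graph.n H)))
  ... | q | k | p = pow-unique (scaled-pow H g S) (λ _ _ → refl) (λ q k p → rotate q _ p) q k p

bit-∧ : ∀ b c → bit (not b ∧ not c) ≡ 1 → b ≡ false × c ≡ false
bit-∧ false false _ = refl , refl

-- Markings with even counts are the decorations.

module _ {n m : ℕ} (ends : Fin m → Fin (suc n) × Fin (suc n)) where

  private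
    H : Graph
    H = G ends
    R : Rooting n (m ℕ.+ m) m
    R = rooting ends
    open module Rt = Rooting R using (v; j)

  moments-weight : ∀ g S → (∀ u → 2 ∣ kAt H S u) → sumOverVertices H (kAt H S) ≡ 2 ℕ.* g →
                   moments (Vec.replicate (suc n) 0) (kVec ends S) ≡ weight H g S
  moments-weight g S even total = begin
    moments (Vec.replicate (suc n) 0) (kVec ends S) ≡⟨ moments-even (suc n) (kAt H S) even ⟩
    pow ½ (sumFin (suc n) (kAt H S)) * List.foldr _*_ 1ℚ (List.tabulate (λ u → ℤ.+ 1 ℚ./ suc (kAt H S u)))
      ≡⟨ cong₂ (λ i ps → pow ½ i * List.foldr _*_ 1ℚ ps) (trans (sym (sum-sumFin (kAt H S) (λ u → u))) total)
           (sym (ListP.map-tabulate (λ u → u) (λ u → ℤ.+ 1 ℚ./ suc (kAt H S u)))) ⟩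
    pow ½ (2 ℕ.* g) * List.foldr _*_ 1ℚ (map (λ u → ℤ.+ 1 ℚ./ suc (kAt H S u)) (List.allFin (suc n)))
      ≡⟨ sym (weight-pow H g S) ⟩
    weight H g S ∎

  private
    marksAt : Decoration H → Fin m → ℕ
    marksAt S e = bit (lookup S (e ↑ˡ m)) ℕ.+ bit (lookup S (m ↑ʳ e))

  -- Every chosen half-edge lies at one vertex and on one edge.
  kAt-total : ∀ S → sumOverVertices H (kAt H S) ≡ sumFin m (marksAt S)
  kAt-total S = begin
    sumOverVertices H (kAt H S) ≡⟨ sum-sumFin (kAt H S) (λ u → u) ⟩
    sumFin (suc n) (kAt H S) ≡⟨ sumFin-cong (suc n) (kAt-sumFin ends S) ⟩
    sumFin (suc n) (λ u → sumFin (m ℕ.+ m) (λ h → bit (lookup S h ∧ ⌊ vert H h ≟ u ⌋)))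
      ≡⟨ sumFin-swap (suc n) (m ℕ.+ m) (λ u h → bit (lookup S h ∧ ⌊ vert H h ≟ u ⌋)) ⟩
    sumFin (m ℕ.+ m) (λ h → sumFin (suc n) (λ u → bit (lookup S h ∧ ⌊ vert H h ≟ u ⌋)))
      ≡⟨ sumFin-cong (m ℕ.+ m) (λ h → at h (lookup S h)) ⟩
    sumFin (m ℕ.+ m) (λ h → bit (lookup S h)) ≡⟨ sumFin-split m m _ ⟩
    sumFin m (λ e → bit (lookup S (e ↑ˡ m))) ℕ.+ sumFin m (λ e → bit (lookup S (m ↑ʳ e))) ≡⟨ sym (sumFin-+ m _ _) ⟩
    sumFin m (marksAt S) ∎
    where
    at : ∀ h b → sumFin (suc n) (λ u → bit (b ∧ ⌊ vert H h ≟ u ⌋)) ≡ bit b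
    at h true = sumFin-one (suc n) (vert H h) (⌊⌋-true (vert H h ≟ vert H h) refl) (λ u ne → ⌊⌋-false (vert H h ≟ u) (ne ∘ sym))
    at h false = sumFin-none (suc n) (λ u → refl)

  betti : firstBetti H ≡ m ℕ.∸ n
  betti = cong (ℕ._∸ suc n) (ℕP.+-comm m 1)

  module _ {x} (s : Section R x) (t : Tree R x) {S : Decoration H} (M : Marked ends x s (List.allFin m) S) where

    private
      marking : ∀ e → Marking ends x s S e
      marking e = proj₁ M e (∈-allFin e)

    remaining-tree : ∀ e → remaining H S e ≡ ⌊ onTree? R x s e ⌋
    remaining-tree e with marking e
    ... | inj₁ (o , p , q) = trans (cong₂ (λ a b → not a ∧ not b) p q) (sym (⌊⌋-true (onTree? R x s e) o))
    ... | inj₂ (¬o , inj₁ (p , q)) = trans (cong₂ (λ a b → not a ∧ not b) p q) (sym (⌊⌋-false (onTree? R x s e) ¬o))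
    ... | inj₂ (¬o , inj₂ (p , q)) = trans (cong₂ (λ a b → not a ∧ not b) p q) (sym (⌊⌋-false (onTree? R x s e) ¬o))

    private
      Reached : Fin (suc n) → Fin (suc n) → Set
      Reached = Reach H (remaining H S)

      _then_ : ∀ {a b c} → Reached a b → Reached b c → Reached a c
      here then q = q
      fwd e k p then q = fwd e k (p then q)
      bwd e k p then q = bwd e k (p then q)

      back : ∀ {a b} → Reached a b → Reached b a
      back here = here
      back (fwd e k p) = back p then bwd e k here
      back (bwd e k p) = back p then fwd e k here

      kept : ∀ {e u} → lookup x u ≡ Rooting.l R e ⊎ lookup x u ≡ Rooting.r R e → remaining H S e ≡ true
      kept {e} p = trans (remaining-tree e) (⌊⌋-true (onTree? R x s e) (OnTree-half R x s t p))

      to-root : ∀ {u} → Hit (parent R x) (_≡ zero) u → Reached u zero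
      to-root (now refl) = here
      to-root {u} (later refl h) with u ≟ zero
      ... | yes refl = here
      ... | no u≢0 with Rooting.cover R (lookup x u)
      ...   | inj₁ e = contradiction e (x≢0 R x s t u≢0)
      ...   | inj₂ (e , inj₁ p) = subst (λ w → Reached w zero) start
              (fwd e (kept (inj₁ p)) (subst (λ w → Reached w zero) end (to-root h)))
        where
        start : proj₁ (ends e) ≡ u
        start = trans (sym (vert-l ends e)) (trans (cong v (sym p)) (s u))
        end : parent R x u ≡ proj₂ (ends e)
        end = trans (cong (v ∘ j) p) (trans (cong v (Rooting.j-l R e)) (vert-r ends e))
      ...   | inj₂ (e , inj₂ p) = subst (λ w → Reached w zero) start
              (bwd e (kept (inj₂ p)) (subst (λ w → Reached w zero) end (to-root h)))
        where
        start : proj₂ (ends e) ≡ u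
        start = trans (sym (vert-r ends e)) (trans (cong v (sym p)) (s u))
        end : parent R x u ≡ proj₁ (ends e)
        end = trans (cong (v ∘ j) p) (trans (cong v (Rooting.j-r R e)) (vert-l ends e))

    -- An edge is on the tree or carries one mark, and never both.
    marked-total : sumFin m (marksAt S) ℕ.+ n ≡ m
    marked-total = begin
      sumFin m (marksAt S) ℕ.+ n ≡⟨ cong (sumFin m (marksAt S) ℕ.+_) (sym (tree-count R x s t)) ⟩
      sumFin m (marksAt S) ℕ.+ sumFin m (λ e → bit ⌊ onTree? R x s e ⌋) ≡⟨ sym (sumFin-+ m _ _) ⟩
      sumFin m (λ e → marksAt S e ℕ.+ bit ⌊ onTree? R x s e ⌋) ≡⟨ sumFin-cong m one ⟩
      sumFin m (λ _ → 1) ≡⟨ sumFin-1 m ⟩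
      m ∎
      where
      one : ∀ e → marksAt S e ℕ.+ bit ⌊ onTree? R x s e ⌋ ≡ 1
      one e with marking e
      ... | inj₁ (o , p , q) = cong₂ ℕ._+_ (cong₂ (λ a b → bit a ℕ.+ bit b) p q) (cong bit (⌊⌋-true (onTree? R x s e) o))
      ... | inj₂ (¬o , inj₁ (p , q)) = cong₂ ℕ._+_ (cong₂ (λ a b → bit a ℕ.+ bit b) p q) (cong bit (⌊⌋-false (onTree? R x s e) ¬o))
      ... | inj₂ (¬o , inj₂ (p , q)) = cong₂ ℕ._+_ (cong₂ (λ a b → bit a ℕ.+ bit b) p q) (cong bit (⌊⌋-false (onTree? R x s e) ¬o))

    marked-decoration : ∀ g → firstBetti H ≡ 2 ℕ.* g → (∀ u → 2 ∣ kAt H S u) → IsDecoration H g S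
    marked-decoration g b even = even
      , trans (kAt-total S) (trans (sym (ℕP.m+n∸n≡m (sumFin m (marksAt S)) n)) (trans (cong (ℕ._∸ n) marked-total) (trans (sym betti) b)))
      , (λ u w → to-root (proj₂ t u) then back (to-root (proj₂ t w)))
      , trans (cong (ℕ._+ 1) (trans (count-sumFin (remaining H S) (λ e → e))
          (trans (sumFin-cong m (cong bit ∘ remaining-tree)) (tree-count R x s t)))) (ℕP.+-comm n 1)

  -- Breadth-first search along the remaining edges finds a rooted tree with `n` edges, and only `n`
  -- edges remain, so it uses all of them. Each of the other `m - n` edges has at least one chosen
  -- half, and only `2 * g = m - n` halves are chosen, so each has exactly one.
  decoration-marked : ∀ {g S} → firstBetti H ≡ 2 ℕ.* g → IsDecoration H g S →
    ∃ λ x → ∃ λ (s : Section R x) → Tree R x × Marked ends x s (List.allFin m) S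
  decoration-marked {g} {S} b (even , total , conn , count) =
    x , s , t , (λ e _ → marking e) , λ e ne → contradiction (∈-allFin e) ne
    where
    keep = remaining H S
    within : ∀ {u w} → Reach H keep u w → w ≡ zero → ∃ λ k → Within R keep k u
    within here e = 0 , e
    within (fwd e k p) eq = let i , w = within p eq in
      suc i , inj₂ (e , k , inj₁ (vert-l ends e , subst (Within R keep i) (sym (vert-r ends e)) w))
    within (bwd e k p) eq = let i , w = within p eq in
      suc i , inj₂ (e , k , inj₂ (vert-r ends e , subst (Within R keep i) (sym (vert-l ends e)) w))
    reach : ∀ u → ∃ λ k → Within R keep k u
    reach u = within (conn u zero) refl
    x = bfs R keep reach
    s = bfs-section R keep reach
    t = bfs-tree R keep reach
    count-keep : sumFin m (bit ∘ keep) ≡ n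
    count-keep = trans (sym (count-sumFin keep (λ e → e))) (ℕP.suc-injective (trans (ℕP.+-comm 1 _) count))
    tree≤keep : ∀ e → bit ⌊ onTree? R x s e ⌋ ℕ.≤ bit (keep e)
    tree≤keep e with onTree? R x s e
    ... | yes o = ℕP.≤-reflexive (cong bit (sym (bfs-keep R keep reach e o)))
    ... | no _ = ℕ.z≤n
    tree≡keep : ∀ e → bit ⌊ onTree? R x s e ⌋ ≡ bit (keep e)
    tree≡keep = sumFin-≤-≡ m tree≤keep (trans (tree-count R x s t) (sym count-keep))
    unkept : Fin m → ℕ
    unkept e = bit (not (keep e))
    unkept+keep : sumFin m unkept ℕ.+ n ≡ m
    unkept+keep = trans (cong (sumFin m unkept ℕ.+_) (sym count-keep)) (trans (sym (sumFin-+ m unkept (bit ∘ keep)))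
      (trans (sumFin-cong m (λ e → complement (keep e))) (sumFin-1 m)))
      where
      complement : ∀ b → bit (not b) ℕ.+ bit b ≡ 1
      complement true = refl
      complement false = refl
    unkept≤marks : ∀ e → unkept e ℕ.≤ marksAt S e
    unkept≤marks e = at (lookup S (e ↑ˡ m)) (lookup S (m ↑ʳ e))
      where
      at : ∀ a c → bit (not (not a ∧ not c)) ℕ.≤ bit a ℕ.+ bit c
      at true c = ℕ.s≤s ℕ.z≤n
      at false true = ℕ.s≤s ℕ.z≤n
      at false false = ℕ.z≤n
    unkept≡marks : ∀ e → unkept e ≡ marksAt S e
    unkept≡marks = sumFin-≤-≡ m unkept≤marks (trans
      (trans (sym (ℕP.m+n∸n≡m (sumFin m unkept) n)) (cong (ℕ._∸ n) unkept+keep))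
      (trans (sym betti) (trans b (trans (sym total) (kAt-total S)))))
    marking : ∀ e → Marking ends x s S e
    marking e with onTree? R x s e | tree≡keep e
    ... | yes o | p = inj₁ (o , bit-∧ _ _ (sym p))
    ... | no ¬o | p = inj₂ (¬o , at (lookup S (e ↑ˡ m)) (lookup S (m ↑ʳ e)) refl refl p (unkept≡marks e))
      where
      at : ∀ a c → lookup S (e ↑ˡ m) ≡ a → lookup S (m ↑ʳ e) ≡ c → 0 ≡ bit (keep e) → unkept e ≡ marksAt S e → OneHalf ends x s S e
      at true false p q _ _ = inj₁ (p , q)
      at false true p q _ _ = inj₂ (p , q)
      at true true p q _ eq rewrite p | q = contradiction eq λ ()
      at false false p q eq _ rewrite p | q = contradiction eq λ ()

-- Cardinalities as sums, and rotations with a leaf.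

same-members : ∀ {A : Set} {xs ys : List A} → Unique xs → Unique ys →
               (∀ {x} → x ∈ xs → x ∈ ys) → (∀ {x} → x ∈ ys → x ∈ xs) → xs ↭ ys
same-members u u′ f g = ∼bag⇒↭ (unique∧set⇒bag u u′ (mk⇔ f g))

∑-filter : ∀ {A : Set} {P : A → Set} (P? : ∀ x → Dec (P x)) xs (f : A → ℚ) →
           (∀ x → ¬ P x → f x ≡ 0ℚ) → ∑ xs f ≡ ∑ (List.filter P? xs) f
∑-filter P? [] f z = refl
∑-filter P? (x ∷ xs) f z with P? x
... | yes _ = cong (f x +_) (∑-filter P? xs f z)
... | no ¬p = trans (cong₂ _+_ (z x ¬p) (∑-filter P? xs f z)) (ℚP.+-identityˡ _)

∑-indicator : ∀ {A : Set} {P : A → Set} (P? : ∀ x → Dec (P x)) xs →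
              ∑ xs (λ x → indicator (P? x)) ≡ ⟦ length (List.filter P? xs) ⟧
∑-indicator P? [] = refl
∑-indicator P? (x ∷ xs) with P? x
... | yes _ = cong (1ℚ +_) (∑-indicator P? xs)
... | no _ = trans (ℚP.+-identityˡ _) (∑-indicator P? xs)

∑-const : ∀ {A : Set} (xs : List A) c → ∑ xs (λ _ → c) ≡ ⟦ length xs ⟧ * c
∑-const [] c = sym (ℚP.*-zeroˡ c)
∑-const (x ∷ xs) c = trans (cong (c +_) (∑-const xs c)) (lemma c ⟦ length xs ⟧)
  where
  lemma : ∀ c k → c + k * c ≡ (1ℚ + k) * c
  lemma = solve-∀ ring

∑-1 : ∀ {A : Set} (xs : List A) → ∑ xs (λ _ → 1ℚ) ≡ ⟦ length xs ⟧
∑-1 xs = trans (∑-const xs 1ℚ) (ℚP.*-identityʳ ⟦ length xs ⟧)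

cycles-count : ∀ {N} (a : Fin N) A b → ∑ (cycles (a ∷ A) b) (λ _ → 1ℚ) ≡ fac (length A)
cycles-count a [] b = refl
cycles-count a A@(c ∷ A₁) b = begin
  ∑ (concatMap (λ b′ → map (λ c → ins a c b′) A) (cycles A b)) (λ _ → 1ℚ)
    ≡⟨ ∑-concatMap (cycles A b) (λ b′ → map (λ c → ins a c b′) A) (λ _ → 1ℚ) ⟩
  ∑ (cycles A b) (λ b′ → ∑ (map (λ c → ins a c b′) A) (λ _ → 1ℚ))
    ≡⟨ ∑-cong (cycles A b) (λ {b′} _ → trans (∑-map A (λ c → ins a c b′) (λ _ → 1ℚ)) (trans (∑-1 A) (sym (ℚP.*-identityʳ ⟦ length A ⟧)))) ⟩
  ∑ (cycles A b) (λ _ → ⟦ length A ⟧ * 1ℚ) ≡⟨ ∑-* (cycles A b) ⟦ length A ⟧ (λ _ → 1ℚ) ⟩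
  ⟦ length A ⟧ * ∑ (cycles A b) (λ _ → 1ℚ) ≡⟨ cong (⟦ length A ⟧ *_) (cycles-count c A₁ b) ⟩
  ⟦ length A ⟧ * fac (length A₁) ∎

cyclesAll-count : ∀ {N} (Ks : List (List (Fin N))) → All (_≢ []) Ks → ∀ b →
                  ∑ (cyclesAll Ks b) (λ _ → 1ℚ) ≡ cyclicOrdersAll Ks
cyclesAll-count [] [] b = refl
cyclesAll-count ([] ∷ Ks) (ne ∷ _) b = contradiction refl ne
cyclesAll-count (K@(a ∷ A) ∷ Ks) (_ ∷ nes) b = begin
  ∑ (concatMap (cycles K) (cyclesAll Ks b)) (λ _ → 1ℚ) ≡⟨ ∑-concatMap (cyclesAll Ks b) (cycles K) (λ _ → 1ℚ) ⟩
  ∑ (cyclesAll Ks b) (λ b′ → ∑ (cycles K b′) (λ _ → 1ℚ))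
    ≡⟨ ∑-cong (cyclesAll Ks b) (λ {b′} _ → trans (cycles-count a A b′) (sym (ℚP.*-identityʳ (fac (length A))))) ⟩
  ∑ (cyclesAll Ks b) (λ _ → fac (length A) * 1ℚ) ≡⟨ ∑-* (cyclesAll Ks b) (fac (length A)) (λ _ → 1ℚ) ⟩
  fac (length A) * ∑ (cyclesAll Ks b) (λ _ → 1ℚ) ≡⟨ cong (fac (length A) *_) (cyclesAll-count Ks nes b) ⟩
  fac (length A) * cyclicOrdersAll Ks ∎

-- The leaf is a fixed point, not yet inserted into the rotation at its vertex.
lift : ∀ {k} → Vec (Fin k) k → Vec (Fin (suc k)) (suc k)
lift ρ = zero ∷ Vec.map suc ρ

module _ {k : ℕ} where

  lift-↦ : ∀ (ρ : Vec (Fin k) k) h y → lift ρ [ suc h ↦ suc y ] ≡ lift (ρ [ h ↦ y ])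
  lift-↦ ρ h y = cong (zero ∷_) (sym (VecP.map-[]≔ suc ρ h))

  lift-ins : ∀ a c (ρ : Vec (Fin k) k) → ins (suc a) (suc c) (lift ρ) ≡ lift (ins a c ρ)
  lift-ins a c ρ = trans
    (cong (λ w → lift ρ [ suc a ↦ w ] [ suc c ↦ suc a ]) (VecP.lookup-map c suc ρ))
    (trans (cong (_[ suc c ↦ suc a ]) (lift-↦ ρ a (lookup ρ c))) (lift-↦ (ρ [ a ↦ lookup ρ c ]) c a))

  cycles-lift : ∀ A (ρ : Vec (Fin k) k) f → ∑ (cycles (map suc A) (lift ρ)) f ≡ ∑ (cycles A ρ) (f ∘ lift)
  cycles-lift [] ρ f = refl
  cycles-lift (a ∷ []) ρ f = cong (λ w → f w + 0ℚ) (lift-↦ ρ a a)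
  cycles-lift (a ∷ A@(_ ∷ _)) ρ f = begin
    ∑ (concatMap (λ b → map (λ c → ins (suc a) c b) (map suc A)) (cycles (map suc A) (lift ρ))) f
      ≡⟨ ∑-concatMap (cycles (map suc A) (lift ρ)) _ f ⟩
    ∑ (cycles (map suc A) (lift ρ)) (λ b → ∑ (map (λ c → ins (suc a) c b) (map suc A)) f)
      ≡⟨ cycles-lift A ρ _ ⟩
    ∑ (cycles A ρ) (λ ρ → ∑ (map (λ c → ins (suc a) c (lift ρ)) (map suc A)) f)
      ≡⟨ ∑-cong (cycles A ρ) (λ {ρ} _ → trans (∑-map (map suc A) _ f) (trans (∑-map A Fin.suc (λ c → f (ins (suc a) c (lift ρ))))
           (trans (∑-cong A (λ {c} _ → cong f (lift-ins a c ρ))) (sym (∑-map A (λ c → ins a c ρ) (f ∘ lift)))))) ⟩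
    ∑ (cycles A ρ) (λ ρ → ∑ (map (λ c → ins a c ρ) A) (f ∘ lift))
      ≡⟨ sym (∑-concatMap (cycles A ρ) _ (f ∘ lift)) ⟩
    ∑ (concatMap (λ ρ → map (λ c → ins a c ρ) A) (cycles A ρ)) (f ∘ lift) ∎

  cyclesAll-lift : ∀ Ks (ρ : Vec (Fin k) k) f →
    ∑ (cyclesAll (map (map suc) Ks) (lift ρ)) f ≡ ∑ (cyclesAll Ks ρ) (f ∘ lift)
  cyclesAll-lift [] ρ f = refl
  cyclesAll-lift (K ∷ Ks) ρ f = begin
    ∑ (concatMap (cycles (map suc K)) bs) f
      ≡⟨ ∑-concatMap bs (cycles (map suc K)) f ⟩
    ∑ bs (λ b → ∑ (cycles (map suc K) b) f) ≡⟨ cyclesAll-lift Ks ρ _ ⟩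
    ∑ (cyclesAll Ks ρ) (λ ρ → ∑ (cycles (map suc K) (lift ρ)) f)
      ≡⟨ ∑-cong (cyclesAll Ks ρ) (λ {ρ} _ → cycles-lift K ρ f) ⟩
    ∑ (cyclesAll Ks ρ) (λ ρ → ∑ (cycles K ρ) (f ∘ lift)) ≡⟨ sym (∑-concatMap (cyclesAll Ks ρ) (cycles K) (f ∘ lift)) ⟩
    ∑ (concatMap (cycles K) (cyclesAll Ks ρ)) (f ∘ lift) ∎
    where
    bs = cyclesAll (map (map suc) Ks) (lift ρ)

  -- The leaf heads its block, so it is inserted last: rotations with a leaf are rotations of the
  -- graph together with a place for the leaf.
  cyclesAll-leaf : ∀ K Ks (ρ : Vec (Fin k) k) f → K ≢ [] →
    ∑ (cyclesAll ((zero ∷ map suc K) ∷ map (map suc) Ks) (lift ρ)) f ≡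
    ∑ (cyclesAll (K ∷ Ks) ρ) (λ ρ → ∑ K (λ c → f (ins zero (suc c) (lift ρ))))
  cyclesAll-leaf [] Ks ρ f ne = contradiction refl ne
  cyclesAll-leaf K@(_ ∷ _) Ks ρ f ne = begin
    ∑ (concatMap (cycles (zero ∷ map suc K)) bs) f
      ≡⟨ ∑-concatMap bs (cycles (zero ∷ map suc K)) f ⟩
    ∑ bs (λ b → ∑ (cycles (zero ∷ map suc K) b) f)
      ≡⟨ ∑-cong bs (λ {b} _ →
           trans (∑-concatMap (cycles (map suc K) b) _ f)
             (∑-cong (cycles (map suc K) b) (λ {b′} _ → trans (∑-map (map suc K) _ f) (∑-map K Fin.suc (λ c → f (ins zero c b′)))))) ⟩
    ∑ bs (λ b → ∑ (cycles (map suc K) b) (λ b′ → ∑ K (λ c → f (ins zero (suc c) b′))))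
      ≡⟨ sym (∑-concatMap bs (cycles (map suc K)) _) ⟩
    ∑ (cyclesAll (map (map suc) (K ∷ Ks)) (lift ρ)) (λ b → ∑ K (λ c → f (ins zero (suc c) b)))
      ≡⟨ cyclesAll-lift (K ∷ Ks) ρ _ ⟩
    ∑ (cyclesAll (K ∷ Ks) ρ) (λ ρ → ∑ K (λ c → f (ins zero (suc c) (lift ρ)))) ∎
    where
    bs = cyclesAll (map (map suc) Ks) (lift ρ)

-- Orbits of an injective map are cycles.

module _ {k : ℕ} {f : Fin k → Fin k} (f-injective : ∀ {x y} → f x ≡ f y → x ≡ y) where

  private
    iterate-injective : ∀ i {x y} → iterate f i x ≡ iterate f i y → x ≡ y
    iterate-injective zero e = e
    iterate-injective (suc i) e = f-injective (iterate-injective i e)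

  -- Two of the first `k + 1` iterates agree, and injectivity cancels the steps common to both.
  Hit-return : ∀ x → Hit f (_≡ x) (f x)
  Hit-return x with pigeonhole (ℕP.n<1+n k) (λ (i : Fin (suc k)) → iterate f (Fin.toℕ i) x)
  ... | p , q , p<q , same with ℕP.m≤n⇒∃[o]m+o≡n p<q
  ...   | d , e = from-iterate f (_≡ x) d (iterate-injective (Fin.toℕ p)
          (sym (trans same (trans (cong (λ i → iterate f i x) (trans (sym e) (cong suc (ℕP.+-comm (Fin.toℕ p) d))))
            (iterate-+ f (suc d) (Fin.toℕ p) x)))))

  Hit-sym : ∀ {x y} → Hit f (_≡ y) x → Hit f (_≡ x) y
  Hit-sym (now refl) = now refl
  Hit-sym {x} (later refl h) = Hit-trans (Hit-sym h) (Hit-return x)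

Formula : Graph → ℕ → Set
Formula H g =
  (Es : List (Perm H)) → Unique Es → (∀ ρ → (ρ ∈ Es) ⇔ IsEmbedding H ρ) →
  (Fs : List (Perm H)) → Unique Fs → (∀ ρ → (ρ ∈ Fs) ⇔ (IsEmbedding H ρ × OneFaced H ρ)) →
  (Ds : List (Decoration H)) → Unique Ds → (∀ S → (S ∈ Ds) ⇔ IsDecoration H g S) →
  ⟦ length Fs ⟧ ≡ ∑ Ds (weight H g) * ⟦ length Es ⟧

-- The number of 1-faced embeddings.

module _ {n m : ℕ} (ends : Fin m → Fin (suc n) × Fin (suc n)) where

  private
    H : Graph
    H = G ends
    R : Rooting n (m ℕ.+ m) m
    R = rooting ends
    open module Rt = Rooting R using (v; j; l; r; j-invol; j-zero; cover)

    Half = Fin (m ℕ.+ m)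
    Choice = Vec (Fin (suc (m ℕ.+ m))) (suc n)

    vertices : List (Fin (suc n))
    vertices = List.allFin (suc n)

    edges : List (Fin m)
    edges = List.allFin m

    K : Fin (suc n) → List Half
    K u = List.filter (λ h → vert H h ≟ u) (List.allFin (m ℕ.+ m))

    K-unique : ∀ u → Unique (K u)
    K-unique u = UniqueP.filter⁺ (λ h → vert H h ≟ u) (UniqueP.allFin⁺ (m ℕ.+ m))

    K⇒vert : ∀ {u h} → h ∈ K u → vert H h ≡ u
    K⇒vert {u} i = proj₂ (∈-filter⁻ (λ h → vert H h ≟ u) {xs = List.allFin (m ℕ.+ m)} i)

    vert⇒K : ∀ {u h} → vert H h ≡ u → h ∈ K u
    vert⇒K {u} e = ∈-filter⁺ (λ h → vert H h ≟ u) (∈-allFin _) e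

    K⁺ : Fin (suc n) → List (Fin (suc (m ℕ.+ m)))
    K⁺ zero = zero ∷ map suc (K zero)
    K⁺ (suc u) = map suc (K (suc u))

    map-suc-unique : ∀ {xs : List Half} → Unique xs → Unique (map Fin.suc xs)
    map-suc-unique = UniqueP.map⁺ suc-injective

    K⁺-unique : ∀ u → Unique (K⁺ u)
    K⁺-unique zero = All.tabulate (λ i e → zero∉ (subst (_∈ map suc (K zero)) (sym e) i)) ∷ map-suc-unique (K-unique zero)
      where
      zero∉ : ∀ {xs : List Half} → zero ∉ map Fin.suc xs
      zero∉ i with ∈-map⁻ Fin.suc i
      ... | _ , _ , ()
    K⁺-unique (suc u) = map-suc-unique (K-unique (suc u))

    K⁺⇒v : ∀ {u h} → h ∈ K⁺ u → v h ≡ u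
    K⁺⇒v {zero} (here refl) = refl
    K⁺⇒v {zero} (there i) with ∈-map⁻ Fin.suc i
    ... | h , h∈ , refl = K⇒vert h∈
    K⁺⇒v {suc u} i with ∈-map⁻ Fin.suc i
    ... | h , h∈ , refl = K⇒vert h∈

    v⇒K⁺ : ∀ {u h} → v h ≡ u → h ∈ K⁺ u
    v⇒K⁺ {zero} {zero} e = here refl
    v⇒K⁺ {zero} {suc h} e = there (∈-map⁺ suc (vert⇒K e))
    v⇒K⁺ {suc u} {suc h} e = ∈-map⁺ suc (vert⇒K e)

    x₀ : Choice
    x₀ = Vec.replicate _ zero

    xs : List Choice
    xs = choices v K⁺ x₀ vertices

    xs-fibres : Fibres (_≡ x₀) (λ x → choices v K⁺ x vertices) (Chosen v K⁺ K⁺-unique K⁺⇒v v⇒K⁺ x₀ vertices)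
    xs-fibres = Fibres-choices v K⁺ K⁺-unique K⁺⇒v v⇒K⁺ x₀ vertices (UniqueP.allFin⁺ (suc n))

    xs-section : ∀ {x} → x ∈ xs → Section R x
    xs-section i u = proj₁ (xs-fibres .sound refl i) u (∈-allFin u)

    section-xs : ∀ {x} → Section R x → x ∈ xs
    section-xs {x} s with xs-fibres .complete {x} ((λ u _ → s u) , λ u ne → contradiction (∈-allFin u) ne)
    ... | _ , refl , i = i

    section? : ∀ x → Dec (Section R x)
    section? x = all? (λ u → v (lookup x u) ≟ u)

    treeMarks : Choice → List (Decoration H)
    treeMarks x with section? x | Tree? R x
    ... | yes s | yes _ = marks ends x s edges (∅ ends)
    ... | _ | _ = []

    treeMarks⁻ : ∀ x {S} → S ∈ treeMarks x → ∃ λ s → Tree R x × Marked ends x s edges S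
    treeMarks⁻ x i with section? x | Tree? R x
    ... | yes s | yes t = s , t , Fibres-marks ends x s edges (UniqueP.allFin⁺ m) .sound refl i

    treeMarks⁺ : ∀ x {S} (s : Section R x) → Tree R x → Marked ends x s edges S → S ∈ treeMarks x
    treeMarks⁺ x {S} s t M with section? x | Tree? R x
    ... | no ns | _ = contradiction s ns
    ... | yes _ | no nt = contradiction t nt
    ... | yes s′ | yes _ with Fibres-marks ends x s′ edges (UniqueP.allFin⁺ m) .complete {S} M
    ...   | _ , refl , i = i

    treeMarks-unique : ∀ x → Unique (treeMarks x)
    treeMarks-unique x with section? x | Tree? R x
    ... | yes s | yes t = Fibres-marks ends x s edges (UniqueP.allFin⁺ m) .unique refl
    ... | yes _ | no _ = []
    ... | no _ | _ = []

    -- The edges without a mark are those of the tree, and by `tree-unique` they determine the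
    -- choice `x`.
    treeMarks-disjoint : ∀ {x x′ S} → S ∈ treeMarks x → S ∈ treeMarks x′ → x ≡ x′
    treeMarks-disjoint {x} {x′} {S} i i′ with treeMarks⁻ x i | treeMarks⁻ x′ i′
    ... | s , t , M | s′ , t′ , M′ = tree-unique R s s′ t t′ λ e o → on e o (proj₁ M e (∈-allFin e)) (proj₁ M′ e (∈-allFin e))
      where
      clash : ∀ {e} → NoHalf ends x s S e → ¬ OneHalf ends x s S e
      clash (p , _) (inj₁ (q , _)) = contradiction (trans (sym p) q) λ ()
      clash (_ , p) (inj₂ (_ , q)) = contradiction (trans (sym p) q) λ ()
      on : ∀ e → OnTree R x s e → Marking ends x s S e → Marking ends x′ s′ S e → OnTree R x′ s′ e
      on e o _ (inj₁ (o′ , _)) = o′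
      on e o (inj₁ (_ , z)) (inj₂ (_ , one)) = ⊥-elim (clash z one)
      on e o (inj₂ (¬o , _)) (inj₂ _) = contradiction o ¬o

    markings : List (Decoration H)
    markings = concatMap treeMarks xs

    markings-unique : Unique markings
    markings-unique = Unique-concatMap treeMarks (xs-fibres .unique refl) (λ {x} _ → treeMarks-unique x) (λ _ _ → treeMarks-disjoint)

    Even : Decoration H → Set
    Even S = ∀ u → 2 ∣ kAt H S u

    Even? : ∀ S → Dec (Even S)
    Even? S = all? (λ u → 2 ∣? kAt H S u)

    ν-weight : Vec ℕ (suc n) → ℚ
    ν-weight = moments (Vec.replicate (suc n) 0)

    vK⁺ : ∀ u → All (λ h → v h ≡ u) (K⁺ u)
    vK⁺ u = All.tabulate K⁺⇒v

    all-blocks : ∀ h → h ∈ blocks v K⁺ vertices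
    all-blocks h = in-block vertices (∈-allFin (v h))
      where
      in-block : ∀ us → v h ∈ us → h ∈ blocks v K⁺ us
      in-block (u ∷ us) (here e) = ∈-++⁺ʳ (blocks v K⁺ us) (v⇒K⁺ e)
      in-block (w ∷ us) (there i) = ∈-++⁺ˡ (in-block us i)

    blocks-unique : ∀ us → Unique us → Unique (blocks v K⁺ us)
    blocks-unique [] _ = []
    blocks-unique (u ∷ us) (u∉ ∷ uus) = UniqueP.++⁺ (blocks-unique us uus) (K⁺-unique u)
      λ (i , k) → All.lookup (v-blocks v K⁺ K⁺-unique vK⁺ u∉) i (K⁺⇒v k)

    all-nodes : ∀ h → h ∈ zero ∷ halves R edges
    all-nodes h with cover h
    ... | inj₁ e = here e
    ... | inj₂ (e , inj₁ refl) = there (l∈halves R (∈-allFin e))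
    ... | inj₂ (e , inj₂ refl) = there (r∈halves R (∈-allFin e))

    nodes-unique : Unique (zero ∷ halves R edges)
    nodes-unique = zero∉halves R edges ∷ halves-unique R edges (UniqueP.allFin⁺ m)

    nodes-↭ : blocks v K⁺ vertices ↭ zero ∷ halves R edges
    nodes-↭ = same-members (blocks-unique vertices (UniqueP.allFin⁺ (suc n))) nodes-unique (λ {h} _ → all-nodes h) (λ {h} _ → all-blocks h)

    root : Vec (Fin (suc (m ℕ.+ m))) (suc (m ℕ.+ m)) → ℚ
    root = rooted j

    Scatter-marks : ∀ {x} → x ∈ xs → ∀ b →
      Scatter v x (blocks v K⁺ vertices) (λ b κ → W κ * root b) b (Vec.replicate _ 0) ≡ ∑ (treeMarks x) (ν-weight ∘ kVec ends)
    Scatter-marks {x} i b with section? x | Tree? R x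
    ... | no ns | _ = contradiction (xs-section i) ns
    ... | yes s | no nt = Scatter-¬tree R x s (blocks v K⁺ vertices) all-blocks nt b (Vec.replicate _ 0)
    ... | yes s | yes t = begin
      Scatter v x (blocks v K⁺ vertices) F b κ₀
        -- From the order by vertices to the order by edges, where the two halves of an edge are
        -- adjacent.
        ≡⟨ Scatter-↭ v nodes-↭ (blocks-unique vertices (UniqueP.allFin⁺ (suc n))) x F b κ₀ ⟩
      Scatter v x (zero ∷ halves R edges) F b κ₀
        ≡⟨ Scatter-tree R x s t edges (UniqueP.allFin⁺ m) ∈-allFin b κ₀ ⟩
      orient₃ R x s edges W κ₀ ≡⟨ orient₃≡orient₂ R x s edges κ₀ κ₀ ⟩
      orient₂ R x s edges ν-weight κ₀ ≡⟨ cong (orient₂ R x s edges ν-weight) (sym (kVec-∅ ends)) ⟩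
      orient₂ R x s edges ν-weight (kVec ends (∅ ends)) ≡⟨ orient₂-marks ends x s edges (UniqueP.allFin⁺ m) ν-weight ⟩
      ∑ (marks ends x s edges (∅ ends)) (ν-weight ∘ kVec ends) ∎
      where
      F : Vec (Fin (suc (m ℕ.+ m))) (suc (m ℕ.+ m)) → Vec ℕ (suc n) → ℚ
      F b κ = W κ * root b
      κ₀ : Vec ℕ (suc n)
      κ₀ = Vec.replicate _ 0

    even-markings : List (Decoration H)
    even-markings = List.filter Even? markings

    even-markings⁻ : ∀ {S} → S ∈ even-markings → (∃ λ x → S ∈ treeMarks x) × Even S
    even-markings⁻ i with ∈-filter⁻ Even? {xs = markings} i
    ... | i′ , even with find (∈-concatMap⁻ treeMarks {xs = xs} i′)
    ...   | x , _ , i″ = (x , i″) , even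

  module _ {g} (b₁ : firstBetti H ≡ 2 ℕ.* g) (Ds : List (Decoration H)) (uDs : Unique Ds)
           (Ds⇔ : ∀ S → S ∈ Ds ⇔ IsDecoration H g S) where

    private
      marking-decoration : ∀ {S} → S ∈ even-markings → IsDecoration H g S
      marking-decoration {S} i with even-markings⁻ i
      ... | (x , i′) , even with treeMarks⁻ x i′
      ...   | s , t , M = marked-decoration ends {x} s t {S} M g b₁ even

      decoration-marking : ∀ {S} → IsDecoration H g S → S ∈ even-markings
      decoration-marking {S} d with decoration-marked ends {g} {S} b₁ d
      ... | x , s , t , M = ∈-filter⁺ Even? (∈-concatMap⁺ treeMarks (lose (section-xs {x} s) (treeMarks⁺ x s t M))) (proj₁ d)

      not-even : ∀ S → ¬ Even S → ν-weight (kVec ends S) ≡ 0ℚ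
      not-even S ne with ¬∀⟶∃¬ (suc n) (λ u → 2 ∣ kAt H S u) (λ u → 2 ∣? kAt H S u) ne
      ... | u , odd = moments-odd (suc n) (kAt H S) u odd

    spread-decorations : ∀ b → spreadAll (map K⁺ vertices) root b ≡ ∑ Ds (weight H g)
    spread-decorations b = begin
      spreadAll (map K⁺ vertices) root b ≡⟨ sym (ℚP.*-identityˡ _) ⟩
      1ℚ * spreadAll (map K⁺ vertices) root b
        ≡⟨ cong (_* spreadAll (map K⁺ vertices) root b) (sym (W-0 (suc n))) ⟩
      W κ₀ * spreadAll (map K⁺ vertices) root b
        ≡⟨ spreadAll-Scatter v K⁺ K⁺-unique vK⁺ x₀ vertices (UniqueP.allFin⁺ (suc n)) root b κ₀ (All.tabulate λ {u} _ → VecP.lookup-replicate u 0) ⟩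
      ∑ xs (λ x → Scatter v x (blocks v K⁺ vertices) (λ b κ → W κ * root b) b κ₀) ≡⟨ ∑-cong xs (λ i → Scatter-marks i b) ⟩
      ∑ xs (λ x → ∑ (treeMarks x) (ν-weight ∘ kVec ends)) ≡⟨ sym (∑-concatMap xs treeMarks (ν-weight ∘ kVec ends)) ⟩
      -- A marking with an odd count at some vertex has weight zero, because the odd moments of `t`
      -- vanish.
      ∑ markings (ν-weight ∘ kVec ends) ≡⟨ ∑-filter Even? markings (ν-weight ∘ kVec ends) not-even ⟩
      ∑ even-markings (ν-weight ∘ kVec ends)
        ≡⟨ ∑-cong even-markings (λ {S} i → let even , total , _ = marking-decoration i in moments-weight ends g S even total) ⟩
      ∑ even-markings (weight H g)
        ≡⟨ ∑-↭ (weight H g) (same-members (UniqueP.filter⁺ Even? markings-unique) uDs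
             (λ {S} i → Equivalence.from (Ds⇔ S) (marking-decoration i)) (λ {S} i → decoration-marking (Equivalence.to (Ds⇔ S) i))) ⟩
      ∑ Ds (weight H g) ∎
      where
      κ₀ : Vec ℕ (suc n)
      κ₀ = Vec.replicate _ 0

  private
    iter-shift : ∀ (f : Half → Half) k h → iter H f k (f h) ≡ f (iter H f k h)
    iter-shift f zero h = refl
    iter-shift f (suc k) h = cong f (iter-shift f k h)

    hit-iter : ∀ (f : Half → Half) {h h′} → Hit f (_≡ h′) h → ∃ λ k → iter H f k h ≡ h′
    hit-iter f (now e) = 0 , e
    hit-iter f {h} (later refl p) = let k , e = hit-iter f p in suc k , trans (sym (iter-shift f k h)) e

    iter-hit : ∀ (f : Half → Half) k {h h′} → iter H f k h ≡ h′ → Hit f (_≡ h′) h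
    iter-hit f zero e = now e
    iter-hit f (suc k) {h} e = later refl (iter-hit f k (trans (iter-shift f k h) e))

    vK : ∀ u → All (λ h → vert H h ≡ u) (K u)
    vK u = All.tabulate K⇒vert

    identity : Perm H
    identity = Vec.tabulate (λ h → h)

    embeddings : List (Perm H)
    embeddings = cyclesAll (map K vertices) identity

    all-half : List Half
    all-half = joined (vert H) K K-unique vK vertices

    ∈-all-half : ∀ h → h ∈ all-half
    ∈-all-half h = in-joined vertices (∈-allFin (vert H h))
      where
      in-joined : ∀ us → vert H h ∈ us → h ∈ joined (vert H) K K-unique vK us
      in-joined (u ∷ us) (here e) = ∈-++⁺ˡ (vert⇒K e)
      in-joined (u ∷ us) (there i) = ∈-++⁺ʳ (K u) (in-joined us i)

    embeddings-fibres : Fibres (Emb (vert H) []) (cyclesAll (map K vertices)) (Emb (vert H) all-half)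
    embeddings-fibres = Fibres-cyclesAll (vert H) K K-unique vK vertices (UniqueP.allFin⁺ (suc n))

    identity-Emb : Emb (vert H) [] identity
    identity-Emb = record
      { injective = λ {h} {h′} e → trans (sym (at h)) (trans e (at h′))
      ; fixes = λ {h} _ → at h
      ; preserves = λ h → cong (vert H) (at h)
      ; transitive = λ () }
      where
      at : ∀ h → lookup identity h ≡ h
      at = VecP.lookup∘tabulate (λ h → h)

    Emb-identity : ∀ {b} → Emb (vert H) [] b → b ≡ identity
    Emb-identity E = Vec-ext λ h → trans (Emb.fixes E λ ()) (sym (VecP.lookup∘tabulate (λ h → h) h))

    embeddings⁻ : ∀ {ρ} → ρ ∈ embeddings → IsEmbedding H ρ
    embeddings⁻ {ρ} i = (λ h h′ → Emb.injective E) , Emb.preserves E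
      , λ h h′ e → hit-iter (lookup ρ) (Emb.transitive E (∈-all-half h) (∈-all-half h′) e)
      where
      E : Emb (vert H) all-half ρ
      E = embeddings-fibres .sound identity-Emb i

    embeddings⁺ : ∀ {ρ} → IsEmbedding H ρ → ρ ∈ embeddings
    embeddings⁺ {ρ} (inj , pres , tr) with embeddings-fibres .complete {ρ} E
      where
      E : Emb (vert H) all-half ρ
      E = record
        { injective = inj _ _
        ; fixes = λ {h} ni → contradiction (∈-all-half h) ni
        ; preserves = pres
        ; transitive = λ {h} {h′} _ _ e → let k , p = tr h h′ e in iter-hit (lookup ρ) k p }
    ... | b , E , i = subst (λ b → ρ ∈ cyclesAll (map K vertices) b) (Emb-identity E) i

    embeddings-unique : Unique embeddings
    embeddings-unique = embeddings-fibres .unique identity-Emb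

    OneFaced? : ∀ ρ → Dec (OneFaced H ρ)
    OneFaced? ρ = all? λ h → all? λ h′ → map′ (hit-iter (facePerm H ρ)) (λ (k , e) → iter-hit (facePerm H ρ) k e)
      (Hit? (facePerm H ρ) (_≡ h′) (_≟ h′) h)

    module _ {ρ : Perm H} (ρ-injective : IsPermutation H ρ) (c : Half) where

      face : Half → Half
      face = facePerm H ρ

      face-injective : ∀ {h h′} → face h ≡ face h′ → h ≡ h′
      face-injective {h} {h′} e = trans (sym (ι-involutive ends h)) (trans (cong (ι H) (ρ-injective _ _ e)) (ι-involutive ends h′))

      with-leaf : Vec (Fin (suc (m ℕ.+ m))) (suc (m ℕ.+ m))
      with-leaf = ins zero (suc c) (lift ρ)

      step : Fin (suc (m ℕ.+ m)) → Fin (suc (m ℕ.+ m))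
      step = next j with-leaf

      step-c : ∀ {d} → ι H d ≡ c → step (suc d) ≡ zero
      step-c refl = lookup-↦ (suc c) (lift ρ [ zero ↦ suc (lookup ρ c) ]) zero

      step-other : ∀ {d} → ι H d ≢ c → step (suc d) ≡ suc (face d)
      step-other {d} ne = trans (lookup-keep (ι H d) c ne (Vec.map suc ρ)) (VecP.lookup-map (ι H d) suc ρ)

      to-leaf : ∀ {d} → Hit face (_≡ ι H c) d → Hit step (_≡ zero) (suc d)
      to-leaf (now refl) = later (step-c (ι-involutive ends c)) (now refl)
      to-leaf {d} (later refl p) with ι H d ≟ c
      ... | yes e = later (step-c e) (now refl)
      ... | no ne = later (step-other ne) (to-leaf p)

      from-leaf : ∀ {z d} → z ≡ suc d → Hit step (_≡ zero) z → Hit face (_≡ ι H c) d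
      from-leaf refl (now ())
      from-leaf {d = d} refl (later e p) with ι H d ≟ c
      ... | yes e′ = now (trans (sym (ι-involutive ends d)) (cong (ι H) e′))
      ... | no ne = later refl (from-leaf (trans (sym e) (step-other ne)) p)

      -- With the leaf placed after `c`, a path runs along its face until it meets `ι c` and then
      -- ends in the leaf. Faces are cycles, so if all of them reach `ι c`, there is only one.
      leaf-one-faced : root with-leaf ≡ indicator (OneFaced? ρ)
      leaf-one-faced = indicator-⇔ (Rooted? j with-leaf) (OneFaced? ρ)
        (λ rt h h′ → hit-iter face (Hit-trans (from-leaf refl (rt (suc h))) (Hit-sym face-injective (from-leaf refl (rt (suc h′))))))
        (λ { one zero → now refl ; one (suc d) → let k , e = one d (ι H c) in to-leaf (iter-hit face k e) })

    leaf-sum : ∀ f → K zero ≢ [] →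
      ∑ (cyclesAll (map K⁺ vertices) (lift identity)) f ≡ ∑ embeddings (λ ρ → ∑ (K zero) (λ c → f (ins zero (suc c) (lift ρ))))
    leaf-sum f ne = trans
      (cong (λ Ks → ∑ (cyclesAll (K⁺ zero ∷ Ks) (lift identity)) f) blocks≡)
      (cyclesAll-leaf (K zero) (map K (List.tabulate suc)) identity f ne)
      where
      blocks≡ : map K⁺ (List.tabulate suc) ≡ map (map suc) (map K (List.tabulate suc))
      blocks≡ = trans (ListP.map-tabulate suc K⁺)
        (sym (trans (cong (map (map suc)) (ListP.map-tabulate suc K)) (ListP.map-tabulate (K ∘ suc) (map suc))))

  -- Each embedding offers `length (K zero)` places for the leaf, and rootedness is the same for all
  -- of them. This factor appears on both sides; it is not zero, since every vertex carries a
  -- half-edge.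
  one-faced-count : ∀ g → (∀ u → ∃ λ h → vert H h ≡ u) → firstBetti H ≡ 2 ℕ.* g → Formula H g
  one-faced-count g inhabited b₁ Es uEs Es⇔ Fs uFs Fs⇔ Ds uDs Ds⇔ = cancel (K zero) (K≢[] zero) (begin
    ⟦ length (K zero) ⟧ * ⟦ length Fs ⟧ ≡⟨ cong (⟦ length (K zero) ⟧ *_) (trans (cong ⟦_⟧ (↭-length Fs↭)) (sym (∑-indicator OneFaced? embeddings))) ⟩
    ⟦ length (K zero) ⟧ * ∑ embeddings (λ ρ → indicator (OneFaced? ρ)) ≡⟨ sym (∑-* embeddings ⟦ length (K zero) ⟧ (λ ρ → indicator (OneFaced? ρ))) ⟩
    ∑ embeddings (λ ρ → ⟦ length (K zero) ⟧ * indicator (OneFaced? ρ))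
      ≡⟨ ∑-cong embeddings (λ {ρ} i → trans (sym (∑-const (K zero) (indicator (OneFaced? ρ))))
           (∑-cong (K zero) (λ {c} _ → sym (leaf-one-faced (proj₁ (embeddings⁻ i)) c)))) ⟩
    ∑ embeddings (λ ρ → ∑ (K zero) (λ c → root (ins zero (suc c) (lift ρ)))) ≡⟨ sym (leaf-sum root (K≢[] zero)) ⟩
    ∑ (cyclesAll (map K⁺ vertices) (lift identity)) root
      ≡⟨ cyclesAll-sum (map K⁺ vertices) (Star-rooted j j-invol j-zero) (All.tabulate λ i → K⁺-good (∈-map⁻ K⁺ i)) (lift identity) ⟩
    cyclicOrdersAll (map K⁺ vertices) * spreadAll (map K⁺ vertices) root (lift identity)
      ≡⟨ cong₂ _*_ (sym (cyclesAll-count (map K⁺ vertices) (All.tabulate λ i → proj₁ (K⁺-good (∈-map⁻ K⁺ i))) (lift identity)))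
           (spread-decorations {g} b₁ Ds uDs Ds⇔ (lift identity)) ⟩
    ∑ (cyclesAll (map K⁺ vertices) (lift identity)) (λ _ → 1ℚ) * ∑ Ds (weight H g)
      ≡⟨ cong (_* ∑ Ds (weight H g)) (leaf-sum (λ _ → 1ℚ) (K≢[] zero)) ⟩
    ∑ embeddings (λ ρ → ∑ (K zero) (λ c → 1ℚ)) * ∑ Ds (weight H g)
      ≡⟨ cong (_* ∑ Ds (weight H g)) (trans (∑-cong embeddings (λ _ → ∑-1 (K zero))) (∑-const embeddings ⟦ length (K zero) ⟧)) ⟩
    (⟦ length embeddings ⟧ * ⟦ length (K zero) ⟧) * ∑ Ds (weight H g)
      ≡⟨ cong (λ k → (⟦ k ⟧ * ⟦ length (K zero) ⟧) * ∑ Ds (weight H g)) (sym (↭-length Es↭)) ⟩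
    (⟦ length Es ⟧ * ⟦ length (K zero) ⟧) * ∑ Ds (weight H g) ≡⟨ shuffle ⟦ length Es ⟧ ⟦ length (K zero) ⟧ (∑ Ds (weight H g)) ⟩
    ⟦ length (K zero) ⟧ * (∑ Ds (weight H g) * ⟦ length Es ⟧) ∎)
    where
    shuffle : ∀ a b c → (a * b) * c ≡ b * (c * a)
    shuffle = solve-∀ ring
    K≢[] : ∀ u → K u ≢ []
    K≢[] u e with inhabited u
    ... | h , p with subst (h ∈_) e (vert⇒K p)
    ...   | ()
    K⁺≢[] : ∀ u → K⁺ u ≢ []
    K⁺≢[] (suc u) e with K (suc u) | K≢[] (suc u)
    K⁺≢[] (suc u) e | [] | ne = ne refl
    K⁺-good : ∀ {A} → (∃ λ u → u ∈ vertices × A ≡ K⁺ u) → A ≢ [] × Unique A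
    K⁺-good (u , _ , refl) = K⁺≢[] u , K⁺-unique u
    Es↭ : Es ↭ embeddings
    Es↭ = same-members uEs embeddings-unique (λ {ρ} i → embeddings⁺ (Equivalence.to (Es⇔ ρ) i)) (λ {ρ} i → Equivalence.from (Es⇔ ρ) (embeddings⁻ i))
    Fs↭ : Fs ↭ List.filter OneFaced? embeddings
    Fs↭ = same-members uFs (UniqueP.filter⁺ OneFaced? embeddings-unique)
      (λ {ρ} i → let e , o = Equivalence.to (Fs⇔ ρ) i in ∈-filter⁺ OneFaced? (embeddings⁺ e) o)
      (λ {ρ} i → let i′ , o = ∈-filter⁻ OneFaced? {xs = embeddings} i in Equivalence.from (Fs⇔ ρ) (embeddings⁻ i′ , o))
    cancel : ∀ (A : List Half) → A ≢ [] → ∀ {x y} → ⟦ length A ⟧ * x ≡ ⟦ length A ⟧ * y → x ≡ y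
    cancel [] ne = contradiction refl ne
    cancel (_ ∷ A) _ {x} {y} e = trans (sym (back x)) (trans (cong (recip (length A) *_) e) (back y))
      where
      back : ∀ x → recip (length A) * (⟦ suc (length A) ⟧ * x) ≡ x
      back x = trans (lemma (recip (length A)) ⟦ suc (length A) ⟧ x) (trans (cong (_* x) (⟦⟧-inverse (length A))) (ℚP.*-identityˡ x))
        where
        lemma : ∀ q k x → q * (k * x) ≡ (k * q) * x
        lemma = solve-∀ ring

-- A vertex without half-edges has no place for the leaf. The empty rotation is the only embedding
-- and vacuously 1-faced, and the empty decoration has weight 1.
edgeless : ∀ (ends : Fin 0 → Fin 1 × Fin 1) → Formula (G ends) 0
edgeless ends Es uEs Es⇔ Fs uFs Fs⇔ Ds uDs Ds⇔ = trans
  (cong ⟦_⟧ (↭-length (only uFs (Equivalence.from (Fs⇔ []) (((λ ()) , (λ ()) , λ ()) , λ ())))))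
  (sym (cong₂ (λ w k → w * ⟦ k ⟧)
    (∑-↭ (weight (G ends) 0) (only uDs (Equivalence.from (Ds⇔ []) ((λ _ → 2 ∣0) , refl , (λ { zero zero → here }) , refl))))
    (↭-length (only uEs (Equivalence.from (Es⇔ []) ((λ ()) , (λ ()) , λ ()))))))
  where
  only : ∀ {A : Set} {xs : List (Vec A 0)} → Unique xs → [] ∈ xs → xs ↭ [] ∷ []
  only u i = same-members u ([] ∷ []) (λ { {[]} _ → here refl }) (λ { (here refl) → i })

theorem2 : (G : Graph) (g : ℕ) → Connected G → firstBetti G ≡ 2 ℕ.* g →
    (Es : List (Perm G)) → Unique Es → (∀ ρ → (ρ ∈ Es) ⇔ IsEmbedding G ρ) →
    (Fs : List (Perm G)) → Unique Fs → (∀ ρ → (ρ ∈ Fs) ⇔ (IsEmbedding G ρ × OneFaced G ρ)) →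
    (Ds : List (Decoration G)) → Unique Ds → (∀ S → (S ∈ Ds) ⇔ IsDecoration G g S) →
    (ℤ.+ length Fs ℚ./ 1) ≡ sumℚ (map (weight G g) Ds) ℚ.* (ℤ.+ length Es ℚ./ 1)
theorem2 record { n = suc n ; m = m ; ends = ends } g (_ , conn) b₁ Es uEs Es⇔ Fs uFs Fs⇔ Ds uDs Ds⇔ =
  trans (sym (⟦⟧-/1 (length Fs)))
    (trans (count n m ends conn g b₁ Es uEs Es⇔ Fs uFs Fs⇔ Ds uDs Ds⇔)
      (cong (sumℚ (map (weight (G ends) g) Ds) *_) (⟦⟧-/1 (length Es))))
  where
  vert-reach : ∀ {n m} (ends : Fin m → Fin (suc n) × Fin (suc n)) {keep u w} →
               Reach (G ends) keep u w → (∃ λ h → vert (G ends) h ≡ w) → ∃ λ h → vert (G ends) h ≡ u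
  vert-reach ends here p = p
  vert-reach {m = m} ends (fwd e _ _) _ = e ↑ˡ m , vert-l ends e
  vert-reach {m = m} ends (bwd e _ _) _ = m ↑ʳ e , vert-r ends e
  no-edges : ∀ {n} (ends : Fin 0 → Fin (suc n) × Fin (suc n)) {keep u w} → Reach (G ends) keep u w → u ≡ w
  no-edges ends here = refl
  no-edges ends (fwd () _ _)
  no-edges ends (bwd () _ _)
  count : ∀ n m (ends : Fin m → Fin (suc n) × Fin (suc n)) → ConnectedVia (G ends) (λ _ → true) →
          ∀ g → firstBetti (G ends) ≡ 2 ℕ.* g → Formula (G ends) g
  count zero zero ends conn zero b₁ = edgeless ends
  count (suc n) zero ends conn g b₁ = contradiction (no-edges ends (conn zero (suc zero))) λ ()
  -- As there is an edge, connectedness provides a half-edge at every vertex.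
  count n (suc m) ends conn g b₁ =
    one-faced-count ends g (λ u → vert-reach ends (conn u (vert (G ends) (zero ↑ˡ suc m))) (zero ↑ˡ suc m , refl)) b₁
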